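{- For any $n$-core $\lambda$, $\mathfrak S^{(n)}_\lambda=\sum_{A\in ABC(\lambda)}x^{\mathrm{weight}(A)}$. Precisely: for every $r\ge1$ and every composition $\alpha=(\alpha_1,\dots,\alpha_r)$ with $0\le\alpha_i<n$ and $|\alpha|=\deg\lambda$, the number of affine Bruhat countertableaux of shape $\lambda$ and weight $\alpha$ equals the number of affine factorizations of $w_\lambda$ of weight $\alpha$ (both sides of the generating-function identity being read with weights identified modulo trailing zeros).
   Context: Fix $n\ge2$. $\tilde S_n$ is the affine symmetric group with generators $s_0,\dots,s_{n-1}$ (indices mod $n$) and the affine type-$A$ Coxeter relations; $\ell$ is length. An element is cyclically decreasing if it has a reduced word in which each index occurs at most once and $i+1$ precedes $i$ whenever both occur. For $w\in\tilde S_n$ and a composition $\alpha=(\alpha_1,\dots,\alpha_r)$ with parts $<n$ and $|\alpha|=\ell(w)$, an affine factorization of $w$ of weight $\alpha$ is a decomposition $w=v^r\cdots v^1$ with each $v^i$ cyclically decreasing of length $\alpha_i$. For an $n$-core $\lambda$, $\mathfrak S^{(n)}_\lambda=\sum x_1^{\ell(v^1)}x_2^{\ell(v^2)}\cdots$ summed over affine factorizations $w_\lambda=\cdots v^2v^1$. Partitions are in French convention ($\lambda_1$ the bottom row; $(a,\lambda)$ is the partition with bottom row $a$ then the rows of $\lambda$); the cell in row $i$, column $j$ has $n$-residue $j-i\bmod n$. An $n$-core is a partition with no hook length $n$. $s_i$ acts on an $n$-core having an addable corner of residue $i$ by adding all such corners; this gives a bijection $w\mapsto\mathfrak a(w)=s_{i_1}\cdots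 s_{i_\ell}\emptyset$ (reduced word) from affine Grassmannian elements (minimal length representatives of $\tilde S_n/\langle s_1,\dots,s_{n-1}\rangle$) to $n$-cores; $w_\lambda=\mathfrak a^{ -1}(\lambda)$, $\deg\lambda=\ell(w_\lambda)$. For cores, $\mu\lessdot_B\gamma$ iff $\mu\subset\gamma$ and $\deg\gamma=\deg\mu+1$. $R(n-1,\lambda)=(\lambda_1+n-1,\lambda)$. $(\lambda,\nu)$ is a horizontal strong $k$-strip if $\lambda\subset\nu$, $k=n-1+\deg\lambda-\deg\nu$, and there is a saturated chain $\nu=\nu^{(0)}\lessdot_B\cdots\lessdot_B\nu^{(k)}=R(n-1,\lambda)$ with strictly increasing bottom rows. An affine Bruhat countertableau (ABC) of shape $\lambda^{(r)}$ and weight $\alpha=(\alpha_1,\dots,\alpha_r)$ ($\alpha_i<n$, $|\alpha|=\deg\lambda^{(r)}$) is a chain of partitions $\lambda^{(r)}=\mu^{(0)}\subset\cdots\subset\mu^{(r)}$ with each $\mu^{(x)}/\mu^{(x-1)}$ a horizontal strip (at most one cell per column) and $\mu^{(x)}=(\mu^{(1)}_1,\dots,\mu^{(x-1)}_{x-1},\lambda^{(r-x)}_1+n-1,\lambda^{(r-x)})$, where $\emptyset=\lambda^{(0)}\subset\cdots\subset\lambda^{(r)}$ are $n$-cores with $(\lambda^{(x-1)},\lambda^{(x)})$ a horizontal strong $(n-1-\alpha_x)$-strip for all $x$. $ABC(\lambda)$ is the set of ABCs of shape $\lambda$ over all weights, and $x^{\mathrm{weight}(A)}=x_1^{\alpha_1}\cdots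 x_r^{\alpha_r}$. -}

module Defs where

open import Data.Nat using (ℕ; zero; suc; _+_; _*_; _∸_; _≤_; _<_; _≤?_; NonZero)
open import Data.Nat.DivMod using (_mod_)
open import Data.Integer as ℤ using (ℤ; +_)
open import Data.Fin as F using (Fin; toℕ; fromℕ; inject₁)
open import Data.Vec as V using (Vec; lookup; tabulate; _[_]≔_)
open import Data.List as L using (List; []; _∷_; _++_; length; filter; foldl; concat; reverse)
open import Data.List.Relation.Unary.All using (All)
open import Data.List.Relation.Unary.Unique.Propositional using (Unique)
open import Data.Product using (Σ; ∃; ∃-syntax; _×_; _,_)
open import Data.Sum using (_⊎_)
open import Data.Irrelevant using (Irrelevant)
open import Relation.Nullary using (¬_)
open import Relation.Binary.PropositionalEquality using (_≡_; _≢_)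

-- The affine symmetric group, realised as affine permutations in window
-- notation.  A window  v : Vec ℤ n  stands for the bijection f : ℤ → ℤ
-- with f (k+1) = lookup v k (k < n) and f (i + n) = f i + n.
-- s_i (i = 1..n-1) swaps i+tn and i+1+tn; s_0 swaps tn and tn+1.
-- Multiplication is composition; right multiplication by s_i acts on
-- windows as below.

Window : ℕ → Set
Window n = Vec ℤ n

idW : ∀ {n} → Window n
idW = tabulate (λ i → + suc (toℕ i))

rmul : ∀ {n} → Window n → Fin n → Window n
rmul {suc m} v F.zero =
  let a = lookup v F.zero
      b = lookup v (fromℕ m)
  in (v [ F.zero ]≔ (b ℤ.- + suc m)) [ fromℕ m ]≔ (a ℤ.+ + suc m)
rmul {suc m} v (F.suc k) =
  let a = lookup v (inject₁ k)
      b = lookup v (F.suc k)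
  in (v [ inject₁ k ]≔ b) [ F.suc k ]≔ a

Word : ℕ → Set
Word n = List (Fin n)

eval : ∀ {n} → Word n → Window n
eval = foldl rmul idW

Len : ∀ {n} → Window n → ℕ → Set
Len {n} w k = (∃[ a ] (length a ≡ k × eval a ≡ w))
            × (∀ (a : Word n) → eval a ≡ w → k ≤ length a)

Reduced : ∀ {n} → Word n → Set
Reduced {n} a = ∀ (b : Word n) → eval b ≡ eval a → length a ≤ length b

sucMod : ∀ {n} → Fin n → Fin n
sucMod {suc m} i = suc (toℕ i) mod suc m

Precedes : ∀ {n} → Fin n → Fin n → Word n → Set
Precedes x y a = ∃[ p ] ∃[ q ] (p F.< q × L.lookup a p ≡ x × L.lookup a q ≡ y)

_∈w_ : ∀ {n} → Fin n → Word n → Set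
x ∈w a = ∃[ p ] (L.lookup a p ≡ x)

CycDec : ∀ {n} → Window n → Set
CycDec {n} w = ∃[ a ] ( eval a ≡ w × Reduced a × Unique a
  × (∀ (i : Fin n) → sucMod i ∈w a → i ∈w a → Precedes (sucMod i) i a))

-- element of position x (0-based) of a vector, with default
at : ∀ {A : Set} {m} → A → Vec A m → ℕ → A
at d v x = L.foldr (λ y _ → y) d (L.drop x (V.toList v))

-- affine factorization  w = v^r ⋯ v^1  of weight α, with  v^(x+1) = at _ vs x
IsAffineFactorization : ∀ {n r} → Window n → Vec ℕ r → Vec (Window n) r → Set
IsAffineFactorization {n} {r} w α vs =
    (∀ x → x < r → CycDec (at idW vs x) × Len (at idW vs x) (at 0 α x))
  × (∃[ ws ] ((∀ x → x < r → eval (at [] ws x) ≡ at idW vs x)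
              × eval (concat (reverse (V.toList {n = r} ws))) ≡ w))

AffineFactorizations : ∀ {n r} → Window n → Vec ℕ r → Set
AffineFactorizations {n} {r} w α =
  Σ (Vec (Window n) r) (λ vs → Irrelevant (IsAffineFactorization w α vs))

-- Partitions (French convention): a list  λ₁ ∷ λ₂ ∷ …  of row lengths,
-- bottom row first, weakly decreasing, all entries positive.

Partition : Set
Partition = List ℕ

data IsPartition : Partition → Set where
  nil  : IsPartition []
  one  : ∀ {a} → 1 ≤ a → IsPartition (a ∷ [])
  cons : ∀ {a b l} → b ≤ a → IsPartition (b ∷ l) → IsPartition (a ∷ b ∷ l)

-- row i (1-based), 0 outside
row : Partition → ℕ → ℕ
row l zero = 0
row [] (suc i) = 0
row (a ∷ l) (suc zero) = a
row (a ∷ l) (suc (suc i)) = row l (suc i)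

col : Partition → ℕ → ℕ
col l j = length (filter (λ a → j ≤? a) l)

InDiagram : Partition → ℕ → ℕ → Set
InDiagram l i j = 1 ≤ i × 1 ≤ j × j ≤ row l i

hook : Partition → ℕ → ℕ → ℕ
hook l i j = (row l i ∸ j) + (col l j ∸ i) + 1

-- n-residue of the cell in row i, column j :  (j - i) mod n
res : (n : ℕ) → .{{_ : NonZero n}} → ℕ → ℕ → Fin n
res n i j = ((j + n * i) ∸ i) mod n

IsCore : (n : ℕ) → Partition → Set
IsCore n l = IsPartition l × (∀ i j → InDiagram l i j → hook l i j ≢ n)

_⊆ₚ_ : Partition → Partition → Set
l ⊆ₚ m = ∀ i → row l i ≤ row m i

HorizontalStrip : Partition → Partition → Set
HorizontalStrip l m = l ⊆ₚ m × (∀ i i' j → InDiagram m i j → ¬ InDiagram l i j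
                                → InDiagram m i' j → ¬ InDiagram l i' j → i ≡ i')

Addable : Partition → ℕ → Set
Addable l i = 1 ≤ i × (i ≡ 1 ⊎ suc (row l i) ≤ row l (i ∸ 1))

AddableRes : (n : ℕ) → .{{_ : NonZero n}} → Fin n → Partition → ℕ → Set
AddableRes n c l i = Addable l i × res n i (suc (row l i)) ≡ c

SAct : (n : ℕ) → .{{_ : NonZero n}} → Fin n → Partition → Partition → Set
SAct n c l m = IsPartition m × (∃[ i ] AddableRes n c l i)
  × (∀ i → 1 ≤ i → (AddableRes n c l i → row m i ≡ suc (row l i))
                  × (¬ AddableRes n c l i → row m i ≡ row l i))

WordAct : (n : ℕ) → .{{_ : NonZero n}} → Word n → Partition → Partition → Set
WordAct n [] l m = l ≡ m
WordAct n (c ∷ a) l m = ∃[ k ] (WordAct n a l k × SAct n c k m)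

Frak : (n : ℕ) → .{{_ : NonZero n}} → Window n → Partition → Set
Frak n w l = ∃[ a ] (eval a ≡ w × Reduced a × WordAct n a [] l)

-- w is the minimal length element of its coset w ⟨s₁,…,s_{n-1}⟩
AffGrass : ∀ {n} → Window n → Set
AffGrass {n} w = ∀ k → Len w k → ∀ (a u b : Word n) → eval a ≡ w
  → All (λ i → toℕ i ≢ 0) u → eval b ≡ eval (a ++ u) → k ≤ length b

Deg : (n : ℕ) → .{{_ : NonZero n}} → Partition → ℕ → Set
Deg n l d = ∃[ w ] (AffGrass {n} w × Frak n w l × Len w d)

BruhatCover : (n : ℕ) → .{{_ : NonZero n}} → Partition → Partition → Set
BruhatCover n μ γ = IsCore n μ × IsCore n γ × μ ⊆ₚ γ
  × ∃[ d ] (Deg n μ d × Deg n γ (suc d))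

Rop : ℕ → Partition → Partition
Rop n l = (row l 1 + (n ∸ 1)) ∷ l

HorizontalStrongStrip : (n : ℕ) → .{{_ : NonZero n}} → ℕ → Partition → Partition → Set
HorizontalStrongStrip n k l m = l ⊆ₚ m
  × (∃[ dl ] ∃[ dm ] (Deg n l dl × Deg n m dm × k + dm ≡ (n ∸ 1) + dl))
  × (∃[ ch ] ( at {m = suc k} [] ch 0 ≡ m × at [] ch k ≡ Rop n l
       × (∀ t → t < k → BruhatCover n (at [] ch t) (at [] ch (suc t))
                       × row (at [] ch t) 1 < row (at [] ch (suc t)) 1)))

-- μ^(x) = (μ^(1)_1, …, μ^(x-1)_{x-1}, λ^(r-x)_1 + n - 1, λ^(r-x))
muShape : ∀ {r} → ℕ → Vec Partition (suc r) → ℕ → Partition → Partition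
muShape n mus x lam =
  L.map (λ t → row (at [] mus t) t) (L.drop 1 (L.upTo x)) ++ ((row lam 1 + (n ∸ 1)) ∷ lam)

IsABC : (n : ℕ) → .{{_ : NonZero n}} → ∀ {r} → Partition → Vec ℕ r → Vec Partition (suc r) → Set
IsABC n {r} l α mus =
    (∀ x → x ≤ r → IsPartition (at [] mus x))
  × at [] mus 0 ≡ l
  × (∀ x → 1 ≤ x → x ≤ r → HorizontalStrip (at [] mus (x ∸ 1)) (at [] mus x))
  × ∃[ lams ] ( at {m = suc r} [] lams 0 ≡ [] × at [] lams r ≡ l
      × (∀ x → x ≤ r → IsCore n (at [] lams x))
      × (∀ x → 1 ≤ x → x ≤ r →
            HorizontalStrongStrip n ((n ∸ 1) ∸ at 0 α (x ∸ 1)) (at [] lams (x ∸ 1)) (at [] lams x))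
      × (∀ x → 1 ≤ x → x ≤ r → at [] mus x ≡ muShape n mus x (at [] lams (r ∸ x))))

ABC : (n : ℕ) → .{{_ : NonZero n}} → ∀ {r} → Partition → Vec ℕ r → Set
ABC n {r} l α = Σ (Vec Partition (suc r)) (λ mus → Irrelevant (IsABC n l α mus))

{-# OPTIONS --safe #-}
-- A core is encoded by its bead set, the integers λᵢ - i + 1, which is closed under subtraction of n;
-- the simple reflection s c exchanges the classes of c and c + 1.  The degree is an explicit function D
-- of the heights of the n runners which every letter changes by at most one, and which rises by one
-- exactly when the letter adds corners.  Hence a word raising D by its length is reduced, and no
-- Coxeter length theory is needed.
--
-- For cores λ ⊆ ν, weak strips and horizontal strong strips are compared through
-- ν = v λ, where v is cyclically decreasing with letter set A.  Let x₀ < ⋯ < xₖ = λ₁ + n - 1 be the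
-- residues outside A, taken in the window of length n starting at the first bead of λ.  Adding x₀ to A
-- multiplies v by the affine transposition of x₀ and x₁, and x₀ is the first bead of ν; thus filling up
-- A letter by letter gives a chain of strong covers from ν to R(n - 1, λ) with increasing first rows.
-- Conversely, a strong cover with increasing first row between two cores lying between λ and
-- R(n - 1, λ) must be the transposition of the classes of the two first beads: exchanging a suitable
-- runner with that of the larger first bead gives a core in between, and D is strictly monotone.
--
-- The rows of μ⁽ˣ⁾ are determined by the cores λ⁽ʸ⁾, and its horizontal strip condition holds
-- automatically.
module Submission where

open import Defs
open import Data.Bool using (Bool; true; false; T; if_then_else_)
open import Data.Empty using (⊥; ⊥-elim)
open import Data.Fin as F using (Fin; toℕ; fromℕ; fromℕ<; inject₁)
import Data.Fin.Properties as FP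
open import Data.Integer as ℤ using (ℤ; +_; -[1+_]; _+_; _-_; _*_; -_; _≤_; _<_)
import Data.Integer.DivMod as ℤD
import Data.Integer.Divisibility.Signed as Signed
import Data.Integer.Properties as ℤP
open import Data.Integer.Tactic.RingSolver using (solve-∀)
open import Data.Irrelevant using (Irrelevant; [_])
open import Data.List as L using (List; []; _∷_; _++_; length; foldl; applyUpTo; drop)
open import Data.List.Membership.Propositional using () renaming (_∈_ to _∈ₗ_)
open import Data.List.Membership.Propositional.Properties.WithK using (unique∧set⇒bag)
import Data.List.Properties as LP
open import Data.List.Relation.Binary.BagAndSetEquality using (∼bag⇒↭)
open import Data.List.Relation.Binary.Permutation.Propositional.Properties using (↭-length)
open import Data.List.Relation.Unary.All using (All; []; _∷_)
open import Data.List.Relation.Unary.All.Properties using (++⁺)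
open import Data.List.Relation.Unary.AllPairs using ([]; _∷_)
open import Data.List.Relation.Unary.Any using (here; there)
open import Data.List.Relation.Unary.Unique.Propositional using (Unique)
open import Data.Nat as ℕ using (ℕ; zero; suc)
open import Data.Nat.DivMod using (m≡m%n+[m/n]*n; _%_; _/_; m%n<n)
import Data.Nat.Properties as ℕP
open import Data.Nat.Tactic.RingSolver using () renaming (solve-∀ to solve-ℕ)
open import Data.Product using (Σ; ∃; ∃-syntax; _×_; _,_; proj₁; proj₂)
open import Data.Sum using (_⊎_; inj₁; inj₂)
open import Data.Unit using (⊤; tt)
open import Data.Vec as V using (Vec; []; _∷_; lookup; tabulate; _[_]≔_)
import Data.Vec.Properties as VP
import Data.Vec.Relation.Unary.All as VA
open import Function.Bundles using (_↔_; mk↔ₛ′; _⇔_; mk⇔; Equivalence)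
open import Relation.Binary.Definitions using (Tri; tri<; tri≈; tri>)
open import Relation.Binary.PropositionalEquality
open import Relation.Nullary using (¬_; Dec; yes; no)
open import Relation.Nullary.Decidable using (_×-dec_; ¬?; recompute)

-- Countertableaux and factorizations carry their correctness proofs only irrelevantly, so the
-- bijection cannot take its words out of those proofs. Both maps are computed from the visible
-- data, by exhaustive search among the words of a prescribed length, and only afterwards compared
-- with the words of the proof. This works because a core determines the affine permutation that
-- creates it from the empty core: a word that adds corners at every letter has an increasing
-- window, and an increasing window is recovered from the images of the integers at most 0. Two
-- consecutive cores thus determine the factor between them, even if the word found is not itself
-- cyclically decreasing.
--
-- Strong covers are tractable here because all cores of a chain lie between λ and R(n - 1, λ): the
-- beads of any two of them interlace, so a bead moves by less than n and passes no other. The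
-- window of letters starts at the first bead of λ because the residue just below that bead is never
-- a letter of a cyclically decreasing word that adds corners to λ at every letter.

-- A decision procedure for linear integer arithmetic.

module LinearArithmetic where

  open ℤP

  infixl 6 _⊕_ _⊖_
  infix 4 _:≤_ _:<_ _:≡_
  infixr 3 _⇒_

  data Expr : Set where
    var : ℕ → Expr
    # : ℤ → Expr
    _⊕_ _⊖_ : Expr → Expr → Expr

  #0 #1 #2 : Expr
  #0 = # (+ 0)
  #1 = # (+ 1)
  #2 = # (+ 2)

  data Atom : Set where
    _:≤_ _:<_ _:≡_ : Expr → Expr → Atom
    ⊥ₐ : Atom

  data Form : Set where
    _⇒_ : Atom → Form → Form
    [_] : Atom → Form

  lookupE : List ℤ → ℕ → ℤ
  lookupE [] _ = + 0
  lookupE (x ∷ ρ) zero = x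
  lookupE (x ∷ ρ) (suc i) = lookupE ρ i

  ⟦_⟧e : Expr → List ℤ → ℤ
  ⟦ var i ⟧e ρ = lookupE ρ i
  ⟦ # z ⟧e ρ = z
  ⟦ a ⊕ b ⟧e ρ = ⟦ a ⟧e ρ + ⟦ b ⟧e ρ
  ⟦ a ⊖ b ⟧e ρ = ⟦ a ⟧e ρ - ⟦ b ⟧e ρ

  ⟦_⟧a : Atom → List ℤ → Set
  ⟦ a :≤ b ⟧a ρ = ⟦ a ⟧e ρ ≤ ⟦ b ⟧e ρ
  ⟦ a :< b ⟧a ρ = ⟦ a ⟧e ρ < ⟦ b ⟧e ρ
  ⟦ a :≡ b ⟧a ρ = ⟦ a ⟧e ρ ≡ ⟦ b ⟧e ρ
  ⟦ ⊥ₐ ⟧a ρ = ⊥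

  ⟦_⟧f : Form → List ℤ → Set
  ⟦ h ⇒ φ ⟧f ρ = ⟦ h ⟧a ρ → ⟦ φ ⟧f ρ
  ⟦ [ g ] ⟧f ρ = ⟦ g ⟧a ρ

  -- (c , a₀ ∷ a₁ ∷ …) stands for the affine form  c + a₀ x₀ + a₁ x₁ + …
  Lin : Set
  Lin = ℤ × List ℤ

  dot : List ℤ → List ℤ → ℤ
  dot [] ρ = + 0
  dot (a ∷ as) [] = + 0
  dot (a ∷ as) (x ∷ ρ) = a * x + dot as ρ

  ⟦_⟧l : Lin → List ℤ → ℤ
  ⟦ c , as ⟧l ρ = c + dot as ρ

  addC : List ℤ → List ℤ → List ℤ
  addC [] bs = bs
  addC (a ∷ as) [] = a ∷ as
  addC (a ∷ as) (b ∷ bs) = (a + b) ∷ addC as bs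

  addL : Lin → Lin → Lin
  addL (c , as) (d , bs) = c + d , addC as bs

  scaleL : ℤ → Lin → Lin
  scaleL k (c , as) = k * c , L.map (λ a → k * a) as

  unit : ℕ → List ℤ
  unit zero = + 1 ∷ []
  unit (suc i) = + 0 ∷ unit i

  lin : Expr → Lin
  lin (var i) = + 0 , unit i
  lin (# z) = z , []
  lin (a ⊕ b) = addL (lin a) (lin b)
  lin (a ⊖ b) = addL (lin a) (scaleL (- + 1) (lin b))

  dot-add : ∀ as bs ρ → dot (addC as bs) ρ ≡ dot as ρ + dot bs ρ
  dot-add [] bs ρ = sym (+-identityˡ _)
  dot-add (a ∷ as) [] ρ = sym (+-identityʳ _)
  dot-add (a ∷ as) (b ∷ bs) [] = refl
  dot-add (a ∷ as) (b ∷ bs) (x ∷ ρ) = trans (cong (λ z → (a + b) * x + z) (dot-add as bs ρ)) (lem a b x _ _)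
    where
    lem : ∀ a b x u v → (a + b) * x + (u + v) ≡ (a * x + u) + (b * x + v)
    lem = solve-∀

  dot-scale : ∀ k as ρ → dot (L.map (λ a → k * a) as) ρ ≡ k * dot as ρ
  dot-scale k [] ρ = sym (*-zeroʳ k)
  dot-scale k (a ∷ as) [] = sym (*-zeroʳ k)
  dot-scale k (a ∷ as) (x ∷ ρ) = trans (cong (λ z → k * a * x + z) (dot-scale k as ρ)) (lem k a x _)
    where
    lem : ∀ k a x u → k * a * x + k * u ≡ k * (a * x + u)
    lem = solve-∀

  addL-sound : ∀ p q ρ → ⟦ addL p q ⟧l ρ ≡ ⟦ p ⟧l ρ + ⟦ q ⟧l ρ
  addL-sound (c , as) (d , bs) ρ = trans (cong (λ z → c + d + z) (dot-add as bs ρ)) (lem c d _ _)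
    where
    lem : ∀ c d u v → c + d + (u + v) ≡ c + u + (d + v)
    lem = solve-∀

  scaleL-sound : ∀ k p ρ → ⟦ scaleL k p ⟧l ρ ≡ k * ⟦ p ⟧l ρ
  scaleL-sound k (c , as) ρ = trans (cong (λ z → k * c + z) (dot-scale k as ρ)) (sym (*-distribˡ-+ k c _))

  unit-sound : ∀ i ρ → dot (unit i) ρ ≡ lookupE ρ i
  unit-sound zero [] = refl
  unit-sound zero (x ∷ ρ) = trans (+-identityʳ _) (*-identityˡ x)
  unit-sound (suc i) [] = refl
  unit-sound (suc i) (x ∷ ρ) = trans (+-identityˡ _) (unit-sound i ρ)

  lin-sound : ∀ e ρ → ⟦ lin e ⟧l ρ ≡ ⟦ e ⟧e ρ
  lin-sound (var i) ρ = trans (+-identityˡ _) (unit-sound i ρ)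
  lin-sound (# z) ρ = +-identityʳ z
  lin-sound (a ⊕ b) ρ = trans (addL-sound (lin a) (lin b) ρ) (cong₂ _+_ (lin-sound a ρ) (lin-sound b ρ))
  lin-sound (a ⊖ b) ρ = trans (addL-sound (lin a) (scaleL (- + 1) (lin b)) ρ)
    (cong₂ _+_ (lin-sound a ρ) (trans (scaleL-sound (- + 1) (lin b) ρ) (trans (-1*i≡-i _) (cong -_ (lin-sound b ρ)))))

  diff : Expr → Expr → Lin
  diff a b = lin (b ⊖ a)

  -- Over ℤ, `a < b` amounts to `1 + a ≤ b`; strict hypotheses, and the negations of weak goals, are
  -- tightened to nonnegative forms in this way.
  diff1 : Expr → Expr → Lin
  diff1 a b = lin (b ⊖ (# (+ 1) ⊕ a))

  hyps : Atom → List Lin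
  hyps (a :≤ b) = diff a b ∷ []
  hyps (a :< b) = diff1 a b ∷ []
  hyps (a :≡ b) = []
  hyps ⊥ₐ = (- + 1 , []) ∷ []

  Nonneg : List ℤ → Lin → Set
  Nonneg ρ p = + 0 ≤ ⟦ p ⟧l ρ

  diff-sound : ∀ a b ρ → ⟦ a ⟧e ρ ≤ ⟦ b ⟧e ρ → Nonneg ρ (diff a b)
  diff-sound a b ρ h = subst (+ 0 ≤_) (sym (lin-sound (b ⊖ a) ρ)) (i≤j⇒0≤j-i h)

  diff1-sound : ∀ a b ρ → ⟦ a ⟧e ρ < ⟦ b ⟧e ρ → Nonneg ρ (diff1 a b)
  diff1-sound a b ρ h = subst (+ 0 ≤_) (sym (lin-sound (b ⊖ (# (+ 1) ⊕ a)) ρ)) (i≤j⇒0≤j-i (i<j⇒suc[i]≤j h))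

  hyps-sound : ∀ h ρ → ⟦ h ⟧a ρ → All (Nonneg ρ) (hyps h)
  hyps-sound (a :≤ b) ρ p = diff-sound a b ρ p ∷ []
  hyps-sound (a :< b) ρ p = diff1-sound a b ρ p ∷ []
  hyps-sound (a :≡ b) ρ p = []

  eqns : Atom → List Lin
  eqns (a :≡ b) = diff a b ∷ []
  eqns _ = []

  Null : List ℤ → Lin → Set
  Null ρ p = ⟦ p ⟧l ρ ≡ + 0

  eqns-sound : ∀ h ρ → ⟦ h ⟧a ρ → All (Null ρ) (eqns h)
  eqns-sound (a :≡ b) ρ p = trans (lin-sound (b ⊖ a) ρ) (i≡j⇒i-j≡0 (sym p)) ∷ []
  eqns-sound (_ :≤ _) ρ p = []
  eqns-sound (_ :< _) ρ p = []
  eqns-sound ⊥ₐ ρ p = []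

  data Head : Set where
    hzero : Lin → Head
    hpos hneg : ℕ → Lin → Head

  head : Lin → Head
  head (c , []) = hzero (c , [])
  head (c , + zero ∷ as) = hzero (c , as)
  head (c , + suc k ∷ as) = hpos k (c , as)
  head (c , -[1+ k ] ∷ as) = hneg k (c , as)

  ⟦_⟧h : Head → ℤ → List ℤ → ℤ
  ⟦ hzero p ⟧h x ρ = ⟦ p ⟧l ρ
  ⟦ hpos k p ⟧h x ρ = + suc k * x + ⟦ p ⟧l ρ
  ⟦ hneg k p ⟧h x ρ = -[1+ k ] * x + ⟦ p ⟧l ρ

  head-sound : ∀ p x ρ → ⟦ p ⟧l (x ∷ ρ) ≡ ⟦ head p ⟧h x ρ
  head-sound (c , []) x ρ = refl
  head-sound (c , + zero ∷ as) x ρ = cong (λ z → c + z) (+-identityˡ _)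
  head-sound (c , + suc k ∷ as) x ρ = lem c (+ suc k * x) (dot as ρ)
    where
    lem : ∀ c u v → c + (u + v) ≡ u + (c + v)
    lem = solve-∀
  head-sound (c , -[1+ k ] ∷ as) x ρ = lem c (-[1+ k ] * x) (dot as ρ)
    where
    lem : ∀ c u v → c + (u + v) ≡ u + (c + v)
    lem = solve-∀

  -- The crossed multipliers are positive, so nonnegativity survives, and the leading variable
  -- cancels between a lower and an upper bound.
  combine : Head → Head → List Lin
  combine (hpos a p) (hneg b q) = addL (scaleL (+ suc b) p) (scaleL (+ suc a) q) ∷ []
  combine _ _ = []

  zeros : Head → List Lin
  zeros (hzero p) = p ∷ []
  zeros _ = []

  NonnegH : ℤ → List ℤ → Head → Set
  NonnegH x ρ h = + 0 ≤ ⟦ h ⟧h x ρ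

  combine-sound : ∀ g h x ρ → NonnegH x ρ g → NonnegH x ρ h → All (Nonneg ρ) (combine g h)
  combine-sound (hpos a p) (hneg b q) x ρ u v = subst (+ 0 ≤_) (sym eq) (+-mono-≤ (nn b u) (nn a v)) ∷ []
    where
    nn : ∀ k {z} → + 0 ≤ z → + 0 ≤ + suc k * z
    nn k {z} h = subst (_≤ + suc k * z) (*-zeroʳ (+ suc k)) (*-monoˡ-≤-nonNeg (+ suc k) h)
    lem : ∀ A B x P Q → B * P + A * Q ≡ B * (A * x + P) + A * (- B * x + Q)
    lem = solve-∀
    eq : ⟦ addL (scaleL (+ suc b) p) (scaleL (+ suc a) q) ⟧l ρ
       ≡ + suc b * (+ suc a * x + ⟦ p ⟧l ρ) + + suc a * (-[1+ b ] * x + ⟦ q ⟧l ρ)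
    eq = trans (addL-sound (scaleL (+ suc b) p) (scaleL (+ suc a) q) ρ)
        (trans (cong₂ _+_ (scaleL-sound (+ suc b) p ρ) (scaleL-sound (+ suc a) q ρ)) (lem (+ suc a) (+ suc b) x _ _))
  combine-sound (hzero _) _ x ρ u v = []
  combine-sound (hneg _ _) _ x ρ u v = []
  combine-sound (hpos _ _) (hzero _) x ρ u v = []
  combine-sound (hpos _ _) (hpos _ _) x ρ u v = []

  zeros-sound : ∀ h x ρ → NonnegH x ρ h → All (Nonneg ρ) (zeros h)
  zeros-sound (hzero p) x ρ u = u ∷ []
  zeros-sound (hpos _ _) x ρ u = []
  zeros-sound (hneg _ _) x ρ u = []

  elim : List Lin → List Lin
  elim ps = L.concatMap zeros hs ++ L.concatMap (λ g → L.concatMap (combine g) hs) hs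
    where hs = L.map head ps

  concatMap-All : ∀ {A : Set} {P : A → Set} {Q : Lin → Set} (f : A → List Lin) → (∀ a → P a → All Q (f a)) →
    ∀ xs → All P xs → All Q (L.concatMap f xs)
  concatMap-All f h [] [] = []
  concatMap-All f h (x ∷ xs) (p ∷ ps) = ++⁺ (h x p) (concatMap-All f h xs ps)

  elim-sound : ∀ ps x ρ → All (Nonneg (x ∷ ρ)) ps → All (Nonneg ρ) (elim ps)
  elim-sound ps x ρ H = ++⁺
      (concatMap-All zeros (λ h → zeros-sound h x ρ) hs HH)
      (concatMap-All _ (λ g u → concatMap-All (combine g) (λ h v → combine-sound g h x ρ u v) hs HH) hs HH)
    where
    hs = L.map head ps
    heads : ∀ ps → All (Nonneg (x ∷ ρ)) ps → All (NonnegH x ρ) (L.map head ps)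
    heads [] [] = []
    heads (p ∷ ps) (u ∷ us) = subst (+ 0 ≤_) (head-sound p x ρ) u ∷ heads ps us
    HH = heads ps H

  -- Eliminates x by the equation `suc k * x + e = 0`. The form is first multiplied by the pivot
  -- coefficient, which `pivotOf` has made positive, so that no division occurs and signs are
  -- preserved.
  substitute : ℕ → Lin → Head → Lin
  substitute k e (hzero p) = p
  substitute k e (hpos a p) = addL (scaleL (+ suc k) p) (scaleL -[1+ a ] e)
  substitute k e (hneg a p) = addL (scaleL (+ suc k) p) (scaleL (+ suc a) e)

  scaled : ∀ k c e p ρ → ⟦ addL (scaleL k p) (scaleL c e) ⟧l ρ ≡ k * ⟦ p ⟧l ρ + c * ⟦ e ⟧l ρ
  scaled k c e p ρ = trans (addL-sound (scaleL k p) (scaleL c e) ρ) (cong₂ _+_ (scaleL-sound k p ρ) (scaleL-sound c e ρ))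

  solved : ∀ k c x p e → k * x + e ≡ + 0 → k * p - c * e ≡ k * (c * x + p)
  solved k c x p e h = trans (lem k c x p e) (trans (cong (λ z → k * (c * x + p) - c * z) h) (lem2 (k * (c * x + p)) c))
    where
    lem : ∀ k c x p e → k * p - c * e ≡ k * (c * x + p) - c * (k * x + e)
    lem = solve-∀
    lem2 : ∀ z c → z - c * + 0 ≡ z
    lem2 = solve-∀

  data Scaled (k : ℕ) : ℤ → ℤ → Set where
    once : ∀ {z} → Scaled k z z
    times : ∀ {y z} → z ≡ + suc k * y → Scaled k y z

  substitute-sound : ∀ k e h x ρ → + suc k * x + ⟦ e ⟧l ρ ≡ + 0 → Scaled k (⟦ h ⟧h x ρ) (⟦ substitute k e h ⟧l ρ)
  substitute-sound k e (hzero p) x ρ h = once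
  substitute-sound k e (hpos a p) x ρ h = times (trans (scaled (+ suc k) -[1+ a ] e p ρ)
    (trans (lem (+ suc k) (+ suc a) (⟦ p ⟧l ρ) (⟦ e ⟧l ρ)) (solved (+ suc k) (+ suc a) x (⟦ p ⟧l ρ) (⟦ e ⟧l ρ) h)))
    where
    lem : ∀ k a p e → k * p + - a * e ≡ k * p - a * e
    lem = solve-∀
  substitute-sound k e (hneg a p) x ρ h = times (trans (scaled (+ suc k) (+ suc a) e p ρ)
    (trans (lem (+ suc k) (+ suc a) (⟦ p ⟧l ρ) (⟦ e ⟧l ρ)) (solved (+ suc k) -[1+ a ] x (⟦ p ⟧l ρ) (⟦ e ⟧l ρ) h)))
    where
    lem : ∀ k a p e → k * p + a * e ≡ k * p - - a * e
    lem = solve-∀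

  scaled-nonneg : ∀ {k y z} → Scaled k y z → + 0 ≤ y → + 0 ≤ z
  scaled-nonneg once h = h
  scaled-nonneg {k} {y} (times refl) h = subst (_≤ + suc k * y) (*-zeroʳ (+ suc k)) (*-monoˡ-≤-nonNeg (+ suc k) h)

  scaled-null : ∀ {k y z} → Scaled k y z → y ≡ + 0 → z ≡ + 0
  scaled-null once h = h
  scaled-null {k} (times refl) refl = *-zeroʳ (+ suc k)

  data Pivot : Set where
    none : Pivot
    some : ℕ → Lin → Pivot

  pivotOf : Head → Pivot → Pivot
  pivotOf (hzero _) r = r
  pivotOf (hpos k p) _ = some k p
  pivotOf (hneg k p) _ = some k (scaleL (- + 1) p)

  pivot : List Lin → Pivot
  pivot [] = none
  pivot (p ∷ ps) = pivotOf (head p) (pivot ps)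

  PivotOK : ℤ → List ℤ → Pivot → Set
  PivotOK x ρ none = ⊤
  PivotOK x ρ (some k e) = + suc k * x + ⟦ e ⟧l ρ ≡ + 0

  pivotOf-sound : ∀ h r x ρ → ⟦ h ⟧h x ρ ≡ + 0 → PivotOK x ρ r → PivotOK x ρ (pivotOf h r)
  pivotOf-sound (hzero _) r x ρ u v = v
  pivotOf-sound (hpos k p) r x ρ u v = u
  pivotOf-sound (hneg k p) r x ρ u v = trans (cong (λ z → + suc k * x + z) (scaleL-sound (- + 1) p ρ))
     (trans (lem (+ suc k) x (⟦ p ⟧l ρ)) (cong -_ u))
    where
    lem : ∀ k x p → k * x + - + 1 * p ≡ - (- k * x + p)
    lem = solve-∀

  pivot-sound : ∀ es x ρ → All (Null (x ∷ ρ)) es → PivotOK x ρ (pivot es)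
  pivot-sound [] x ρ [] = tt
  pivot-sound (p ∷ ps) x ρ (u ∷ us) = pivotOf-sound (head p) _ x ρ (trans (sym (head-sound p x ρ)) u) (pivot-sound ps x ρ us)

  negConst : List Lin → Bool
  negConst [] = false
  negConst ((-[1+ _ ] , _) ∷ ps) = true
  negConst ((+ _ , _) ∷ ps) = negConst ps

  mutual
    -- Each unit of fuel removes one variable, by an equation if one contains it: substitution keeps
    -- the number of inequalities, while `elim` multiplies it. Without variables every form is a
    -- constant, and a negative one is the contradiction.
    refute : ℕ → List Lin → List Lin → Bool
    refute zero es ps = negConst ps
    refute (suc k) es ps = refuteWith (pivot es) k es ps

    refuteWith : Pivot → ℕ → List Lin → List Lin → Bool
    refuteWith (some c e) k es ps = refute k (L.map (λ p → substitute c e (head p)) es) (L.map (λ p → substitute c e (head p)) ps)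
    refuteWith none k es ps = refute k (L.concatMap zeros (L.map head es)) (elim ps)

  dot-[] : ∀ as → dot as [] ≡ + 0
  dot-[] [] = refl
  dot-[] (_ ∷ _) = refl

  substitute-nonneg : ∀ k e x ρ → + suc k * x + ⟦ e ⟧l ρ ≡ + 0 → ∀ ps → All (Nonneg (x ∷ ρ)) ps →
    All (Nonneg ρ) (L.map (λ p → substitute k e (head p)) ps)
  substitute-nonneg k e x ρ h [] [] = []
  substitute-nonneg k e x ρ h (p ∷ ps) (u ∷ us) =
    scaled-nonneg (substitute-sound k e (head p) x ρ h) (subst (+ 0 ≤_) (head-sound p x ρ) u) ∷ substitute-nonneg k e x ρ h ps us

  substitute-null : ∀ k e x ρ → + suc k * x + ⟦ e ⟧l ρ ≡ + 0 → ∀ ps → All (Null (x ∷ ρ)) ps →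
    All (Null ρ) (L.map (λ p → substitute k e (head p)) ps)
  substitute-null k e x ρ h [] [] = []
  substitute-null k e x ρ h (p ∷ ps) (u ∷ us) =
    scaled-null (substitute-sound k e (head p) x ρ h) (trans (sym (head-sound p x ρ)) u) ∷ substitute-null k e x ρ h ps us

  zeros-null : ∀ x ρ es → All (Null (x ∷ ρ)) es → All (Null ρ) (L.concatMap zeros (L.map head es))
  zeros-null x ρ [] [] = []
  zeros-null x ρ (p ∷ ps) (u ∷ us) = ++⁺ (null-zeros (head p) (trans (sym (head-sound p x ρ)) u)) (zeros-null x ρ ps us)
    where
    null-zeros : ∀ h → ⟦ h ⟧h x ρ ≡ + 0 → All (Null ρ) (zeros h)
    null-zeros (hzero p) u = u ∷ []
    null-zeros (hpos _ _) u = []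
    null-zeros (hneg _ _) u = []

  mutual
    refute-sound : ∀ ρ es ps → All (Null ρ) es → All (Nonneg ρ) ps → T (refute (L.length ρ) es ps) → ⊥
    refute-sound [] es ((-[1+ k ] , as) ∷ ps) vs (u ∷ us) t with subst (λ z → + 0 ≤ -[1+ k ] + z) (dot-[] as) u
    ... | ()
    refute-sound [] es ((+ _ , _) ∷ ps) vs (u ∷ us) t = refute-sound [] es ps vs us t
    refute-sound (x ∷ ρ) es ps vs us t = refuteWith-sound (pivot es) x ρ es ps (pivot-sound es x ρ vs) vs us t

    refuteWith-sound : ∀ r x ρ es ps → PivotOK x ρ r → All (Null (x ∷ ρ)) es → All (Nonneg (x ∷ ρ)) ps →
      T (refuteWith r (L.length ρ) es ps) → ⊥
    refuteWith-sound none x ρ es ps ok vs us t = refute-sound ρ _ _ (zeros-null x ρ es vs) (elim-sound ps x ρ us) t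
    refuteWith-sound (some c e) x ρ es ps ok vs us t = refute-sound ρ _ _ (substitute-null c e x ρ ok es vs) (substitute-nonneg c e x ρ ok ps us) t

  decideA : ℕ → List Lin → List Lin → Atom → Bool
  decideA k es ps (a :≤ b) = refute k es (diff1 b a ∷ ps)
  decideA k es ps (a :< b) = refute k es (diff b a ∷ ps)
  decideA k es ps (a :≡ b) = if refute k es (diff1 b a ∷ ps) then refute k es (diff1 a b ∷ ps) else false
  decideA k es ps ⊥ₐ = refute k es ps

  decideF : ℕ → List Lin → List Lin → Form → Bool
  decideF k es ps (h ⇒ φ) = decideF k (eqns h ++ es) (hyps h ++ ps) φ
  decideF k es ps [ g ] = decideA k es ps g

  le-sound : ∀ a b ρ es ps → All (Null ρ) es → All (Nonneg ρ) ps → T (refute (L.length ρ) es (diff1 b a ∷ ps)) → ⟦ a ⟧e ρ ≤ ⟦ b ⟧e ρ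
  le-sound a b ρ es ps vs us t with ⟦ a ⟧e ρ ℤP.≤? ⟦ b ⟧e ρ
  ... | yes p = p
  ... | no ¬p = ⊥-elim (refute-sound ρ _ _ vs (diff1-sound b a ρ (≰⇒> ¬p) ∷ us) t)

  decideA-sound : ∀ g ρ es ps → All (Null ρ) es → All (Nonneg ρ) ps → T (decideA (L.length ρ) es ps g) → ⟦ g ⟧a ρ
  decideA-sound (a :≤ b) ρ es ps vs us t = le-sound a b ρ es ps vs us t
  decideA-sound (a :< b) ρ es ps vs us t with ⟦ a ⟧e ρ ℤP.<? ⟦ b ⟧e ρ
  ... | yes p = p
  ... | no ¬p = ⊥-elim (refute-sound ρ _ _ vs (diff-sound b a ρ (≮⇒≥ ¬p) ∷ us) t)
  decideA-sound (a :≡ b) ρ es ps vs us t with refute (L.length ρ) es (diff1 b a ∷ ps) in eq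
  ... | true = ≤-antisym (le-sound a b ρ es ps vs us (subst T (sym eq) tt)) (le-sound b a ρ es ps vs us t)
  decideA-sound ⊥ₐ ρ es ps vs us t = refute-sound ρ _ _ vs us t

  decideF-sound : ∀ φ ρ es ps → All (Null ρ) es → All (Nonneg ρ) ps → T (decideF (L.length ρ) es ps φ) → ⟦ φ ⟧f ρ
  decideF-sound (h ⇒ φ) ρ es ps vs us t p = decideF-sound φ ρ _ _ (++⁺ (eqns-sound h ρ p) vs) (++⁺ (hyps-sound h ρ p) us) t
  decideF-sound [ g ] ρ es ps vs us t = decideA-sound g ρ es ps vs us t

  Fun : ℕ → Set
  Fun zero = Form
  Fun (suc k) = Expr → Fun k

  apply : ∀ k → ℕ → Fun k → Form
  apply zero i φ = φ
  apply (suc k) i f = apply k (suc i) (f (var i))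

  Closure : ℕ → (List ℤ → Set) → Set
  Closure zero P = P []
  Closure (suc k) P = ∀ x → Closure k (λ ρ → P (x ∷ ρ))

  closure : ∀ k (P : List ℤ → Set) → (∀ ρ → L.length ρ ≡ k → P ρ) → Closure k P
  closure zero P f = f [] refl
  closure (suc k) P f x = closure k _ (λ ρ e → f (x ∷ ρ) (cong suc e))

  -- Linear integer arithmetic by Fourier–Motzkin elimination:  lia k (λ x₁ … xₖ → h ⇒ … ⇒ [ g ])
  lia : ∀ k (f : Fun k) {_ : T (decideF k [] [] (apply k 0 f))} → Closure k ⟦ apply k 0 f ⟧f
  lia k f {t} = closure k _ (λ ρ e → decideF-sound (apply k 0 f) ρ [] [] [] [] (subst (λ j → T (decideF j [] [] (apply k 0 f))) (sym e) t))

open LinearArithmetic using (_⊕_; _⊖_; _:≤_; _:<_; _:≡_; _⇒_; #; #0; #1; #2; ⊥ₐ; [_]; lia)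

-- Runner heights and their degree

module Runners where

  -- δ = n gives the action of a generator on windows, δ = -1 its action on runner heights.
  exchange : ∀ {n} → ℤ → Fin n → Vec ℤ n → Vec ℤ n
  exchange {suc m} δ F.zero v = (v [ F.zero ]≔ (lookup v (fromℕ m) - δ)) [ fromℕ m ]≔ (lookup v F.zero ℤ.+ δ)
  exchange {suc m} δ (F.suc k) v = (v [ inject₁ k ]≔ lookup v (F.suc k)) [ F.suc k ]≔ lookup v (inject₁ k)

  rmul-exchange : ∀ {n} (v : Window n) c → rmul v c ≡ exchange (+ n) c v
  rmul-exchange {suc m} v F.zero = refl
  rmul-exchange {suc m} v (F.suc k) = refl

  data Exchange {n : ℕ} (δ : ℤ) (v : Vec ℤ n) (c j : Fin n) : ℤ → Set where
    step-up : ∀ j' → suc (toℕ j) ≡ toℕ c → toℕ j' ≡ suc (toℕ j) → Exchange δ v c j (lookup v j')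
    step-down : ∀ j' → toℕ j ≡ toℕ c → suc (toℕ j') ≡ toℕ j → Exchange δ v c j (lookup v j')
    wrap-up : ∀ j' → toℕ c ≡ 0 → suc (toℕ j) ≡ n → toℕ j' ≡ 0 → Exchange δ v c j (lookup v j' ℤ.+ δ)
    wrap-down : ∀ j' → toℕ c ≡ 0 → toℕ j ≡ 0 → suc (toℕ j') ≡ n → Exchange δ v c j (lookup v j' - δ)
    still : suc (toℕ j) ≢ toℕ c → toℕ j ≢ toℕ c → (toℕ c ≡ 0 → suc (toℕ j) ≢ n) → Exchange δ v c j (lookup v j)

  module _ {m} (v : Vec ℤ m) (i k : Fin m) (x y : ℤ) where

    lookup-second : lookup ((v [ i ]≔ x) [ k ]≔ y) k ≡ y
    lookup-second = VP.lookup∘updateAt k (v [ i ]≔ x)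

    lookup-first : i ≢ k → lookup ((v [ i ]≔ x) [ k ]≔ y) i ≡ x
    lookup-first i≢k = trans (VP.lookup∘update′ i≢k (v [ i ]≔ x) y) (VP.lookup∘updateAt i v)

    lookup-other : ∀ {j} → j ≢ k → j ≢ i → lookup ((v [ i ]≔ x) [ k ]≔ y) j ≡ lookup v j
    lookup-other j≢k j≢i = trans (VP.lookup∘update′ j≢k (v [ i ]≔ x) y) (VP.lookup∘update′ j≢i v x)

  -- For `n = 1` both updates of the letter 0 would hit the same entry; `2 ≤ n` keeps them apart.
  exchange-view : ∀ {n} → 2 ℕ.≤ n → ∀ δ (v : Vec ℤ n) (c j : Fin n) → Exchange δ v c j (lookup (exchange δ c v) j)
  exchange-view {suc zero} (ℕ.s≤s ()) δ v F.zero j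
  exchange-view {suc (suc m)} _ δ v F.zero j with j F.≟ fromℕ (suc m)
  ... | yes refl = subst (Exchange δ v F.zero j) (sym (lookup-second v F.zero j _ _))
                    (wrap-up F.zero refl (cong suc (FP.toℕ-fromℕ (suc m))) refl)
  ... | no j≢ with j F.≟ F.zero
  ...   | yes refl = subst (Exchange δ v F.zero j) (sym (lookup-first v F.zero (fromℕ (suc m)) _ _ j≢))
                    (wrap-down (fromℕ (suc m)) refl refl (cong suc (FP.toℕ-fromℕ (suc m))))
  ...   | no j≢0 = subst (Exchange δ v F.zero j) (sym (lookup-other v F.zero (fromℕ (suc m)) _ _ j≢ j≢0))
                    (still (λ ()) (λ e → j≢0 (FP.toℕ-injective e))
                      (λ _ e → j≢ (FP.toℕ-injective (trans (ℕP.suc-injective e) (sym (FP.toℕ-fromℕ (suc m)))))))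
  exchange-view {suc (suc m)} _ δ v (F.suc k) j with j F.≟ F.suc k
  ... | yes refl = subst (Exchange δ v (F.suc k) j) (sym (lookup-second v (inject₁ k) j _ _))
                    (step-down (inject₁ k) refl (cong suc (FP.toℕ-inject₁ k)))
  ... | no j≢ with j F.≟ inject₁ k
  ...   | yes refl = subst (Exchange δ v (F.suc k) j) (sym (lookup-first v (inject₁ k) (F.suc k) _ _ j≢))
                    (step-up (F.suc k) (cong suc (FP.toℕ-inject₁ k)) (cong suc (sym (FP.toℕ-inject₁ k))))
  ...   | no j≢i = subst (Exchange δ v (F.suc k) j) (sym (lookup-other v (inject₁ k) (F.suc k) _ _ j≢ j≢i))
                    (still (λ e → j≢i (FP.toℕ-injective (trans (ℕP.suc-injective e) (sym (FP.toℕ-inject₁ k)))))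
                      (λ e → j≢ (FP.toℕ-injective e)) (λ ()))

  lookup-ext : ∀ {A : Set} {m} {u v : Vec A m} → (∀ k → lookup u k ≡ lookup v k) → u ≡ v
  lookup-ext {u = u} {v} h = trans (sym (VP.tabulate∘lookup u)) (trans (VP.tabulate-cong h) (VP.tabulate∘lookup v))

  -- h (x - y) is the contribution of a pair of runners x before y to the degree.
  h : ℤ → ℕ
  h (+ zero) = 0
  h (+ suc k) = k
  h -[1+ k ] = suc k

  -- The symmetry about 1/2 is the reason why a runner that goes round the end of the window, its
  -- height changing by one, keeps its contribution with every runner in between.
  h-1- : ∀ d → h (+ 1 - d) ≡ h d
  h-1- (+ zero) = refl
  h-1- (+ suc zero) = refl
  h-1- (+ suc (suc k)) = refl
  h-1- -[1+ k ] = refl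

  h-neg : ∀ d → + 0 < d → h (- d) ≡ suc (h d)
  h-neg (+ suc k) _ = refl
  h-neg (+ zero) (ℤ.+<+ ())

  h-neg≤ : ∀ d → h (- d) ℕ.≤ suc (h d)
  h-neg≤ (+ zero) = ℕ.z≤n
  h-neg≤ (+ suc k) = ℕP.≤-refl
  h-neg≤ -[1+ k ] = ℕP.≤-trans (ℕP.n≤1+n k) (ℕP.≤-trans (ℕP.n≤1+n (suc k)) ℕP.≤-refl)

  h-2- : ∀ d → d ≤ + 0 → h (+ 2 - d) ≡ suc (h d)
  h-2- (+ zero) _ = refl
  h-2- (+ suc k) (ℤ.+≤+ ())
  h-2- -[1+ k ] _ = refl

  h-2-≤ : ∀ d → h (+ 2 - d) ℕ.≤ suc (h d)
  h-2-≤ (+ zero) = ℕP.≤-refl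
  h-2-≤ (+ suc zero) = ℕ.z≤n
  h-2-≤ (+ suc (suc zero)) = ℕ.z≤n
  h-2-≤ (+ suc (suc (suc k))) = ℕP.≤-trans (ℕP.n≤1+n (suc k)) (ℕP.n≤1+n _)
  h-2-≤ -[1+ k ] = ℕP.≤-refl

  H : ∀ {m} → ℤ → Vec ℤ m → ℕ
  H x [] = 0
  H x (y ∷ v) = h (x - y) ℕ.+ H x v

  -- This is the length formula for minimal coset representatives, summed over pairs of runners:
  -- with height difference d, a pair contributes -d if d ≤ 0 and d - 1 if d > 0.
  D : ∀ {m} → Vec ℤ m → ℕ
  D [] = 0
  D (x ∷ v) = H x v ℕ.+ D v

  private
    swapAt : ∀ {m} → Fin m → Vec ℤ (suc m) → Vec ℤ (suc m)
    swapAt k v = (v [ inject₁ k ]≔ lookup v (F.suc k)) [ F.suc k ]≔ lookup v (inject₁ k)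

    shuffle : ∀ a b c → a ℕ.+ (b ℕ.+ c) ≡ b ℕ.+ (a ℕ.+ c)
    shuffle a b c = trans (sym (ℕP.+-assoc a b c)) (trans (cong (ℕ._+ c) (ℕP.+-comm a b)) (ℕP.+-assoc b a c))

    H-swap : ∀ {m} z (k : Fin m) v → H z (swapAt k v) ≡ H z v
    H-swap z F.zero (x ∷ y ∷ v) = shuffle (h (z - y)) (h (z - x)) (H z v)
    H-swap z (F.suc k) (x ∷ v@(_ ∷ _)) = cong (h (z - x) ℕ.+_) (H-swap z k v)

    -- Neighbouring runners change places, so only their own pair is read in the other order. Its
    -- old and new contributions stand on opposite sides because subtraction in ℕ truncates.
    D-swap : ∀ {m} (k : Fin m) v → D (swapAt k v) ℕ.+ h (lookup v (inject₁ k) - lookup v (F.suc k)) ≡ D v ℕ.+ h (lookup v (F.suc k) - lookup v (inject₁ k))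
    D-swap F.zero (x ∷ y ∷ v) = lem (h (x - y)) (h (y - x)) (H x v) (H y v) (D v)
      where
      lem : ∀ a b c d e → (b ℕ.+ d) ℕ.+ (c ℕ.+ e) ℕ.+ a ≡ (a ℕ.+ c) ℕ.+ (d ℕ.+ e) ℕ.+ b
      lem = solve-ℕ
    D-swap (F.suc k) (x ∷ v@(_ ∷ _)) = trans (ℕP.+-assoc (H x (swapAt k v)) _ _)
      (trans (cong₂ ℕ._+_ (H-swap x k v) (D-swap k v)) (sym (ℕP.+-assoc (H x v) _ _)))

    -- G v y is the contribution of the last entry of v to the degree, were that entry y.
    G : ∀ {m} → Vec ℤ (suc m) → ℤ → ℕ
    G (x ∷ []) y = 0
    G (x ∷ v@(_ ∷ _)) y = h (x - y) ℕ.+ G v y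

    last : ∀ {m} → Vec ℤ (suc m) → ℤ
    last {m} v = lookup v (fromℕ m)

    setLast : ∀ {m} → Vec ℤ (suc m) → ℤ → Vec ℤ (suc m)
    setLast {m} v y = v [ fromℕ m ]≔ y

    H-G : ∀ {m} z (v : Vec ℤ (suc m)) → H z v ≡ G v (z - + 1) ℕ.+ h (z - last v)
    H-G z (x ∷ []) = ℕP.+-identityʳ _
    H-G z (x ∷ v@(_ ∷ _)) = trans (cong₂ ℕ._+_ (trans (sym (h-1- (z - x))) (cong h (lem z x))) (H-G z v)) (sym (ℕP.+-assoc (h (x - (z - + 1))) (G v (z - + 1)) (h (z - last v))))
      where
      lem : ∀ z x → + 1 - (z - x) ≡ x - (z - + 1)
      lem = solve-∀

    G-setLast : ∀ {m} (v : Vec ℤ (suc m)) y w → G (setLast v y) w ≡ G v w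
    G-setLast (x ∷ []) y w = refl
    G-setLast (x ∷ v@(_ ∷ [])) y w = refl
    G-setLast (x ∷ v@(_ ∷ v'@(_ ∷ _))) y w = cong (h (x - w) ℕ.+_) (G-setLast v y w)

    last-setLast : ∀ {m} (v : Vec ℤ (suc m)) y → last (setLast v y) ≡ y
    last-setLast {m} v y = VP.lookup∘updateAt (fromℕ m) v

    H-setLast : ∀ {m} z (v : Vec ℤ (suc m)) y → H z (setLast v y) ℕ.+ h (z - last v) ≡ H z v ℕ.+ h (z - y)
    H-setLast z (x ∷ []) y = lem (h (z - x)) (h (z - y))
      where
      lem : ∀ a b → b ℕ.+ 0 ℕ.+ a ≡ a ℕ.+ 0 ℕ.+ b
      lem = solve-ℕ
    H-setLast z (x ∷ v@(_ ∷ _)) y = trans (ℕP.+-assoc (h (z - x)) _ _) (trans (cong (h (z - x) ℕ.+_) (H-setLast z v y)) (sym (ℕP.+-assoc (h (z - x)) _ _)))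

    D-setLast : ∀ {m} (v : Vec ℤ (suc m)) y → D (setLast v y) ℕ.+ G v (last v) ≡ D v ℕ.+ G v y
    D-setLast (x ∷ []) y = refl
    D-setLast (x ∷ v@(_ ∷ _)) y = trans (lem (H x (setLast v y)) (D (setLast v y)) (h (x - last v)) (G v (last v)))
      (trans (cong₂ ℕ._+_ (H-setLast x v y) (D-setLast v y)) (lem' (H x v) (h (x - y)) (D v) (G v y)))
      where
      lem : ∀ a b c d → a ℕ.+ b ℕ.+ (c ℕ.+ d) ≡ (a ℕ.+ c) ℕ.+ (b ℕ.+ d)
      lem = solve-ℕ
      lem' : ∀ a b c d → (a ℕ.+ b) ℕ.+ (c ℕ.+ d) ≡ a ℕ.+ c ℕ.+ (b ℕ.+ d)
      lem' = solve-ℕ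

    -- By the symmetry of `h` each end keeps its contributions with the runners in between. Only the
    -- pair of the two ends changes; both heights move by one, so its difference d becomes 2 - d.
    D-ends : ∀ {m} x (v : Vec ℤ (suc m)) → D ((last v - -[1+ 0 ]) ∷ setLast v (x ℤ.+ -[1+ 0 ])) ℕ.+ h (x - last v) ≡ D (x ∷ v) ℕ.+ h (+ 2 - (x - last v))
    D-ends x v = begin
      H b+ v' ℕ.+ D v' ℕ.+ h (x - b)                           ≡⟨ cong (λ w → w ℕ.+ D v' ℕ.+ h (x - b)) (H-G b+ v') ⟩
      G v' (b+ - + 1) ℕ.+ h (b+ - last v') ℕ.+ D v' ℕ.+ h (x - b)
        ≡⟨ cong₂ (λ g k → g ℕ.+ h k ℕ.+ D v' ℕ.+ h (x - b)) (trans (G-setLast v _ _) (cong (G v) (l1 b))) (trans (cong (λ w → b+ - w) (last-setLast v _)) (l2 b x)) ⟩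
      G v b ℕ.+ h (+ 2 - (x - b)) ℕ.+ D v' ℕ.+ h (x - b)
        ≡⟨ l3 (G v b) (h (+ 2 - (x - b))) (D v') (h (x - b)) ⟩
      (D v' ℕ.+ G v b) ℕ.+ h (x - b) ℕ.+ h (+ 2 - (x - b))
        ≡⟨ cong (λ w → w ℕ.+ h (x - b) ℕ.+ h (+ 2 - (x - b))) (D-setLast v _) ⟩
      (D v ℕ.+ G v (x - + 1)) ℕ.+ h (x - b) ℕ.+ h (+ 2 - (x - b))
        ≡⟨ cong (ℕ._+ h (+ 2 - (x - b))) (l4 (D v) (G v (x - + 1)) (h (x - b))) ⟩
      (G v (x - + 1) ℕ.+ h (x - b)) ℕ.+ D v ℕ.+ h (+ 2 - (x - b))
        ≡⟨ cong (λ w → w ℕ.+ D v ℕ.+ h (+ 2 - (x - b))) (sym (H-G x v)) ⟩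
      H x v ℕ.+ D v ℕ.+ h (+ 2 - (x - b)) ∎
      where
      open ≡-Reasoning
      b = last v
      b+ = b - -[1+ 0 ]
      v' = setLast v (x ℤ.+ -[1+ 0 ])
      l1 : ∀ b → b - -[1+ 0 ] - + 1 ≡ b
      l1 = solve-∀
      l2 : ∀ b x → b - -[1+ 0 ] - (x ℤ.+ -[1+ 0 ]) ≡ + 2 - (x - b)
      l2 = solve-∀
      l3 : ∀ a b c d → a ℕ.+ b ℕ.+ c ℕ.+ d ≡ c ℕ.+ a ℕ.+ d ℕ.+ b
      l3 = solve-ℕ
      l4 : ∀ a b c → a ℕ.+ b ℕ.+ c ≡ b ℕ.+ c ℕ.+ a
      l4 = solve-ℕ

  qact : ∀ {n} → Fin n → Vec ℤ n → Vec ℤ n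
  qact = exchange -[1+ 0 ]

  -- Position `i` carries class c and position `c` carries class c + 1, so the runner of class c is
  -- the higher one and its top bead has a vacancy next to it. For c = 0 the class is carried by the
  -- integer n, a period higher than 0, which turns the strict inequality into a weak one.
  data Rising {n} (q : Vec ℤ n) (c : Fin n) : Set where
    inner : ∀ i → suc (toℕ i) ≡ toℕ c → lookup q c < lookup q i → Rising q c
    outer : ∀ i → toℕ c ≡ 0 → suc (toℕ i) ≡ n → lookup q c ≤ lookup q i → Rising q c

  private
    cancel≡ : ∀ {a b d e} → a ℕ.+ d ≡ b ℕ.+ e → e ≡ suc d → a ≡ suc b
    cancel≡ {a} {b} {d} p refl = ℕP.+-cancelʳ-≡ d a (suc b) (trans p (ℕP.+-suc b d))

    cancel≤ : ∀ {a b d e} → a ℕ.+ d ≡ b ℕ.+ e → e ℕ.≤ suc d → a ℕ.≤ suc b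
    cancel≤ {a} {b} {d} p q = ℕP.+-cancelʳ-≤ d a (suc b) (ℕP.≤-trans (ℕP.≤-reflexive p) (ℕP.≤-trans (ℕP.+-monoʳ-≤ b q) (ℕP.≤-reflexive (ℕP.+-suc b d))))

    flip- : ∀ x y → y - x ≡ - (x - y)
    flip- = solve-∀

  D-rising : ∀ {n} → 2 ℕ.≤ n → (q : Vec ℤ n) (c : Fin n) → Rising q c → D (qact c q) ≡ suc (D q)
  D-rising {suc zero} (ℕ.s≤s ()) q F.zero r
  D-rising {suc (suc m)} _ q (F.suc k) (inner i e lt) with FP.toℕ-injective {i = i} {j = inject₁ k} (trans (ℕP.suc-injective e) (sym (FP.toℕ-inject₁ k)))
  ... | refl = cancel≡ (D-swap k q) (trans (cong h (flip- (lookup q (inject₁ k)) (lookup q (F.suc k)))) (h-neg (lookup q (inject₁ k) - lookup q (F.suc k)) (lia 2 (λ a b → a :< b ⇒ [ #0 :< b ⊖ a ]) _ _ lt)))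
  D-rising {suc (suc m)} _ (x ∷ v) F.zero (outer F.zero _ () le)
  D-rising {suc (suc m)} _ (x ∷ v) F.zero (outer (F.suc i) _ e le) with FP.toℕ-injective {i = i} {j = fromℕ m} (trans (ℕP.suc-injective (ℕP.suc-injective e)) (sym (FP.toℕ-fromℕ m)))
  ... | refl = cancel≡ (D-ends x v) (h-2- _ (lia 2 (λ a b → a :≤ b ⇒ [ a ⊖ b :≤ #0 ]) _ _ le))

  h-neg⁻¹ : ∀ d → h (- d) ≡ suc (h d) → + 0 < d
  h-neg⁻¹ (+ zero) ()
  h-neg⁻¹ (+ suc k) _ = ℤ.+<+ (ℕ.s≤s ℕ.z≤n)
  h-neg⁻¹ -[1+ k ] e = ⊥-elim (ℕP.<-irrefl e (ℕP.≤-trans (ℕP.n≤1+n _) ℕP.≤-refl))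

  h-2-⁻¹ : ∀ d → h (+ 2 - d) ≡ suc (h d) → d ≤ + 0
  h-2-⁻¹ (+ zero) _ = ℤP.≤-refl
  h-2-⁻¹ (+ suc zero) ()
  h-2-⁻¹ (+ suc (suc zero)) ()
  h-2-⁻¹ (+ suc (suc (suc k))) e = ⊥-elim (ℕP.<-irrefl e (ℕP.≤-trans (ℕP.n≤1+n _) ℕP.≤-refl))
  h-2-⁻¹ -[1+ k ] _ = ℤ.-≤+

  private
    cancel≡⁻¹ : ∀ {a b d e} → a ℕ.+ d ≡ b ℕ.+ e → a ≡ suc b → e ≡ suc d
    cancel≡⁻¹ {_} {b} {d} {e} p refl = ℕP.+-cancelˡ-≡ b e (suc d) (trans (sym p) (sym (ℕP.+-suc b d)))

  D-rising⁻¹ : ∀ {n} → 2 ℕ.≤ n → (q : Vec ℤ n) (c : Fin n) → D (qact c q) ≡ suc (D q) → Rising q c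
  D-rising⁻¹ {suc zero} (ℕ.s≤s ()) q F.zero
  D-rising⁻¹ {suc (suc m)} _ q (F.suc k) e = inner (inject₁ k) (cong suc (FP.toℕ-inject₁ k))
    (lia 2 (λ a b → #0 :< a ⊖ b ⇒ [ b :< a ]) _ _ (h-neg⁻¹ (lookup q (inject₁ k) - lookup q (F.suc k))
      (trans (cong h (sym (flip- (lookup q (inject₁ k)) (lookup q (F.suc k))))) (cancel≡⁻¹ (D-swap k q) e))))
  D-rising⁻¹ {suc (suc m)} _ (x ∷ v) F.zero e = outer (fromℕ (suc m)) refl (cong suc (FP.toℕ-fromℕ (suc m)))
    (lia 2 (λ a b → a ⊖ b :≤ #0 ⇒ [ a :≤ b ]) _ _ (h-2-⁻¹ (x - last v) (cancel≡⁻¹ (D-ends x v) e)))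

  -- This holds for every height vector, whether or not the letter adds corners, and so bounds `D`
  -- along an arbitrary word.
  D-step : ∀ {n} → 2 ℕ.≤ n → (q : Vec ℤ n) (c : Fin n) → D (qact c q) ℕ.≤ suc (D q)
  D-step {suc zero} (ℕ.s≤s ()) q F.zero
  D-step {suc (suc m)} _ q (F.suc k) = cancel≤ (D-swap k q) (subst (λ z → h z ℕ.≤ suc (h (lookup q (inject₁ k) - lookup q (F.suc k)))) (sym (flip- (lookup q (inject₁ k)) (lookup q (F.suc k)))) (h-neg≤ (lookup q (inject₁ k) - lookup q (F.suc k))))
  D-step {suc (suc m)} _ (x ∷ v) F.zero = cancel≤ (D-ends x v) (h-2-≤ (x - last v))

  D-const : ∀ m z → D (V.replicate m z) ≡ 0
  D-const zero z = refl
  D-const (suc m) z = cong₂ ℕ._+_ (H-const m) (D-const m z)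
    where
    H-const : ∀ m → H z (V.replicate m z) ≡ 0
    H-const zero = refl
    H-const (suc m) = cong₂ ℕ._+_ (cong h (ℤP.+-inverseʳ z)) (H-const m)

open Runners

module Cores (n : ℕ) {{nz : ℕ.NonZero n}} (2≤n : 2 ℕ.≤ n) where

  -- Congruence modulo n and affine transpositions

  ≤-<-connexℤ : ∀ x y → x ≤ y ⊎ y < x
  ≤-<-connexℤ x y with x ℤP.≤? y
  ... | yes p = inj₁ p
  ... | no p = inj₂ (ℤP.≰⇒> p)

  N : ℤ
  N = + n

  2≤N : + 2 ≤ N
  2≤N = ℤ.+≤+ 2≤n

  infix 4 _≋_ _≋?_

  record _≋_ (x y : ℤ) : Set where
    constructor mk
    field
      quot : ℤ
      eq : x ≡ y + quot * N

  abstract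
    _≋?_ : ∀ x y → Dec (x ≋ y)
    x ≋? y with N Signed.∣? (x - y)
    ... | yes (Signed.divides q e) = yes (mk q (trans (lem x y) (cong (λ z → y + z) e)))
      where
      lem : ∀ x y → x ≡ y + (x - y)
      lem = solve-∀
    ... | no ¬d = no λ { (mk q e) → ¬d (Signed.divides q (trans (cong (λ z → z - y) e) (lem y (q * N)))) }
      where
      lem : ∀ y z → y + z - y ≡ z
      lem = solve-∀

  ≋-refl : ∀ {x} → x ≋ x
  ≋-refl {x} = mk (+ 0) (sym (ℤP.+-identityʳ x))

  ≋-sym : ∀ {x y} → x ≋ y → y ≋ x
  ≋-sym {x} {y} (mk q refl) = mk (- q) (lem y q N)
    where
    lem : ∀ y q n → y ≡ y + q * n + - q * n
    lem = solve-∀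

  ≋-trans : ∀ {x y z} → x ≋ y → y ≋ z → x ≋ z
  ≋-trans {z = z} (mk p refl) (mk q refl) = mk (q + p) (lem z p q N)
    where
    lem : ∀ z p q n → z + q * n + p * n ≡ z + (q + p) * n
    lem = solve-∀

  ≋-shift : ∀ {x y x' y'} → x ≋ y → x' - y' ≡ x - y → x' ≋ y'
  ≋-shift {x} {y} {x'} {y'} (mk q refl) e = mk q (trans (l1 x' y') (trans (cong (λ z → y' + z) e) (l2 y y' (q * N))))
    where
    l1 : ∀ x' y' → x' ≡ y' + (x' - y')
    l1 = solve-∀
    l2 : ∀ y y' z → y' + (y + z - y) ≡ y' + z
    l2 = solve-∀

  ≋-+ : ∀ {x y} k → x ≋ y → x + k ≋ y + k
  ≋-+ {x} {y} k h = ≋-shift h (lem x y k)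
    where
    lem : ∀ x y k → x + k - (y + k) ≡ x - y
    lem = solve-∀

  ≋-pred : ∀ {x y} → x ≋ y + + 1 → x - + 1 ≋ y
  ≋-pred {x} {y} h = ≋-shift h (lem x y)
    where
    lem : ∀ x y → x - + 1 - y ≡ x - (y + + 1)
    lem = solve-∀

  ≋-suc : ∀ {x y} → x - + 1 ≋ y → x ≋ y + + 1
  ≋-suc {x} {y} h = ≋-shift h (lem x y)
    where
    lem : ∀ x y → x - (y + + 1) ≡ x - + 1 - y
    lem = solve-∀

  ≋-up : ∀ {x} → x + N ≋ x
  ≋-up {x} = mk (+ 1) (cong (λ z → x + z) (sym (ℤP.*-identityˡ N)))

  ≋-down : ∀ {x} → x - N ≋ x
  ≋-down {x} = mk (- + 1) (cong (λ z → x + z) (sym (ℤP.-1*i≡-i N)))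

  ≡⇒≋ : ∀ {x y} → x ≡ y → x ≋ y
  ≡⇒≋ refl = ≋-refl

  ≋-gaps : ∀ {x y} → x ≋ y → x ≡ y ⊎ (x + N ≤ y ⊎ y + N ≤ x)
  ≋-gaps {x} {y} (mk (+ zero) e) = inj₁ (trans e (ℤP.+-identityʳ y))
  ≋-gaps {x} {y} (mk (+ suc k) e) = inj₂ (inj₂ (subst (λ z → y + N ≤ z) (sym e)
     (ℤP.+-monoʳ-≤ y (ℤP.≤-trans (ℤ.+≤+ (ℕP.m≤m+n n (k ℕ.* n))) (ℤP.≤-reflexive (ℤP.pos-* (suc k) n))))))
  ≋-gaps {x} {y} (mk -[1+ k ] e) = inj₂ (inj₁ (lia 4 (λ x y w v → x :≡ y ⊖ w ⇒ v :≤ w ⇒ [ x ⊕ v :≤ y ]) x y (+ suc k * N) N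
     (trans e (cong (λ z → y + z) (lem (+ suc k) N)))
     (ℤP.≤-trans (ℤ.+≤+ (ℕP.m≤m+n n (k ℕ.* n))) (ℤP.≤-reflexive (ℤP.pos-* (suc k) n)))))
    where
    lem : ∀ k n → - k * n ≡ - (k * n)
    lem = solve-∀

  ≋-near : ∀ {x y} → x ≋ y → x < y + N → y < x + N → x ≡ y
  ≋-near {x} {y} h p q with ≋-gaps h
  ... | inj₁ e = e
  ... | inj₂ (inj₁ r) = ⊥-elim (lia 3 (λ x y n → x ⊕ n :≤ y ⇒ y :< x ⊕ n ⇒ [ ⊥ₐ ]) x y N r q)
  ... | inj₂ (inj₂ r) = ⊥-elim (lia 3 (λ x y n → y ⊕ n :≤ x ⇒ x :< y ⊕ n ⇒ [ ⊥ₐ ]) x y N r p)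

  ≋-gap : ∀ {x y} → x ≋ y → x < y → x + N ≤ y
  ≋-gap {x} {y} h p with ≋-gaps h
  ... | inj₁ e = ⊥-elim (lia 2 (λ x y → x :≡ y ⇒ x :< y ⇒ [ ⊥ₐ ]) x y e p)
  ... | inj₂ (inj₁ r) = r
  ... | inj₂ (inj₂ r) = ⊥-elim (lia 3 (λ x y n → y ⊕ n :≤ x ⇒ x :< y ⇒ #2 :≤ n ⇒ [ ⊥ₐ ]) x y N r p 2≤N)

  ≋̸-suc : ∀ {x} → ¬ (x ≋ x + + 1)
  ≋̸-suc {x} h = lia 2 (λ x n → x ⊕ n :≤ x ⊕ #1 ⇒ #2 :≤ n ⇒ [ ⊥ₐ ]) x N
    (≋-gap h (lia 1 (λ x → [ x :< x ⊕ #1 ]) x)) 2≤N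

  representative : ∀ z lo → ∃[ z' ] (z' ≋ z × lo ≤ z' × z' < lo + N)
  representative z lo = lo + + ((z - lo) ℤD.%ℕ n)
    , ≋-sym (mk ((z - lo) ℤD./ℕ n) (trans (l1 z lo) (trans (cong (λ y → lo + y) (ℤD.a≡a%ℕn+[a/ℕn]*n (z - lo) n)) (sym (ℤP.+-assoc lo _ _)))))
    , ℤP.≤-trans (ℤP.≤-reflexive (sym (ℤP.+-identityʳ lo))) (ℤP.+-monoʳ-≤ lo (ℤ.+≤+ ℕ.z≤n))
    , ℤP.+-monoʳ-< lo (ℤ.+<+ (ℤD.n%ℕd<d (z - lo) n))
    where
    l1 : ∀ z lo → z ≡ lo + (z - lo)
    l1 = solve-∀

  ⌜_⌝ : Fin n → ℤ
  ⌜ c ⌝ = + toℕ c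

  residue-spec : ∀ z → ∃[ c ] (⌜ c ⌝ ≋ z)
  residue-spec z = fromℕ< lt , subst (λ k → + k ≋ z) (sym (FP.toℕ-fromℕ< lt))
      (≋-sym (mk (z ℤD./ℕ n) (ℤD.a≡a%ℕn+[a/ℕn]*n z n)))
    where lt = ℤD.n%ℕd<d z n

  residue : ℤ → Fin n
  residue z = proj₁ (residue-spec z)

  residue-≋ : ∀ z → ⌜ residue z ⌝ ≋ z
  residue-≋ z = proj₂ (residue-spec z)

  ⌜⌝<N : ∀ c → ⌜ c ⌝ < N
  ⌜⌝<N c = ℤ.+<+ (FP.toℕ<n c)

  0≤⌜⌝ : ∀ c → + 0 ≤ ⌜ c ⌝
  0≤⌜⌝ c = ℤ.+≤+ ℕ.z≤n

  ⌜⌝-inj : ∀ {c d} → ⌜ c ⌝ ≋ ⌜ d ⌝ → c ≡ d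
  ⌜⌝-inj {c} {d} h = FP.toℕ-injective (ℤP.+-injective (≋-near h
    (lia 3 (λ c d n → c :< n ⇒ #0 :≤ d ⇒ [ c :< d ⊕ n ]) ⌜ c ⌝ ⌜ d ⌝ N (⌜⌝<N c) (0≤⌜⌝ d))
    (lia 3 (λ c d n → c :< n ⇒ #0 :≤ d ⇒ [ c :< d ⊕ n ]) ⌜ d ⌝ ⌜ c ⌝ N (⌜⌝<N d) (0≤⌜⌝ c))))

  data Tr (x y z : ℤ) : ℤ → Set where
    fst : z ≋ x → Tr x y z (z + (y - x))
    snd : ¬ z ≋ x → z ≋ y → Tr x y z (z + (x - y))
    off : ¬ z ≋ x → ¬ z ≋ y → Tr x y z z

  abstract

    -- The class of `x` is tested first, so for `x ≋ y` this is a translation by `y - x`. It is the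
    -- affine transposition when the classes differ, whence the hypothesis `¬ x ≋ y` below.
    tr : ℤ → ℤ → ℤ → ℤ
    tr x y z with z ≋? x
    ... | yes _ = z + (y - x)
    ... | no _ with z ≋? y
    ...   | yes _ = z + (x - y)
    ...   | no _ = z

    tr-view : ∀ x y z → Tr x y z (tr x y z)
    tr-view x y z with z ≋? x
    ... | yes h = fst h
    ... | no ¬h with z ≋? y
    ...   | yes k = snd ¬h k
    ...   | no ¬k = off ¬h ¬k

  tr-fst : ∀ {x y z} → z ≋ x → tr x y z ≡ z + (y - x)
  tr-fst {x} {y} {z} h with tr x y z | tr-view x y z
  ... | _ | fst _ = refl
  ... | _ | snd ¬h _ = ⊥-elim (¬h h)
  ... | _ | off ¬h _ = ⊥-elim (¬h h)

  tr-snd : ∀ {x y z} → ¬ x ≋ y → z ≋ y → tr x y z ≡ z + (x - y)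
  tr-snd {x} {y} {z} ¬xy h with tr x y z | tr-view x y z
  ... | _ | fst k = ⊥-elim (¬xy (≋-trans (≋-sym k) h))
  ... | _ | snd _ _ = refl
  ... | _ | off _ ¬h = ⊥-elim (¬h h)

  tr-off : ∀ {x y z} → ¬ z ≋ x → ¬ z ≋ y → tr x y z ≡ z
  tr-off {x} {y} {z} ¬h ¬k with tr x y z | tr-view x y z
  ... | _ | fst h = ⊥-elim (¬h h)
  ... | _ | snd _ k = ⊥-elim (¬k k)
  ... | _ | off _ _ = refl

  ≋-move : ∀ {x y z} → z ≋ x → z + (y - x) ≋ y
  ≋-move {x} {y} {z} h = ≋-shift h (lem x y z)
    where
    lem : ∀ x y z → z + (y - x) - y ≡ z - x
    lem = solve-∀

  move-back : ∀ x y z → z + (y - x) + (x - y) ≡ z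
  move-back = solve-∀

  tr-invol : ∀ {x y} → ¬ x ≋ y → ∀ z → tr x y (tr x y z) ≡ z
  tr-invol {x} {y} ¬xy z with tr x y z | tr-view x y z
  ... | _ | fst h = trans (tr-snd ¬xy (≋-move h)) (move-back x y z)
  ... | _ | snd _ h = trans (tr-fst (≋-move h)) (move-back y x z)
  ... | _ | off h k = tr-off h k

  -- Equivalent to f (z + n) = f z + n, in a form that needs no induction over multiples of n.
  Per : (ℤ → ℤ) → Set
  Per f = ∀ u v → u ≋ v → f u ≡ f v + (u - v)

  per-tr : ∀ x y → Per (tr x y)
  per-tr x y u v h with tr x y u | tr-view x y u | tr x y v | tr-view x y v
  ... | _ | fst _ | _ | fst _ = lem u v (y - x)
    where
    lem : ∀ u v d → u + d ≡ v + d + (u - v)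
    lem = solve-∀
  ... | _ | fst p | _ | snd q _ = ⊥-elim (q (≋-trans (≋-sym h) p))
  ... | _ | fst p | _ | off q _ = ⊥-elim (q (≋-trans (≋-sym h) p))
  ... | _ | snd p _ | _ | fst q = ⊥-elim (p (≋-trans h q))
  ... | _ | snd _ _ | _ | snd _ _ = lem u v (x - y)
    where
    lem : ∀ u v d → u + d ≡ v + d + (u - v)
    lem = solve-∀
  ... | _ | snd _ p | _ | off _ q = ⊥-elim (q (≋-trans (≋-sym h) p))
  ... | _ | off p _ | _ | fst q = ⊥-elim (p (≋-trans h q))
  ... | _ | off _ p | _ | snd _ q = ⊥-elim (p (≋-trans h q))
  ... | _ | off _ _ | _ | off _ _ = lem u v
    where
    lem : ∀ u v → u ≡ v + (u - v)
    lem = solve-∀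

  per-≋ : ∀ {f} → Per f → ∀ {u v} → u ≋ v → f u ≋ f v
  per-≋ {f} pf {u} {v} h = ≋-shift h (trans (cong (λ z → z - f v) (pf u v h)) (lem (f v) u v))
    where
    lem : ∀ a u v → a + (u - v) - a ≡ u - v
    lem = solve-∀

  per-∘ : ∀ {f g} → Per f → Per g → Per (λ z → f (g z))
  per-∘ {f} {g} pf pg u v h = trans (pf (g u) (g v) (per-≋ pg h))
    (cong (λ z → f (g v) + z) (trans (cong (λ z → z - g v) (pg u v h)) (lem (g v) u v)))
    where
    lem : ∀ a u v → a + (u - v) - a ≡ u - v
    lem = solve-∀

  per--N : ∀ {f} → Per f → ∀ z → f (z - N) ≡ f z - N
  per--N {f} pf z = trans (pf _ _ ≋-down) (cong (λ w → f z + w) (lem z N))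
    where
    lem : ∀ z n → z - n - z ≡ - n
    lem = solve-∀

  per-ext : ∀ {f g} → Per f → Per g → ∀ lo → (∀ z → lo ≤ z → z < lo + N → f z ≡ g z) → ∀ z → f z ≡ g z
  per-ext {f} {g} pf pg lo h z with representative z lo
  ... | z' , z'≋z , l , u = trans (pf z z' (≋-sym z'≋z)) (trans (cong (λ w → w + (z - z')) (h z' l u)) (sym (pg z z' (≋-sym z'≋z))))

  s : Fin n → ℤ → ℤ
  s c = tr ⌜ c ⌝ (⌜ c ⌝ + + 1)

  s-up : ∀ {c z} → z ≋ ⌜ c ⌝ → s c z ≡ z + + 1
  s-up {c} {z} h = trans (tr-fst h) (lem ⌜ c ⌝ z)
    where
    lem : ∀ c z → z + (c + + 1 - c) ≡ z + + 1
    lem = solve-∀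

  s-down : ∀ {c z} → z ≋ ⌜ c ⌝ + + 1 → s c z ≡ z - + 1
  s-down {c} {z} h = trans (tr-snd ≋̸-suc h) (lem ⌜ c ⌝ z)
    where
    lem : ∀ c z → z + (c - (c + + 1)) ≡ z - + 1
    lem = solve-∀

  s-off : ∀ {c z} → ¬ z ≋ ⌜ c ⌝ → ¬ z ≋ ⌜ c ⌝ + + 1 → s c z ≡ z
  s-off = tr-off

  s-invol : ∀ c z → s c (s c z) ≡ z
  s-invol c = tr-invol ≋̸-suc

  per-s : ∀ c → Per (s c)
  per-s c = per-tr _ _

  run : Word n → ℤ → ℤ
  run [] z = z
  run (c ∷ a) z = s c (run a z)

  per-run : ∀ a → Per (run a)
  per-run [] u v h = lem u v
    where
    lem : ∀ u v → u ≡ v + (u - v)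
    lem = solve-∀
  per-run (c ∷ a) = per-∘ (per-s c) (per-run a)

  run-++ : ∀ a b z → run (a ++ b) z ≡ run a (run b z)
  run-++ [] b z = refl
  run-++ (c ∷ a) b z = cong (s c) (run-++ a b z)

  run⁻¹ : Word n → ℤ → ℤ
  run⁻¹ [] z = z
  run⁻¹ (c ∷ a) z = run⁻¹ a (s c z)

  per-run⁻¹ : ∀ a → Per (run⁻¹ a)
  per-run⁻¹ [] = per-run []
  per-run⁻¹ (c ∷ a) = per-∘ (per-run⁻¹ a) (per-s c)

  run-run⁻¹ : ∀ a z → run a (run⁻¹ a z) ≡ z
  run-run⁻¹ [] z = refl
  run-run⁻¹ (c ∷ a) z = trans (cong (s c) (run-run⁻¹ a (s c z))) (s-invol c z)

  run⁻¹-run : ∀ a z → run⁻¹ a (run a z) ≡ z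
  run⁻¹-run [] z = refl
  run⁻¹-run (c ∷ a) z = trans (cong (run⁻¹ a) (s-invol c _)) (run⁻¹-run a z)

  run-inj : ∀ a {y z} → run a y ≡ run a z → y ≡ z
  run-inj a {y} {z} e = trans (sym (run⁻¹-run a y)) (trans (cong (run⁻¹ a) e) (run⁻¹-run a z))

  run⁻¹-cong : ∀ {a b} → (∀ z → run a z ≡ run b z) → ∀ z → run⁻¹ a z ≡ run⁻¹ b z
  run⁻¹-cong {a} {b} h z = run-inj a (trans (run-run⁻¹ a z) (trans (sym (run-run⁻¹ b z)) (sym (h (run⁻¹ b z)))))

  -- Windows as maps of ℤ

  pos : Fin n → ℤ
  pos k = + suc (toℕ k)

  Tracks : Window n → (ℤ → ℤ) → Set
  Tracks v f = ∀ k → lookup v k ≡ f (pos k)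

  pos≢ : ∀ {j c} → suc (toℕ j) ≢ toℕ c → (toℕ c ≡ 0 → suc (toℕ j) ≢ n) → ¬ pos j ≋ ⌜ c ⌝
  pos≢ {j} {c} p r k = case (≋-gaps k)
    where
    j<n : pos j ≤ N
    j<n = ℤ.+≤+ (FP.toℕ<n j)
    case : pos j ≡ ⌜ c ⌝ ⊎ (pos j + N ≤ ⌜ c ⌝ ⊎ ⌜ c ⌝ + N ≤ pos j) → ⊥
    case (inj₁ e) = p (ℤP.+-injective e)
    case (inj₂ (inj₁ e)) = lia 3 (λ j c n → #1 ⊕ j ⊕ n :≤ c ⇒ c :< n ⇒ #0 :≤ j ⇒ [ ⊥ₐ ]) ⌜ j ⌝ ⌜ c ⌝ N e (⌜⌝<N c) (0≤⌜⌝ j)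
    case (inj₂ (inj₂ e)) = r (ℤP.+-injective c≡0) (ℤP.+-injective j≡)
      where
      c≡0 : ⌜ c ⌝ ≡ + 0
      c≡0 = lia 3 (λ j c n → c ⊕ n :≤ j ⇒ j :≤ n ⇒ #0 :≤ c ⇒ [ c :≡ #0 ]) (pos j) ⌜ c ⌝ N e j<n (0≤⌜⌝ c)
      j≡ : pos j ≡ N
      j≡ = lia 3 (λ j c n → c ⊕ n :≤ j ⇒ j :≤ n ⇒ #0 :≤ c ⇒ [ j :≡ n ]) (pos j) ⌜ c ⌝ N e j<n (0≤⌜⌝ c)

  1+-comm : ∀ z → + 1 + z ≡ z + + 1
  1+-comm = solve-∀

  -- The letter acts on positions and on vectors by the same pattern: position `j` reads from `j'`
  -- and crosses the end of the window `e` times, which adds `e * N` in the first case and `e * δ`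
  -- in the second. Stated for all `δ`, one case analysis serves both windows and heights.
  data Target (c j : Fin n) : Set where
    target : ∀ j' e → s c (pos j) ≡ pos j' + e * N → (∀ δ v → lookup (exchange δ c v) j ≡ lookup v j' + e * δ) → Target c j

  private
    -- Which constructor applies depends only on `c` and `j`. The view at one fixed vector selects
    -- the case; at any other `δ` and `v` the remaining constructors are contradictory.
    view-target : ∀ {c j} → (∀ δ v → Exchange δ v c j (lookup (exchange δ c v) j)) → ∀ {w} → Exchange (+ 0) idW c j w → Target c j
    view-target {c} {j} f (step-up j' e e') = target j' (+ 0)
        (trans (s-up {c} (≡⇒≋ (cong +_ e))) (trans (sym (1+-comm (pos j))) (trans (cong (λ k → + suc k) (sym e')) (sym (ℤP.+-identityʳ _)))))
        (λ δ v → trans (all (f δ v)) (sym (ℤP.+-identityʳ _)))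
      where
      all : ∀ {δ v w} → Exchange δ v c j w → w ≡ lookup v j'
      all {v = v} (step-up k p q) = cong (lookup v) (FP.toℕ-injective (trans q (sym e')))
      all (step-down k p q) = ⊥-elim (ℕP.1+n≢n (trans e (sym p)))
      all (wrap-up k p q r) = ⊥-elim (ℕP.1+n≢0 (trans e p))
      all (wrap-down k p q r) = ⊥-elim (ℕP.1+n≢0 (trans e p))
      all (still p q r) = ⊥-elim (p e)
    view-target {c} {j} f (step-down j' e e') = target j' (+ 0)
        (trans (s-down {c} (≡⇒≋ (trans (1+-comm ⌜ j ⌝) (cong (λ k → + k + + 1) e)))) (trans (lem ⌜ j ⌝) (trans (cong +_ (sym e')) (sym (ℤP.+-identityʳ _)))))
        (λ δ v → trans (all (f δ v)) (sym (ℤP.+-identityʳ _)))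
      where
      lem : ∀ z → + 1 + z - + 1 ≡ z
      lem = solve-∀
      all : ∀ {δ v w} → Exchange δ v c j w → w ≡ lookup v j'
      all (step-up k p q) = ⊥-elim (ℕP.1+n≢n (trans p (sym e)))
      all {v = v} (step-down k p q) = cong (lookup v) (FP.toℕ-injective (ℕP.suc-injective (trans q (sym e'))))
      all (wrap-up k p q r) = ⊥-elim (ℕP.1+n≢0 (trans e' (trans e p)))
      all (wrap-down k p q r) = ⊥-elim (ℕP.1+n≢0 (trans e' q))
      all (still p q r) = ⊥-elim (q e)
    view-target {c} {j} f (wrap-up j' c0 e j0) = target j' (+ 1)
        (trans (s-up {c} (≋-trans (≡⇒≋ (cong +_ e)) (≋-trans (≋-sym ≋-down) (≡⇒≋ (trans (ℤP.+-inverseʳ N) (cong +_ (sym c0)))))))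
          (trans (cong (λ k → + k + + 1) e) (trans (lem N) (cong (λ k → + suc k + + 1 * N) (sym j0)))))
        (λ δ v → trans (all (f δ v)) (cong (λ w → lookup v j' + w) (sym (ℤP.*-identityˡ δ))))
      where
      lem : ∀ n → n + + 1 ≡ + 1 + + 1 * n
      lem = solve-∀
      all : ∀ {δ v w} → Exchange δ v c j w → w ≡ lookup v j' + δ
      all (step-up k p q) = ⊥-elim (ℕP.1+n≢0 (trans p c0))
      all (step-down k p q) = ⊥-elim (ℕP.1+n≢0 (trans q (trans p c0)))
      all {δ} {v} (wrap-up k p q r) = cong (λ k → lookup v k + δ) (FP.toℕ-injective (trans r (sym j0)))
      all (wrap-down k p q r) = ⊥-elim (ℕP.<-irrefl (sym (trans (sym e) (cong suc q))) 2≤n)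
      all (still p q r) = ⊥-elim (r c0 e)
    view-target {c} {j} f (wrap-down j' c0 j0 e) = target j' (- + 1)
        (trans (s-down {c} (≡⇒≋ (trans (cong (λ k → + suc k) j0) (cong (λ k → + k + + 1) (sym c0)))))
          (trans (cong (λ k → + suc k - + 1) j0) (trans (lem N) (cong (λ k → + k + - + 1 * N) (sym e)))))
        (λ δ v → trans (all (f δ v)) (cong (λ w → lookup v j' + w) (sym (ℤP.-1*i≡-i δ))))
      where
      lem : ∀ n → + 0 ≡ n + - + 1 * n
      lem = solve-∀
      all : ∀ {δ v w} → Exchange δ v c j w → w ≡ lookup v j' - δ
      all (step-up k p q) = ⊥-elim (ℕP.1+n≢0 (trans p c0))
      all (step-down k p q) = ⊥-elim (ℕP.1+n≢0 (trans q j0))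
      all (wrap-up k p q r) = ⊥-elim (ℕP.<-irrefl (sym (trans (sym q) (cong suc j0))) 2≤n)
      all {δ} {v} (wrap-down k p q r) = cong (λ k → lookup v k - δ) (FP.toℕ-injective (ℕP.suc-injective (trans r (sym e))))
      all (still p q r) = ⊥-elim (q (trans j0 (sym c0)))
    view-target {c} {j} f (still p q r) = target j (+ 0)
        (trans (s-off {c} (pos≢ {j} {c} p r) (λ k → q (cong toℕ (⌜⌝-inj {j} {c} (≋-shift k (lem ⌜ j ⌝ ⌜ c ⌝)))))) (sym (ℤP.+-identityʳ _)))
        (λ δ v → trans (all (f δ v)) (sym (ℤP.+-identityʳ _)))
      where
      lem : ∀ j c → j - c ≡ + 1 + j - (c + + 1)
      lem = solve-∀
      all : ∀ {δ v w} → Exchange δ v c j w → w ≡ lookup v j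
      all (step-up k p' q') = ⊥-elim (p p')
      all (step-down k p' q') = ⊥-elim (q p')
      all (wrap-up k p' q' r') = ⊥-elim (r p' q')
      all (wrap-down k p' q' r') = ⊥-elim (q (trans q' (sym p')))
      all (still p' q' r') = refl

  target-of : ∀ c j → Target c j
  target-of c j = view-target (λ δ v → exchange-view 2≤n δ v c j) (exchange-view 2≤n (+ 0) idW c j)

  tracks-rmul : ∀ {v f} → Per f → Tracks v f → ∀ c → Tracks (rmul v c) (λ z → f (s c z))
  tracks-rmul {v} {f} pf tr c j with target-of c j
  ... | target j' e p q = trans (cong (λ w → lookup w j) (rmul-exchange v c)) (trans (q N v) (trans (cong (λ w → w + e * N) (tr j'))
      (sym (trans (cong f p) (trans (pf _ (pos j') (mk e refl)) (cong (λ w → f (pos j') + w) (lem (pos j') (e * N))))))))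
    where
    lem : ∀ x y → x + y - x ≡ y
    lem = solve-∀

  tracks-foldl : ∀ a {v f} → Per f → Tracks v f → Tracks (foldl rmul v a) (λ z → f (run a z))
  tracks-foldl [] pf h = h
  tracks-foldl (c ∷ a) pf h = tracks-foldl a (per-∘ pf (per-s c)) (tracks-rmul pf h c)

  lookup-eval : ∀ a → Tracks (eval a) (run a)
  lookup-eval a = tracks-foldl a {f = λ z → z} (per-run []) (λ k → VP.lookup∘tabulate _ k)

  eval⇒run : ∀ {a b} → eval a ≡ eval b → ∀ z → run a z ≡ run b z
  eval⇒run {a} {b} e = per-ext (per-run a) (per-run b) (+ 1) window
    where
    window : ∀ z → + 1 ≤ z → z < + 1 + N → run a z ≡ run b z
    window (+ suc k) (ℤ.+≤+ _) (ℤ.+<+ (ℕ.s≤s k<n)) = subst (λ k → run a (+ suc k) ≡ run b (+ suc k)) (FP.toℕ-fromℕ< k<n)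
      (trans (sym (lookup-eval a (fromℕ< k<n))) (trans (cong (λ w → lookup w (fromℕ< k<n)) e) (lookup-eval b (fromℕ< k<n))))

  run⇒eval : ∀ {a b} → (∀ z → run a z ≡ run b z) → eval a ≡ eval b
  run⇒eval {a} {b} h = lookup-ext (λ k → trans (lookup-eval a k) (trans (h (pos k)) (sym (lookup-eval b k))))

  -- Bead sequences

  Seq : Set
  Seq = ℕ → ℤ

  infix 4 _∈_ _∉_ _⊆_

  _∈_ _∉_ : ℤ → Seq → Set
  z ∈ b = ∃[ i ] (b i ≡ z)
  z ∉ b = ¬ (z ∈ b)

  _⊆_ : Seq → Seq → Set
  b ⊆ b' = ∀ i → b i ≤ b' i

  Decreasing : Seq → Set
  Decreasing b = ∀ i → b (suc i) < b i

  +suc : ∀ i → + suc i ≡ + i + + 1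
  +suc i = ℤP.+-comm (+ 1) (+ i)

  module _ {b : Seq} (dec : Decreasing b) where

    dec-≤ : ∀ i k → b (k ℕ.+ i) ≤ b i - + k
    dec-≤ i zero = ℤP.≤-reflexive (sym (ℤP.+-identityʳ (b i)))
    dec-≤ i (suc k) = lia 5 (λ u v w K K' → u :< v ⇒ v :≤ w ⊖ K ⇒ K' :≡ K ⊕ #1 ⇒ [ u :≤ w ⊖ K' ])
      (b (suc k ℕ.+ i)) (b (k ℕ.+ i)) (b i) (+ k) (+ suc k) (dec (k ℕ.+ i)) (dec-≤ i k) (+suc k)

    dec-mono< : ∀ {i j} → i ℕ.< j → b j < b i
    dec-mono< {i} {j} (i<j) with ℕP.m≤n⇒∃[o]m+o≡n i<j
    ... | k , refl = subst (λ m → b m < b i) (cong suc (ℕP.+-comm k i))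
       (lia 4 (λ u w K K' → u :≤ w ⊖ K' ⇒ K' :≡ K ⊕ #1 ⇒ #0 :≤ K ⇒ [ u :< w ])
         (b (suc k ℕ.+ i)) (b i) (+ k) (+ suc k) (dec-≤ i (suc k)) (+suc k) (ℤ.+≤+ ℕ.z≤n))

    dec-mono≤ : ∀ {i j} → i ℕ.≤ j → b j ≤ b i
    dec-mono≤ {i} {j} h with ℕP.m≤n⇒m<n∨m≡n h
    ... | inj₁ p = ℤP.<⇒≤ (dec-mono< p)
    ... | inj₂ refl = ℤP.≤-refl

    dec-cancel< : ∀ {i j} → b j < b i → i ℕ.< j
    dec-cancel< {i} {j} h with ℕP.<-≤-connex i j
    ... | inj₁ p = p
    ... | inj₂ p = ⊥-elim (ℤP.<⇒≱ h (dec-mono≤ p))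

    dec-cancel≤ : ∀ {i j} → b j ≤ b i → i ℕ.≤ j
    dec-cancel≤ {i} {j} h with ℕP.≤-<-connex i j
    ... | inj₁ p = p
    ... | inj₂ p = ⊥-elim (ℤP.≤⇒≯ h (dec-mono< p))

    dec-inj : ∀ {i j} → b i ≡ b j → i ≡ j
    dec-inj e = ℕP.≤-antisym (dec-cancel≤ (ℤP.≤-reflexive (sym e))) (dec-cancel≤ (ℤP.≤-reflexive e))

    abstract

      locate : ∀ z → (z ∈ b) ⊎ (∃[ i ] (b i < z × (∀ j → j ℕ.< i → z < b j)))
      -- A strictly decreasing sequence has come down to z after `∣ b 0 - z ∣` steps, so this much
      -- fuel cannot run out.
      locate z = go ℤ.∣ b 0 - z ∣ 0 (subst (λ w → b 0 - z ≤ + w) (sym (ℕP.+-identityʳ _)) abs) (λ _ ())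
        where
        abs : b 0 - z ≤ + ℤ.∣ b 0 - z ∣
        abs with b 0 - z
        ... | + k = ℤP.≤-refl
        ... | -[1+ k ] = ℤ.-≤+
        go : ∀ fuel i → b 0 - z ≤ + (fuel ℕ.+ i) → (∀ j → j ℕ.< i → z < b j) →
             (z ∈ b) ⊎ (∃[ i ] (b i < z × (∀ j → j ℕ.< i → z < b j)))
        go fuel i le above with ℤP.<-cmp (b i) z
        ... | tri< lt _ _ = inj₂ (i , lt , above)
        ... | tri≈ _ e _ = inj₁ (i , e)
        go zero i le above | tri> _ _ gt = ⊥-elim (lia 4 (λ bi b0 z i → b0 ⊖ z :≤ i ⇒ z :< bi ⇒ bi :≤ b0 ⊖ i ⇒ [ ⊥ₐ ])
          (b i) (b 0) z (+ i) le gt (subst (λ m → b m ≤ b 0 - + i) (ℕP.+-identityʳ i) (dec-≤ 0 i)))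
        go (suc fuel) i le above | tri> _ _ gt = go fuel (suc i) (subst (λ m → b 0 - z ≤ + m) (sym (ℕP.+-suc fuel i)) le) above'
          where
          above' : ∀ j → j ℕ.< suc i → z < b j
          above' j j<i = ℤP.<-≤-trans gt (dec-mono≤ (ℕ.s≤s⁻¹ j<i))

    between : ∀ {z i} → b i < z → (∀ j → j ℕ.< i → z < b j) → z ∉ b
    between {z} {i} lt above (j , refl) with ℕP.<-≤-connex j i
    ... | inj₁ p = ℤP.<-irrefl refl (above j p)
    ... | inj₂ p = ℤP.<-irrefl refl (ℤP.<-≤-trans lt (dec-mono≤ p))

    abstract

      _∈?_ : ∀ z → Dec (z ∈ b)
      _∈?_ z with locate z
      ... | inj₁ h = yes h
      ... | inj₂ (i , lt , above) = no (between lt above)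

  -- Membership test for arbitrary sequences; conclusive for decreasing ones, whose entries at most ∣ b 0 - z ∣ later than the first are ≥ z.
  mem? : ∀ (b : Seq) z → Dec (∃[ i ] (i ℕ.< suc ℤ.∣ b 0 - z ∣ × b i ≡ z))
  mem? b z = ℕP.anyUpTo? (λ i → b i ℤP.≟ z) _

  mem-complete : ∀ {b} → Decreasing b → ∀ {z} → z ∈ b → ∃[ i ] (i ℕ.< suc ℤ.∣ b 0 - z ∣ × b i ≡ z)
  mem-complete {b} dec {z} (i , e) = i , ℕ.s≤s (ℤP.drop‿+≤+ (ℤP.≤-trans le (abs (b 0 - z)))) , e
    where
    abs : ∀ w → w ≤ + ℤ.∣ w ∣
    abs (+ k) = ℤP.≤-refl
    abs -[1+ k ] = ℤ.-≤+
    le : + i ≤ b 0 - z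
    le = lia 4 (λ bi b0 z i → bi :≤ b0 ⊖ i ⇒ bi :≡ z ⇒ [ i :≤ b0 ⊖ z ]) (b i) (b 0) z (+ i)
      (subst (λ m → b m ≤ b 0 - + i) (ℕP.+-identityʳ i) (dec-≤ dec 0 i)) e

  -- The index at which `b'` takes the value `b i` is strictly increasing in i, hence at least i.
  range-⊆ : ∀ {b b'} → Decreasing b → Decreasing b' → (∀ z → z ∈ b → z ∈ b') → b ⊆ b'
  range-⊆ {b} {b'} d d' h i = subst (λ w → w ≤ b' i) (proj₂ (σ i)) (dec-mono≤ d' (i≤σ i))
    where
    σ : ∀ i → b i ∈ b'
    σ i = h (b i) (i , refl)
    i≤σ : ∀ i → i ℕ.≤ proj₁ (σ i)
    i≤σ zero = ℕ.z≤n
    i≤σ (suc i) = ℕP.≤-<-trans (i≤σ i) (dec-cancel< d' (subst₂ _<_ (sym (proj₂ (σ (suc i)))) (sym (proj₂ (σ i))) (d i)))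

  range-≡ : ∀ {b b'} → Decreasing b → Decreasing b' → (∀ z → z ∈ b ⇔ z ∈ b') → ∀ i → b i ≡ b' i
  range-≡ d d' h i = ℤP.≤-antisym (range-⊆ d d' (λ z → Equivalence.to (h z)) i) (range-⊆ d' d (λ z → Equivalence.from (h z)) i)

  Closed : Seq → Set
  Closed b = ∀ i → b i - N ∈ b

  closed-≤ : ∀ {b} → Closed b → ∀ {z z'} → z ∈ b → z' ≋ z → z' ≤ z → z' ∈ b
  closed-≤ {b} cl {z} {z'} z∈ (mk (+ zero) e) le = subst (_∈ b) (sym (trans e (ℤP.+-identityʳ z))) z∈
  closed-≤ {b} cl {z} {z'} z∈ (mk (+ suc k) e) le = subst (_∈ b) (ℤP.≤-antisym z≤z' le) z∈
    where
    z≤z' : z ≤ z'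
    z≤z' = subst (z ≤_) (sym e) (ℤP.≤-trans (ℤP.≤-reflexive (sym (ℤP.+-identityʳ z)))
      (ℤP.+-monoʳ-≤ z (ℤP.≤-trans (ℤ.+≤+ {0} {suc k ℕ.* n} ℕ.z≤n) (ℤP.≤-reflexive (ℤP.pos-* (suc k) n)))))
  closed-≤ {b} cl {z} {z'} z∈ (mk -[1+ k ] e) le = subst (_∈ b) (sym (trans e (lem z (+ suc k) N))) (down (suc k))
    where
    lem : ∀ z k n → z + - k * n ≡ z - k * n
    lem = solve-∀
    lem' : ∀ z k n → z - k * n - n ≡ z - (+ 1 + k) * n
    lem' = solve-∀
    down : ∀ k → z - + k * N ∈ b
    down zero = subst (_∈ b) (sym (ℤP.+-identityʳ z)) z∈
    down (suc k) with down k
    ... | i , e = subst (_∈ b) (trans (cong (λ w → w - N) e) (lem' z (+ k) N)) (cl i)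

  -- Exchanging two classes of beads.

  module _ (x y : ℤ) (b : Seq) where

    Movable : ℕ → Set
    Movable i = b i ≋ x × tr x y (b i) ∉ b

    Moves : Seq → Set
    Moves b' = ∀ i → (Movable i × b' i ≡ tr x y (b i)) ⊎ ((b i ≋ x → tr x y (b i) ∈ b) × b' i ≡ b i)

    abstract

      movable? : ∀ i → Dec (b i ≋ x × ¬ (∃[ j ] (j ℕ.< suc ℤ.∣ b 0 - tr x y (b i) ∣ × b j ≡ tr x y (b i))))
      movable? i = b i ≋? x ×-dec ¬? (mem? b (tr x y (b i)))

      move : Seq
      move i with movable? i
      ... | yes _ = tr x y (b i)
      ... | no _ = b i

      move-moves : Decreasing b → Moves move
      move-moves dec i with movable? i
      ... | yes (p , q) = inj₁ ((p , λ m → q (mem-complete dec m)) , refl)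
      ... | no ¬pq = inj₂ (f (mem? b (tr x y (b i))) , refl)
        where
        f : Dec (∃[ j ] (j ℕ.< suc ℤ.∣ b 0 - tr x y (b i) ∣ × b j ≡ tr x y (b i))) → b i ≋ x → tr x y (b i) ∈ b
        f (yes (j , _ , e)) p = j , e
        f (no q) p = ⊥-elim (¬pq (p , q))

  -- Where a bead and its partner are both present, the set does not change. The second last
  -- hypothesis describes the motion of x-beads into vacancies; the last gives every bead of class
  -- `y` its partner in class `x`, so this motion is the whole effect of `tr x y` on the set.
  moves-range : ∀ {x y b b'} → ¬ x ≋ y → Moves x y b b' → (∀ z → z ∈ b → z ≋ y → tr x y z ∈ b) →
    ∀ z → z ∈ b' ⇔ tr x y z ∈ b
  moves-range {x} {y} {b} {b'} ¬xy mv back z = mk⇔ to from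
    where
    to : z ∈ b' → tr x y z ∈ b
    to (i , refl) with mv i
    ... | inj₁ (_ , e) = i , sym (trans (cong (tr x y) e) (tr-invol ¬xy (b i)))
    ... | inj₂ (h , e) = subst (λ w → tr x y w ∈ b) (sym e) unmoved
      where
      unmoved : tr x y (b i) ∈ b
      unmoved with b i ≋? x | b i ≋? y
      ... | yes p | _ = h p
      ... | no _ | yes q = back (b i) (i , refl) q
      ... | no p | no q = i , sym (tr-off p q)
    stay : ∀ i → (¬ b i ≋ x ⊎ tr x y (b i) ∈ b) → b' i ≡ b i
    stay i h with mv i | h
    ... | inj₂ (_ , e) | _ = e
    ... | inj₁ ((p , _) , _) | inj₁ ¬p = ⊥-elim (¬p p)
    ... | inj₁ ((_ , q) , _) | inj₂ m = ⊥-elim (q m)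
    from : tr x y z ∈ b → z ∈ b'
    from (i , e) = subst (_∈ b') (trans (cong (tr x y) e) (tr-invol ¬xy z)) (image (b i ≋? x) (b i ≋? y))
      where
      image : Dec (b i ≋ x) → Dec (b i ≋ y) → tr x y (b i) ∈ b'
      image (yes p) _ with mv i
      ... | inj₁ (_ , e') = i , e'
      ... | inj₂ (h , _) with h p
      ...   | j , ej = j , trans (stay j (inj₁ ¬x)) ej
        where
        ¬x : ¬ b j ≋ x
        ¬x q = ¬xy (≋-trans (≋-sym q) (subst (_≋ y) (sym ej) (subst (_≋ y) (sym (tr-fst p)) (≋-move p))))
      image (no ¬p) (yes q) with back (b i) (i , refl) q
      ... | j , ej = j , trans (stay j (inj₂ (i , sym (trans (cong (tr x y) ej) (tr-invol ¬xy (b i)))))) ej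
      image (no ¬p) (no ¬q) = i , trans (stay i (inj₁ ¬p)) (sym (tr-off ¬p ¬q))

  -- If row i + 1 of a partition has length `b i + i`, then `low` says that rows are nonnegative and
  -- `stable` that only finitely many are nonzero.
  record Maya (b : Seq) : Set where
    field
      dec : Decreasing b
      low : ∀ i → - + i ≤ b i
      stable : ∃[ M ] (∀ i → M ℕ.≤ i → b i ≡ - + i)

  -+suc : ∀ i → - + suc i ≡ - + i - + 1
  -+suc i = trans (cong -_ (+suc i)) (lem (+ i))
    where
    lem : ∀ i → - (i + + 1) ≡ - i - + 1
    lem = solve-∀

  -- Adding and removing all corners of one residue.

  up down : Fin n → Seq → Seq
  up c = move ⌜ c ⌝ (⌜ c ⌝ + + 1)
  down c = move (⌜ c ⌝ + + 1) ⌜ c ⌝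

  HasAddable HasRemovable : Fin n → Seq → Set
  HasAddable c b = ∃[ i ] (b i ≋ ⌜ c ⌝ × b i + + 1 ∉ b)
  HasRemovable c b = ∃[ i ] (b i ≋ ⌜ c ⌝ + + 1 × b i - + 1 ∉ b)

  data UpView (c : Fin n) (b : Seq) (i : ℕ) : ℤ → Set where
    moved : b i ≋ ⌜ c ⌝ → b i + + 1 ∉ b → UpView c b i (b i + + 1)
    fixed : (b i ≋ ⌜ c ⌝ → b i + + 1 ∈ b) → UpView c b i (b i)

  data DownView (c : Fin n) (b : Seq) (i : ℕ) : ℤ → Set where
    moved : b i ≋ ⌜ c ⌝ + + 1 → b i - + 1 ∉ b → DownView c b i (b i - + 1)
    fixed : (b i ≋ ⌜ c ⌝ + + 1 → b i - + 1 ∈ b) → DownView c b i (b i)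

  tr-down : ∀ {c z} → z ≋ ⌜ c ⌝ + + 1 → tr (⌜ c ⌝ + + 1) ⌜ c ⌝ z ≡ z - + 1
  tr-down {c} {z} h = trans (tr-fst h) (lem ⌜ c ⌝ z)
    where
    lem : ∀ c z → z + (c - (c + + 1)) ≡ z - + 1
    lem = solve-∀

  up-view : ∀ c {b} → Decreasing b → ∀ i → UpView c b i (up c b i)
  up-view c {b} dec i with move-moves ⌜ c ⌝ (⌜ c ⌝ + + 1) b dec i
  ... | inj₁ ((p , q) , e) = subst (UpView c b i) (sym (trans e (s-up {c} p))) (moved p (subst (_∉ b) (s-up {c} p) q))
  ... | inj₂ (f , e) = subst (UpView c b i) (sym e) (fixed (λ p → subst (_∈ b) (s-up {c} p) (f p)))

  down-view : ∀ c {b} → Decreasing b → ∀ i → DownView c b i (down c b i)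
  down-view c {b} dec i with move-moves (⌜ c ⌝ + + 1) ⌜ c ⌝ b dec i
  ... | inj₁ ((p , q) , e) = subst (DownView c b i) (sym (trans e (tr-down {c} p))) (moved p (subst (_∉ b) (tr-down {c} p) q))
  ... | inj₂ (f , e) = subst (DownView c b i) (sym e) (fixed (λ p → subst (_∈ b) (tr-down {c} p) (f p)))

  up-≥ : ∀ c {b} → Decreasing b → b ⊆ up c b
  up-≥ c {b} dec i with up c b i | up-view c dec i
  ... | _ | moved _ _ = lia 1 (λ x → [ x :≤ x ⊕ #1 ]) (b i)
  ... | _ | fixed _ = ℤP.≤-refl

  up-maya : ∀ c {b} → Maya b → Maya (up c b)
  up-maya c {b} m = record { dec = dec' ; low = λ i → ℤP.≤-trans (low i) (up-≥ c dec i) ; stable = suc (proj₁ stable) , stable' }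
    where
    open Maya m
    dec' : Decreasing (up c b)
    dec' i = ℤP.<-≤-trans lt (up-≥ c dec i)
      where
      lt : up c b (suc i) < b i
      lt with up c b (suc i) | up-view c dec (suc i)
      ... | _ | fixed _ = dec i
      ... | _ | moved _ q with ℤP.<-cmp (b (suc i) + + 1) (b i)
      ...   | tri< p _ _ = p
      ...   | tri≈ _ e _ = ⊥-elim (q (i , sym e))
      ...   | tri> _ _ p = ⊥-elim (lia 2 (λ u v → u :< v ⇒ v :< u ⊕ #1 ⇒ [ ⊥ₐ ]) (b (suc i)) (b i) (dec i) p)
    stable' : ∀ i → suc (proj₁ stable) ℕ.≤ i → up c b i ≡ - + i
    stable' (suc i) (ℕ.s≤s M≤i) with up c b (suc i) | up-view c dec (suc i)
    ... | _ | fixed _ = proj₂ stable (suc i) (ℕP.m≤n⇒m≤1+n M≤i)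
    ... | _ | moved _ q = ⊥-elim (q (i , trans (proj₂ stable i M≤i) (lia 3 (λ u v w → w :≡ v ⇒ v :≡ u ⊖ #1 ⇒ [ u :≡ w ⊕ #1 ])
           (- + i) (- + suc i) (b (suc i)) (proj₂ stable (suc i) (ℕP.m≤n⇒m≤1+n M≤i)) (-+suc i))))

  down-≤ : ∀ c {b} → Decreasing b → down c b ⊆ b
  down-≤ c {b} dec i with down c b i | down-view c dec i
  ... | _ | moved _ _ = lia 1 (λ x → [ x ⊖ #1 :≤ x ]) (b i)
  ... | _ | fixed _ = ℤP.≤-refl

  down-maya : ∀ c {b} → Maya b → Maya (down c b)
  down-maya c {b} m = record { dec = dec' ; low = low' ; stable = proj₁ stable , stable' }
    where
    open Maya m
    dec' : Decreasing (down c b)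
    dec' i = ℤP.≤-<-trans (down-≤ c dec (suc i)) lt
      where
      lt : b (suc i) < down c b i
      lt with down c b i | down-view c dec i
      ... | _ | fixed _ = dec i
      ... | _ | moved _ q with ℤP.<-cmp (b (suc i)) (b i - + 1)
      ...   | tri< p _ _ = p
      ...   | tri≈ _ e _ = ⊥-elim (q (suc i , e))
      ...   | tri> _ _ p = ⊥-elim (lia 2 (λ u v → u :< v ⇒ v ⊖ #1 :< u ⇒ [ ⊥ₐ ]) (b (suc i)) (b i) (dec i) p)
    low' : ∀ i → - + i ≤ down c b i
    low' i with down c b i | down-view c dec i
    ... | _ | fixed _ = low i
    ... | _ | moved _ q with ℤP.<-cmp (- + i) (b i)
    ...   | tri< p _ _ = lia 2 (λ u v → u :< v ⇒ [ u :≤ v ⊖ #1 ]) (- + i) (b i) p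
    ...   | tri> ¬p _ p = ⊥-elim (ℤP.<⇒≱ p (low i))
    ...   | tri≈ _ e _ = ⊥-elim (q (suc i , lia 4 (λ i b b' i' → i :≡ b ⇒ b' :< b ⇒ i' :≤ b' ⇒ i' :≡ i ⊖ #1 ⇒ [ b' :≡ b ⊖ #1 ])
                (- + i) (b i) (b (suc i)) (- + suc i) e (dec i) (low (suc i)) (-+suc i)))
    stable' : ∀ i → proj₁ stable ℕ.≤ i → down c b i ≡ - + i
    stable' i M≤i with down c b i | down-view c dec i
    ... | _ | fixed _ = proj₂ stable i M≤i
    ... | _ | moved _ q = ⊥-elim (q (suc i , lia 4 (λ i b b' i' → b :≡ i ⇒ b' :≡ i' ⇒ i' :≡ i ⊖ #1 ⇒ [ b' :≡ b ⊖ #1 ])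
                (- + i) (b i) (b (suc i)) (- + suc i) (proj₂ stable i M≤i) (proj₂ stable (suc i) (ℕP.m≤n⇒m≤1+n M≤i)) (-+suc i)))

  -- A closed set cannot have both kinds of corner of one residue.
  addable-back : ∀ c {b} → Decreasing b → Closed b → HasAddable c b → ∀ z → z ∈ b → z ≋ ⌜ c ⌝ + + 1 → z - + 1 ∈ b
  addable-back c {b} dec cl (i , p , q) z z∈ z≋ with ≤-<-connexℤ (z - + 1) (b i)
  ... | inj₁ le = closed-≤ cl (i , refl) (≋-trans (≋-pred z≋) (≋-sym p)) le
  ... | inj₂ lt = ⊥-elim (q (closed-≤ cl z∈ (≋-trans (≋-+ (+ 1) p) (≋-sym z≋))
      (lia 2 (λ b z → b :< z ⊖ #1 ⇒ [ b ⊕ #1 :≤ z ]) (b i) z lt)))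

  removable-back : ∀ c {b} → Decreasing b → Closed b → HasRemovable c b → ∀ z → z ∈ b → z ≋ ⌜ c ⌝ → z + + 1 ∈ b
  removable-back c {b} dec cl (i , p , q) z z∈ z≋ with ≤-<-connexℤ (z + + 1) (b i)
  ... | inj₁ le = closed-≤ cl (i , refl) (≋-trans (≋-+ (+ 1) z≋) (≋-sym p)) le
  ... | inj₂ lt = ⊥-elim (q (closed-≤ cl z∈ (≋-trans (≋-pred p) (≋-sym z≋))
      (lia 2 (λ b z → b :< z ⊕ #1 ⇒ [ b ⊖ #1 :≤ z ]) (b i) z lt)))

  up-range : ∀ c {b} → Decreasing b → Closed b → HasAddable c b → ∀ z → z ∈ up c b ⇔ s c z ∈ b
  up-range c {b} dec cl add = moves-range ≋̸-suc (move-moves _ _ b dec)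
    (λ z z∈ h → subst (_∈ b) (sym (s-down {c} h)) (addable-back c dec cl add z z∈ h))

  tr-swap : ∀ {x y} → ¬ x ≋ y → ∀ z → tr y x z ≡ tr x y z
  tr-swap {x} {y} ¬xy z with tr y x z | tr-view y x z
  ... | _ | fst h = sym (tr-snd ¬xy h)
  ... | _ | snd _ h = sym (tr-fst h)
  ... | _ | off p q = sym (tr-off q p)

  down-range : ∀ c {b} → Decreasing b → Closed b → HasRemovable c b → ∀ z → z ∈ down c b ⇔ s c z ∈ b
  down-range c {b} dec cl rem z = subst (λ w → z ∈ down c b ⇔ w ∈ b) (tr-swap ≋̸-suc z)
    (moves-range (λ h → ≋̸-suc (≋-sym h)) (move-moves _ _ b dec)
      (λ z z∈ h → subst (_∈ b) (sym (trans (tr-swap ≋̸-suc z) (s-up {c} h))) (removable-back c dec cl rem z z∈ h)) z)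

  range-closed : ∀ {f b b'} → Per f → (∀ z → z ∈ b' ⇔ f z ∈ b) → Closed b → Closed b'
  range-closed {f} {b} {b'} pf h cl i with Equivalence.to (h (b' i)) (i , refl)
  ... | j , e = Equivalence.from (h (b' i - N)) (subst (_∈ b) (trans (cong (λ w → w - N) e) (sym (per--N pf (b' i)))) (cl j))

  up-closed : ∀ c {b} → Decreasing b → Closed b → HasAddable c b → Closed (up c b)
  up-closed c dec cl add = range-closed (per-s c) (up-range c dec cl add) cl

  down-closed : ∀ c {b} → Decreasing b → Closed b → HasRemovable c b → Closed (down c b)
  down-closed c dec cl rem = range-closed (per-s c) (down-range c dec cl rem) cl

  -- Partitions and their beads

  β : Partition → Seq
  β l i = + row l (suc i) - + i

  row-step : ∀ {l} → IsPartition l → ∀ i → row l (suc (suc i)) ℕ.≤ row l (suc i)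
  row-step nil i = ℕ.z≤n
  row-step (one _) i = ℕ.z≤n
  row-step (cons b≤a p) zero = b≤a
  row-step (cons b≤a p) (suc i) = row-step p i

  row-mono : ∀ {l} → IsPartition l → ∀ {i j} → i ℕ.≤ j → row l (suc j) ℕ.≤ row l (suc i)
  row-mono {l} p {i} h with ℕP.m≤n⇒∃[o]m+o≡n h
  ... | k , refl = go k
    where
    go : ∀ k → row l (suc (i ℕ.+ k)) ℕ.≤ row l (suc i)
    go zero = ℕP.≤-reflexive (cong (λ m → row l (suc m)) (ℕP.+-identityʳ i))
    go (suc k) = ℕP.≤-trans (ℕP.≤-reflexive (cong (λ m → row l (suc m)) (ℕP.+-suc i k))) (ℕP.≤-trans (row-step p (i ℕ.+ k)) (go k))

  row-end : ∀ l i → length l ℕ.≤ i → row l (suc i) ≡ 0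
  row-end [] i h = refl
  row-end (a ∷ l) (suc i) (ℕ.s≤s h) = row-end l i h

  β-maya : ∀ {l} → IsPartition l → Maya (β l)
  β-maya {l} p = record
    { dec = λ i → lia 4 (λ a b i i' → a :≤ b ⇒ i' :≡ i ⊕ #1 ⇒ [ a ⊖ i' :< b ⊖ i ]) (+ row l (suc (suc i))) (+ row l (suc i)) (+ i) (+ suc i)
         (ℤ.+≤+ (row-step p i)) (+suc i)
    ; low = λ i → subst (_≤ β l i) (ℤP.+-identityˡ _) (ℤP.+-monoˡ-≤ (- + i) (ℤ.+≤+ {0} {row l (suc i)} ℕ.z≤n))
    ; stable = length l , λ i h → trans (cong (λ r → + r - + i) (row-end l i h)) (ℤP.+-identityˡ _) }

  β-dec : ∀ {l} → IsPartition l → Decreasing (β l)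
  β-dec p = Maya.dec (β-maya p)

  head-pos : ∀ {a l} → IsPartition (a ∷ l) → 1 ℕ.≤ a
  head-pos (one h) = h
  head-pos (cons b≤a p) = ℕP.≤-trans (head-pos p) b≤a

  tail-part : ∀ {a l} → IsPartition (a ∷ l) → IsPartition l
  tail-part (one _) = nil
  tail-part (cons _ p) = p

  rows-ext : ∀ {l m} → IsPartition l → IsPartition m → (∀ i → row l (suc i) ≡ row m (suc i)) → l ≡ m
  rows-ext {[]} {[]} p q h = refl
  rows-ext {[]} {b ∷ m} p q h = ⊥-elim (ℕP.<-irrefl (h 0) (head-pos q))
  rows-ext {a ∷ l} {[]} p q h = ⊥-elim (ℕP.<-irrefl (sym (h 0)) (head-pos p))
  rows-ext {a ∷ l} {b ∷ m} p q h = cong₂ _∷_ (h 0) (rows-ext (tail-part p) (tail-part q) (λ i → h (suc i)))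

  β-ext : ∀ {l m} → IsPartition l → IsPartition m → (∀ i → β l i ≡ β m i) → l ≡ m
  β-ext p q h = rows-ext p q (λ i → ℤP.+-injective (lia 3 (λ a b i → a ⊖ i :≡ b ⊖ i ⇒ [ a :≡ b ]) _ _ (+ i) (h i)))

  range-ext : ∀ {l m} → IsPartition l → IsPartition m → (∀ z → z ∈ β l ⇔ z ∈ β m) → l ≡ m
  range-ext p q h = β-ext p q (range-≡ (β-dec p) (β-dec q) h)

  ⊆ₚ⇒⊆ : ∀ {l m} → l ⊆ₚ m → β l ⊆ β m
  ⊆ₚ⇒⊆ h i = ℤP.+-monoˡ-≤ (- + i) (ℤ.+≤+ (h (suc i)))

  ⊆⇒⊆ₚ : ∀ {l m} → β l ⊆ β m → l ⊆ₚ m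
  ⊆⇒⊆ₚ h zero = ℕ.z≤n
  ⊆⇒⊆ₚ h (suc i) = ℤP.drop‿+≤+ (lia 3 (λ a b i → a ⊖ i :≤ b ⊖ i ⇒ [ a :≤ b ]) _ _ (+ i) (h i))

  cons-part : ∀ {a l} → 1 ℕ.≤ a → row l 1 ℕ.≤ a → IsPartition l → IsPartition (a ∷ l)
  cons-part h _ nil = one h
  cons-part _ h (one p) = cons h (one p)
  cons-part _ h (cons p q) = cons h (cons p q)

  1≤n-1 : 1 ℕ.≤ n ℕ.∸ 1
  1≤n-1 = ℕP.≤-pred (subst (2 ℕ.≤_) (sym (ℕP.suc-pred n)) 2≤n)

  Rop-part : ∀ {l} → IsPartition l → IsPartition (Rop n l)
  Rop-part {l} p = cons-part (ℕP.≤-trans 1≤n-1 (ℕP.m≤n+m _ (row l 1))) (ℕP.m≤m+n (row l 1) _) p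

  toRows : ℕ → (ℕ → ℕ) → Partition
  toRows zero f = []
  toRows (suc M) f with f 0
  ... | zero = []
  ... | suc k = suc k ∷ toRows M (λ i → f (suc i))

  module _ where
    private
      mono0 : ∀ {f : ℕ → ℕ} → (∀ i → f (suc i) ℕ.≤ f i) → ∀ i → f i ℕ.≤ f 0
      mono0 h zero = ℕP.≤-refl
      mono0 h (suc i) = ℕP.≤-trans (h i) (mono0 h i)

    toRows-row : ∀ M f → (∀ i → f (suc i) ℕ.≤ f i) → (∀ i → M ℕ.≤ i → f i ≡ 0) → ∀ i → row (toRows M f) (suc i) ≡ f i
    toRows-row zero f h e i = sym (e i ℕ.z≤n)
    toRows-row (suc M) f h e i with f 0 in eq
    toRows-row (suc M) f h e i | zero = sym (ℕP.n≤0⇒n≡0 (subst (f i ℕ.≤_) eq (mono0 h i)))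
    toRows-row (suc M) f h e zero | suc k = sym eq
    toRows-row (suc M) f h e (suc i) | suc k = toRows-row M (λ i → f (suc i)) (λ i → h (suc i)) (λ i p → e (suc i) (ℕ.s≤s p)) i

    toRows-part : ∀ M f → (∀ i → f (suc i) ℕ.≤ f i) → IsPartition (toRows M f)
    toRows-part zero f h = nil
    toRows-part (suc M) f h with f 0 in eq
    ... | zero = nil
    ... | suc k = cons-part (ℕ.s≤s ℕ.z≤n) (bound M) (toRows-part M (λ i → f (suc i)) (λ i → h (suc i)))
      where
      bound : ∀ M → row (toRows M (λ i → f (suc i))) 1 ℕ.≤ suc k
      bound zero = ℕ.z≤n
      bound (suc M) with f 1 in eq1
      ... | zero = ℕ.z≤n
      ... | suc j = subst₂ ℕ._≤_ eq1 eq (h 0)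

  toPart : ℕ → Seq → Partition
  toPart M b = toRows M (λ i → ℤ.∣ b i + + i ∣)

  module _ {b : Seq} (maya : Maya b) where
    open Maya maya

    rowOf : ∀ i → + ℤ.∣ b i + + i ∣ ≡ b i + + i
    rowOf i = ℤP.0≤i⇒+∣i∣≡i (lia 2 (λ b i → #0 ⊖ i :≤ b ⇒ [ #0 :≤ b ⊕ i ]) (b i) (+ i)
      (subst (_≤ b i) (sym (ℤP.+-identityˡ _)) (low i)))

    private
      f-dec : ∀ i → ℤ.∣ b (suc i) + + suc i ∣ ℕ.≤ ℤ.∣ b i + + i ∣
      f-dec i = ℤP.drop‿+≤+ (subst₂ _≤_ (sym (rowOf (suc i))) (sym (rowOf i))
        (lia 4 (λ b b' i i' → b' :< b ⇒ i' :≡ i ⊕ #1 ⇒ [ b' ⊕ i' :≤ b ⊕ i ]) (b i) (b (suc i)) (+ i) (+ suc i) (dec i) (+suc i)))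

    toPart-part : ∀ M → IsPartition (toPart M b)
    toPart-part M = toRows-part M _ f-dec

    toPart-β : ∀ M → (∀ i → M ℕ.≤ i → b i ≡ - + i) → ∀ i → β (toPart M b) i ≡ b i
    toPart-β M st i = trans (cong (λ r → + r - + i) (toRows-row M _ f-dec (λ i h → cong ℤ.∣_∣ (trans (cong (λ w → w + + i) (st i h)) (ℤP.+-inverseˡ (+ i)))) i))
      (trans (cong (λ w → w - + i) (rowOf i)) (lem (b i) (+ i)))
      where
      lem : ∀ b i → b + i - i ≡ b
      lem = solve-∀

  col-spec : ∀ {l} → IsPartition l → ∀ {j} i → suc i ℕ.≤ col l j ⇔ (suc i ℕ.≤ length l × j ℕ.≤ row l (suc i))
  col-spec {[]} p i = mk⇔ (λ ()) (λ { (() , _) })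
  col-spec {a ∷ l} p {j} i with ℕP.<-≤-connex a j
  ... | inj₂ j≤a = subst (λ k → suc i ℕ.≤ k ⇔ (suc i ℕ.≤ suc (length l) × j ℕ.≤ row (a ∷ l) (suc i)))
      (sym (cong length (LP.filter-accept (λ b → j ℕ.≤? b) j≤a))) (mk⇔ (to i) (from i))
    where
    to : ∀ i → suc i ℕ.≤ suc (col l j) → suc i ℕ.≤ suc (length l) × j ℕ.≤ row (a ∷ l) (suc i)
    to zero _ = ℕ.s≤s ℕ.z≤n , j≤a
    to (suc i) (ℕ.s≤s h) with Equivalence.to (col-spec (tail-part p) i) h
    ... | u , v = ℕ.s≤s u , v
    from : ∀ i → suc i ℕ.≤ suc (length l) × j ℕ.≤ row (a ∷ l) (suc i) → suc i ℕ.≤ suc (col l j)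
    from zero _ = ℕ.s≤s ℕ.z≤n
    from (suc i) (ℕ.s≤s u , v) = ℕ.s≤s (Equivalence.from (col-spec (tail-part p) i) (u , v))
  ... | inj₁ a<j = subst (λ k → suc i ℕ.≤ k ⇔ (suc i ℕ.≤ suc (length l) × j ℕ.≤ row (a ∷ l) (suc i)))
      (sym (cong length (LP.filter-reject (λ b → j ℕ.≤? b) (ℕP.<⇒≱ a<j)))) (mk⇔
    (λ h → ⊥-elim (ℕP.<⇒≱ a<j (ℕP.≤-trans (proj₂ (Equivalence.to (col-spec (tail-part p) i) h)) (row-mono p {0} {suc i} ℕ.z≤n))))
    (λ { (_ , v) → ⊥-elim (ℕP.<⇒≱ a<j (ℕP.≤-trans v (row-mono p {0} {i} ℕ.z≤n))) }))

  col-row : ∀ {l} → IsPartition l → ∀ {j} i → 1 ℕ.≤ j → suc i ℕ.≤ col l j ⇔ j ℕ.≤ row l (suc i)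
  col-row {l} p {j} i 1≤j = mk⇔ (λ h → proj₂ (Equivalence.to (col-spec p i) h)) (λ h → Equivalence.from (col-spec p i) (inside h , h))
    where
    inside : j ℕ.≤ row l (suc i) → suc i ℕ.≤ length l
    inside h with ℕP.<-≤-connex i (length l)
    ... | inj₁ q = q
    ... | inj₂ q = ⊥-elim (ℕP.<⇒≱ 1≤j (subst (j ℕ.≤_) (row-end l i q) h))

  +∸ : ∀ {m k} → k ℕ.≤ m → + (m ℕ.∸ k) ≡ + m - + k
  +∸ {m} {k} h = lia 3 (λ d k m → d ⊕ k :≡ m ⇒ [ d :≡ m ⊖ k ]) _ (+ k) (+ m) (cong +_ (ℕP.m∸n+n≡m h))

  -- The vacancies of the bead set, one for each column; a hook length is a bead minus a vacancy.
  gap : Partition → ℕ → ℤ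
  gap l j = + j - + col l j

  gap∉ : ∀ {l} → IsPartition l → ∀ {j} → 1 ℕ.≤ j → gap l j ∉ β l
  gap∉ {l} p {j} 1≤j (i , e) with ℕP.<-≤-connex i (col l j)
  ... | inj₁ q = lia 4 (λ r i j c → r ⊖ i :≡ j ⊖ c ⇒ j :≤ r ⇒ i :< c ⇒ [ ⊥ₐ ]) _ (+ i) (+ j) (+ col l j) e
         (ℤ.+≤+ (Equivalence.to (col-row p i 1≤j) q)) (ℤ.+<+ q)
  ... | inj₂ q with ℕP.<-≤-connex (row l (suc i)) j
  ...   | inj₁ r = lia 4 (λ r i j c → r ⊖ i :≡ j ⊖ c ⇒ r :< j ⇒ c :≤ i ⇒ [ ⊥ₐ ]) _ (+ i) (+ j) (+ col l j) e (ℤ.+<+ r) (ℤ.+≤+ q)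
  ...   | inj₂ r = ⊥-elim (ℕP.<⇒≱ (Equivalence.from (col-row p i 1≤j) r) q)

  hook-gap : ∀ {l} → IsPartition l → ∀ i j → 1 ℕ.≤ j → j ℕ.≤ row l (suc i) → + hook l (suc i) j ≡ β l i - gap l j
  hook-gap {l} p i j 1≤j h = trans (cong₂ (λ u v → u + v + + 1) (+∸ h) (+∸ (Equivalence.from (col-row p i 1≤j) h)))
    (trans (cong (λ u → + row l (suc i) - + j + (+ col l j - u) + + 1) (+suc i)) (lem (+ row l (suc i)) (+ j) (+ col l j) (+ i)))
    where
    lem : ∀ r j c i → r - j + (c - (i + + 1)) + + 1 ≡ r - i - (j - c)
    lem = solve-∀

  -- A hook of length n would place a vacancy exactly n below a bead.
  closed⇒core : ∀ {l} → IsPartition l → Closed (β l) → IsCore n l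
  closed⇒core {l} p cl = p , nohook
    where
    nohook : ∀ i j → InDiagram l i j → hook l i j ≢ n
    nohook (suc i) j (_ , 1≤j , j≤row) e = gap∉ p 1≤j (subst (_∈ β l)
      (lia 3 (λ b g n → n :≡ b ⊖ g ⇒ [ b ⊖ n :≡ g ]) (β l i) (gap l j) N (trans (cong +_ (sym e)) (hook-gap p i j 1≤j j≤row))) (cl i))

  res-≋ : ∀ l i → ⌜ res n (suc i) (suc (row l (suc i))) ⌝ ≋ β l i
  res-≋ l i = ≋-trans (subst (λ w → + w ≋ + m) (sym (FP.toℕ-fromℕ< (m%n<n m n))) mod≋) m≋
    where
    r = row l (suc i)
    m = (suc r ℕ.+ n ℕ.* suc i) ℕ.∸ suc i
    mod≋ : + (m % n) ≋ + m
    mod≋ = ≋-sym (mk (+ (m / n)) (trans (cong +_ (m≡m%n+[m/n]*n m n)) (cong (λ w → + (m % n) + w) (ℤP.pos-* (m / n) n))))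
    i≤ : suc i ℕ.≤ suc r ℕ.+ n ℕ.* suc i
    i≤ = ℕP.≤-trans (ℕP.m≤n*m (suc i) n) (ℕP.m≤n+m (n ℕ.* suc i) (suc r))
    m≋ : + m ≋ β l i
    m≋ = mk (+ suc i) (trans (+∸ i≤) (trans (cong₂ (λ u v → u - v) (cong₂ _+_ (+suc r) (trans (cong +_ (ℕP.*-comm n (suc i))) (ℤP.pos-* (suc i) n))) (+suc i)) (lem (+ r) (+ suc i * N) (+ i))))
      where
      lem : ∀ r w i → r + + 1 + w - (i + + 1) ≡ r - i + w
      lem = solve-∀

  addable⇔ : ∀ {l} → IsPartition l → ∀ i → Addable l (suc i) ⇔ (β l i + + 1 ∉ β l)
  addable⇔ {l} p zero = mk⇔
    (λ _ → λ { (j , e) → ℤP.<⇒≱ (lia 2 (λ x y → y :≡ x ⊕ #1 ⇒ [ x :< y ]) (β l 0) (β l j) e) (dec-mono≤ (β-dec p) {0} {j} ℕ.z≤n) })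
    (λ _ → ℕ.s≤s ℕ.z≤n , inj₁ refl)
  addable⇔ {l} p (suc i) = mk⇔ to from
    where
    to : Addable l (suc (suc i)) → β l (suc i) + + 1 ∉ β l
    to (_ , inj₂ h) (j , e) = ℤP.<⇒≱ lt (dec-mono≤ (β-dec p) (ℕ.s≤s⁻¹ j<))
      where
      j< : j ℕ.< suc i
      j< = dec-cancel< (β-dec p) (lia 2 (λ x y → y :≡ x ⊕ #1 ⇒ [ x :< y ]) (β l (suc i)) (β l j) e)
      lt : β l j < β l i
      lt = lia 6 (λ bj r r' r'' i i' → bj :≡ r' ⊖ i' ⊕ #1 ⇒ i' :≡ i ⊕ #1 ⇒ r'' :≡ r' ⊕ #1 ⇒ r'' :≤ r ⇒ [ bj :< r ⊖ i ])
        (β l j) (+ row l (suc i)) (+ row l (suc (suc i))) (+ suc (row l (suc (suc i)))) (+ i) (+ suc i) e (+suc i) (+suc (row l (suc (suc i)))) (ℤ.+≤+ h)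
    from : β l (suc i) + + 1 ∉ β l → Addable l (suc (suc i))
    from h with ℕP.m≤n⇒m<n∨m≡n (row-step p i)
    ... | inj₁ q = ℕ.s≤s ℕ.z≤n , inj₂ q
    ... | inj₂ q = ⊥-elim (h (i , lia 4 (λ r r' i i' → r' :≡ r ⇒ i' :≡ i ⊕ #1 ⇒ [ r ⊖ i :≡ r' ⊖ i' ⊕ #1 ])
        (+ row l (suc i)) (+ row l (suc (suc i))) (+ i) (+ suc i) (cong +_ q) (+suc i)))

  addableRes⇔ : ∀ {l} → IsPartition l → ∀ c i → AddableRes n c l (suc i) ⇔ (β l i ≋ ⌜ c ⌝ × β l i + + 1 ∉ β l)
  addableRes⇔ {l} p c i = mk⇔
    (λ { (a , r) → ≋-trans (≋-sym (res-≋ l i)) (≡⇒≋ (cong ⌜_⌝ r)) , Equivalence.to (addable⇔ p i) a })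
    (λ { (r , a) → Equivalence.from (addable⇔ p i) a , ⌜⌝-inj (≋-trans (res-≋ l i) r) })

  abstract

    sAdd : Fin n → Partition → Partition
    -- Adding corners opens at most one new row.
    sAdd c l = toPart (suc (length l)) (up c (β l))

    sAdd-part : ∀ c {l} → IsPartition l → IsPartition (sAdd c l)
    sAdd-part c {l} p = toPart-part (up-maya c (β-maya p)) (suc (length l))

    sAdd-β : ∀ c {l} → IsPartition l → ∀ i → β (sAdd c l) i ≡ up c (β l) i
    sAdd-β c {l} p = toPart-β (up-maya c (β-maya p)) (suc (length l)) (proj₂ (Maya.stable (up-maya c (β-maya p))))

  row-β : ∀ l i → + row l (suc i) ≡ β l i + + i
  row-β l i = lem (+ row l (suc i)) (+ i)
    where
    lem : ∀ r i → r ≡ r - i + i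
    lem = solve-∀

  sAdd-SAct : ∀ c {l} → IsPartition l → HasAddable c (β l) → SAct n c l (sAdd c l)
  sAdd-SAct c {l} p (k , r , a) = sAdd-part c p , (suc k , Equivalence.from (addableRes⇔ p c k) (r , a)) , rows
    where
    rows : ∀ i → 1 ℕ.≤ i → (AddableRes n c l i → row (sAdd c l) i ≡ suc (row l i)) × (¬ AddableRes n c l i → row (sAdd c l) i ≡ row l i)
    rows (suc i) _ = add , keep
      where
      e : + row (sAdd c l) (suc i) ≡ up c (β l) i + + i
      e = trans (row-β (sAdd c l) i) (cong (λ w → w + + i) (sAdd-β c p i))
      add : AddableRes n c l (suc i) → row (sAdd c l) (suc i) ≡ suc (row l (suc i))
      add h = ℤP.+-injective (trans (added (up-view c (β-dec p) i) e) (sym (+suc _)))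
        where
        lem : ∀ r i → r - i + + 1 + i ≡ r + + 1
        lem = solve-∀
        added : ∀ {w} → UpView c (β l) i w → + row (sAdd c l) (suc i) ≡ w + + i → + row (sAdd c l) (suc i) ≡ + row l (suc i) + + 1
        added (moved _ _) e' = trans e' (lem (+ row l (suc i)) (+ i))
        added (fixed f) e' = ⊥-elim (proj₂ uv (f (proj₁ uv)))
          where uv = Equivalence.to (addableRes⇔ p c i) h
      keep : ¬ AddableRes n c l (suc i) → row (sAdd c l) (suc i) ≡ row l (suc i)
      keep h = ℤP.+-injective (kept (up-view c (β-dec p) i) e)
        where
        kept : ∀ {w} → UpView c (β l) i w → + row (sAdd c l) (suc i) ≡ w + + i → + row (sAdd c l) (suc i) ≡ + row l (suc i)
        kept (moved u v) e' = ⊥-elim (h (Equivalence.from (addableRes⇔ p c i) (u , v)))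
        kept (fixed f) e' = trans e' (sym (row-β l i))

  SAct-addable : ∀ {c l m} → IsPartition l → SAct n c l m → HasAddable c (β l)
  SAct-addable {c} p (_ , (suc k , a) , _) = k , Equivalence.to (addableRes⇔ p c k) a
  SAct-addable {c} p (_ , (zero , ((() , _) , _)) , _)

  SAct-sAdd : ∀ {c l m} → IsPartition l → SAct n c l m → m ≡ sAdd c l
  SAct-sAdd {c} {l} {m} p sa@(q , _ , rows) = rows-ext q (sAdd-part c p) same
    where
    rows' = proj₂ (proj₂ (sAdd-SAct c p (SAct-addable p sa)))
    same : ∀ i → row m (suc i) ≡ row (sAdd c l) (suc i)
    same i = case (β l i ≋? ⌜ c ⌝ ×-dec ¬? (_∈?_ (β-dec p) (β l i + + 1)))
      where
      case : Dec (β l i ≋ ⌜ c ⌝ × β l i + + 1 ∉ β l) → row m (suc i) ≡ row (sAdd c l) (suc i)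
      case (yes h) = trans (proj₁ (rows (suc i) (ℕ.s≤s ℕ.z≤n)) (Equivalence.from (addableRes⇔ p c i) h))
                     (sym (proj₁ (rows' (suc i) (ℕ.s≤s ℕ.z≤n)) (Equivalence.from (addableRes⇔ p c i) h)))
      case (no ¬h) = trans (proj₂ (rows (suc i) (ℕ.s≤s ℕ.z≤n)) (λ a → ¬h (Equivalence.to (addableRes⇔ p c i) a)))
                     (sym (proj₂ (rows' (suc i) (ℕ.s≤s ℕ.z≤n)) (λ a → ¬h (Equivalence.to (addableRes⇔ p c i) a))))

  -- Heights of the runners of a closed set

  infix 4 _⊨_

  -- P is closed under subtraction of n, and pos k + (lookup q k) n is its maximal element in the class of pos k.
  record _⊨_ (P : ℤ → Set) (q : Vec ℤ n) : Set where
    constructor mk⊨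
    field level : ∀ k t → P (pos k + t * N) ⇔ t ≤ lookup q k
  open _⊨_ public

  ⊨-unique : ∀ {P q q'} → P ⊨ q → P ⊨ q' → q ≡ q'
  ⊨-unique {P} {q} {q'} r r' = lookup-ext (λ k → ℤP.≤-antisym (le r r' k) (le r' r k))
    where
    le : ∀ {q q'} → P ⊨ q → P ⊨ q' → ∀ k → lookup q k ≤ lookup q' k
    le {q} r r' k = Equivalence.to (level r' k (lookup q k)) (Equivalence.from (level r k (lookup q k)) ℤP.≤-refl)

  ⊨-cong : ∀ {P P' q} → (∀ z → P z ⇔ P' z) → P ⊨ q → P' ⊨ q
  ⊨-cong h r = mk⊨ λ k t → mk⇔ (λ m → Equivalence.to (level r k t) (Equivalence.from (h _) m)) (λ m → Equivalence.to (h _) (Equivalence.from (level r k t) m))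

  s-pos : ∀ {c k j' e} → s c (pos k) ≡ pos j' + e * N → ∀ t → s c (pos k + t * N) ≡ pos j' + (t + e) * N
  s-pos {c} {k} {j'} {e} p t = trans (per-s c _ (pos k) (mk t refl)) (trans (cong (λ w → w + (pos k + t * N - pos k)) p) (lem (pos j') (pos k) e t N))
    where
    lem : ∀ x y e t n → x + e * n + (y + t * n - y) ≡ x + (t + e) * n
    lem = solve-∀

  -- At `pos k + t * N` the pulled back set reads `P` at `pos j' + (t + e) * N`, so the height found
  -- at `j'` is lowered by e. This is the origin of the shift -1 in `qact`.
  ⊨-s : ∀ {P q} c → P ⊨ q → (λ z → P (s c z)) ⊨ qact c q
  ⊨-s {P} {q} c r = mk⊨ λ k t → go k t (target-of c k)
    where
    go : ∀ k t → Target c k → P (s c (pos k + t * N)) ⇔ t ≤ lookup (qact c q) k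
    go k t (target j' e p look) = mk⇔ to from
     where
      e1 = look -[1+ 0 ] q
      to : P (s c (pos k + t * N)) → t ≤ lookup (qact c q) k
      to m = lia 4 (λ t e q' q → t ⊕ e :≤ q ⇒ q' :≡ q ⊖ e ⇒ [ t :≤ q' ]) t e _ (lookup q j')
        (Equivalence.to (level r j' (t + e)) (subst P (s-pos {c} {k} {j'} {e} p t) m))
        (trans e1 (cong (λ w → lookup q j' + w) (trans (ℤP.*-comm e -[1+ 0 ]) (ℤP.-1*i≡-i e))))
      from : t ≤ lookup (qact c q) k → P (s c (pos k + t * N))
      from le = subst P (sym (s-pos {c} {k} {j'} {e} p t)) (Equivalence.from (level r j' (t + e))
        (lia 4 (λ t e q' q → t :≤ q' ⇒ q' :≡ q ⊖ e ⇒ [ t ⊕ e :≤ q ]) t e _ (lookup q j') le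
          (trans e1 (cong (λ w → lookup q j' + w) (trans (ℤP.*-comm e -[1+ 0 ]) (ℤP.-1*i≡-i e))))))

  pos-of : ∀ c → Σ (Fin n) (λ k → (suc (toℕ k) ≡ toℕ c × pos k ≡ ⌜ c ⌝) ⊎ (toℕ c ≡ 0 × suc (toℕ k) ≡ n))
  pos-of c = go (toℕ c) refl
    where
    go : ∀ m → toℕ c ≡ m → Σ (Fin n) (λ k → (suc (toℕ k) ≡ toℕ c × pos k ≡ ⌜ c ⌝) ⊎ (toℕ c ≡ 0 × suc (toℕ k) ≡ n))
    go zero e = fromℕ< lt , inj₂ (e , trans (cong suc (FP.toℕ-fromℕ< lt)) (ℕP.suc-pred n))
      where lt : ℕ.pred n ℕ.< n
            lt = ℕP.≤-reflexive (ℕP.suc-pred n)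
    go (suc m) e = fromℕ< lt , inj₁ (e' , cong +_ e')
      where lt : m ℕ.< n
            lt = ℕP.<-trans (ℕP.≤-reflexive (sym e)) (FP.toℕ<n c)
            e' : suc (toℕ (fromℕ< lt)) ≡ toℕ c
            e' = trans (cong suc (FP.toℕ-fromℕ< lt)) (sym e)

  rising : ∀ {b q c} → (_∈ b) ⊨ q → HasAddable c b → Rising q c
  rising {b} {q} {c} r (i , mk t e , ∉b) with pos-of c
  ... | k , inj₁ (suck≡c , posk≡c) = inner k suck≡c (lia 3 (λ qc t qk → qc :< t ⇒ t :≤ qk ⇒ [ qc :< qk ]) _ t (lookup q k) (ℤP.≰⇒> qc<t) t≤qk)
    where
    t≤qk : t ≤ lookup q k
    t≤qk = Equivalence.to (level r k t) (i , trans e (cong (λ w → w + t * N) (sym posk≡c)))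
    qc<t : ¬ t ≤ lookup q c
    qc<t le = ∉b (subst (_∈ b) (sym (trans (cong (λ w → w + + 1) e) (lem ⌜ c ⌝ (t * N)))) (Equivalence.from (level r c t) le))
      where
      lem : ∀ c w → c + w + + 1 ≡ + 1 + c + w
      lem = solve-∀
  ... | k , inj₂ (c≡0 , suck≡n) = outer k c≡0 suck≡n (lia 3 (λ qc t qk → qc :< t ⇒ t ⊖ #1 :≤ qk ⇒ [ qc :≤ qk ]) _ t (lookup q k) (ℤP.≰⇒> qc<t) t≤qk)
    where
    t≤qk : t - + 1 ≤ lookup q k
    t≤qk = Equivalence.to (level r k (t - + 1)) (i , trans e (trans (cong (λ w → + w + t * N) c≡0) (trans (lem N t) (cong (λ w → + w + (t - + 1) * N) (sym suck≡n)))))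
      where
      lem : ∀ n t → + 0 + t * n ≡ n + (t - + 1) * n
      lem = solve-∀
    qc<t : ¬ t ≤ lookup q c
    qc<t le = ∉b (subst (_∈ b) (sym (trans (cong (λ w → w + + 1) e) (lem ⌜ c ⌝ (t * N)))) (Equivalence.from (level r c t) le))
      where
      lem : ∀ c w → c + w + + 1 ≡ + 1 + c + w
      lem = solve-∀

  D-addable : ∀ {b q c} → (_∈ b) ⊨ q → HasAddable c b → D (qact c q) ≡ suc (D q)
  D-addable {b} {q} {c} r a = D-rising 2≤n q c (rising {b} r a)

  addable : ∀ {b q c} → (_∈ b) ⊨ q → Rising q c → HasAddable c b
  addable {b} {q} {c} r (inner i e lt) with Equivalence.from (level r i (lookup q i)) ℤP.≤-refl
  ... | j , ej = j , mk (lookup q i) (trans ej (cong (λ w → + w + lookup q i * N) e)) , λ h → ℤP.<⇒≱ lt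
     (Equivalence.to (level r c (lookup q i)) (subst (_∈ b) (trans (cong (λ w → w + + 1) (trans ej (cong (λ w → + w + lookup q i * N) e))) (lem ⌜ c ⌝ (lookup q i * N))) h))
    where
    lem : ∀ c w → c + w + + 1 ≡ + 1 + c + w
    lem = solve-∀
  addable {b} {q} {c} r (outer i c≡0 e le) with Equivalence.from (level r i (lookup q i)) ℤP.≤-refl
  ... | j , ej = j , mk (lookup q i + + 1) (trans ej eq) , λ h → ℤP.<⇒≱ (lia 2 (λ a b → a :≤ b ⇒ [ a :< b ⊕ #1 ]) _ _ le)
     (Equivalence.to (level r c (lookup q i + + 1)) (subst (_∈ b) (trans (cong (λ w → w + + 1) (trans ej eq)) (lem ⌜ c ⌝ ((lookup q i + + 1) * N))) h))
    where
    lem : ∀ c w → c + w + + 1 ≡ + 1 + c + w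
    lem = solve-∀
    lem2 : ∀ n q → n + q * n ≡ + 0 + (q + + 1) * n
    lem2 = solve-∀
    eq : pos i + lookup q i * N ≡ ⌜ c ⌝ + (lookup q i + + 1) * N
    eq = trans (cong (λ w → + w + lookup q i * N) e) (trans (lem2 N (lookup q i)) (cong (λ w → + w + (lookup q i + + 1) * N) (sym c≡0)))

  addable-D : ∀ {b q c} → (_∈ b) ⊨ q → D (qact c q) ≡ suc (D q) → HasAddable c b
  addable-D {b} {q} {c} r e = addable {b} r (D-rising⁻¹ 2≤n q c e)

  qact-invol : ∀ c q → qact c (qact c q) ≡ q
  qact-invol c q = lookup-ext go
    where
    go : ∀ k → lookup (qact c (qact c q)) k ≡ lookup q k
    go k with target-of c k
    ... | target j e p look with target-of c j
    ...   | target k' e' p' look' = trans (look -[1+ 0 ] (qact c q)) (trans (cong (λ w → w + e * -[1+ 0 ]) (look' -[1+ 0 ] q))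
            (trans (cong (λ k → lookup q k + e' * -[1+ 0 ] + e * -[1+ 0 ]) k'≡k) (trans (lem (lookup q k) e' e) (trans (cong (λ w → lookup q k + w * -[1+ 0 ]) e+e'≡0) (ℤP.+-identityʳ _)))))
      where
      lem : ∀ x e' e → x + e' * -[1+ 0 ] + e * -[1+ 0 ] ≡ x + (e' + e) * -[1+ 0 ]
      lem = solve-∀
      ret : pos k ≡ pos k' + (e + e') * N
      ret = trans (sym (s-invol c (pos k))) (trans (cong (s c) p) (s-pos {c} {j} {k'} {e'} p' e))
      k'≡k : k' ≡ k
      k'≡k = ⌜⌝-inj {k'} {k} (≋-sym (≋-shift {pos k} {pos k'} (mk (e + e') ret) (lem2 ⌜ k ⌝ ⌜ k' ⌝)))
        where
        lem2 : ∀ a b → a - b ≡ + 1 + a - (+ 1 + b)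
        lem2 = solve-∀
      e+e'≡0 : e' + e ≡ + 0
      e+e'≡0 = ℤP.*-cancelʳ-≡ (e' + e) (+ 0) N (lia 3 (λ x y z → x :≡ x ⊕ y ⇒ [ y :≡ #0 ]) (pos k) ((e' + e) * N) (+ 0)
          (trans ret (trans (cong (λ k → pos k + (e + e') * N) k'≡k) (cong (λ w → pos k + w * N) (ℤP.+-comm e e')))))

  -- The beads of the empty core are the integers at most 0 and the positions are 1, ..., n, so
  -- every top bead lies one period below its position.
  ground : Vec ℤ n
  ground = V.replicate n (- + 1)

  D-ground : D ground ≡ 0
  D-ground = D-const n (- + 1)

  *N-mono : ∀ {t u} → t ≤ u → t * N ≤ u * N
  *N-mono h = ℤP.*-monoʳ-≤-nonNeg N h

  β[]-range : ∀ z → z ∈ β [] ⇔ z ≤ + 0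
  β[]-range z = mk⇔ (λ { (i , e) → subst (_≤ + 0) e (lia 1 (λ i → #0 :≤ i ⇒ [ #0 ⊖ i :≤ #0 ]) (+ i) (ℤ.+≤+ ℕ.z≤n)) })
    (λ le → ℤ.∣ z ∣ , trans (ℤP.+-identityˡ _) (neg z le))
    where
    neg : ∀ z → z ≤ + 0 → - + ℤ.∣ z ∣ ≡ z
    neg (+ zero) _ = refl
    neg (+ suc k) (ℤ.+≤+ ())
    neg -[1+ k ] _ = refl

  ground-⊨ : (_∈ β []) ⊨ ground
  ground-⊨ = mk⊨ λ k t → mk⇔ (to k t) (from k t)
    where
    module _ (k : Fin n) (t : ℤ) where
      p≤ : pos k ≤ N
      p≤ = ℤ.+≤+ (FP.toℕ<n k)
      to : pos k + t * N ∈ β [] → t ≤ lookup ground k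
      to m = subst (t ≤_) (sym (VP.lookup-replicate k (- + 1))) (ℤP.≮⇒≥ (λ lt →
        lia 2 (λ p w → #1 ⊕ p ⊕ w :≤ #0 ⇒ #0 :≤ w ⇒ #0 :≤ p ⇒ [ ⊥ₐ ]) ⌜ k ⌝ (t * N)
          (Equivalence.to (β[]-range _) m) (*N-mono {+ 0} {t} (lia 1 (λ t → # (- + 1) :< t ⇒ [ #0 :≤ t ]) t lt)) (0≤⌜⌝ k)))
      from : t ≤ lookup ground k → pos k + t * N ∈ β []
      from le = Equivalence.from (β[]-range _) (lia 3 (λ p w n → p :≤ n ⇒ w :≤ #0 ⊖ n ⇒ [ p ⊕ w :≤ #0 ]) (pos k) (t * N) N p≤
        (ℤP.≤-trans (*N-mono {t} { - + 1} (subst (t ≤_) (VP.lookup-replicate k (- + 1)) le)) (ℤP.≤-reflexive (trans (ℤP.-1*i≡-i N) (sym (ℤP.+-identityˡ _))))))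

  below-stable : ∀ {b} (m : Maya b) → ∀ z → z ≤ - + proj₁ (Maya.stable m) → z ∈ b
  below-stable {b} m z le = j , trans (proj₂ (Maya.stable m) j (ℤP.drop‿+≤+ M≤j)) (trans (cong -_ j≡) (ℤP.neg-involutive z))
    where
    M = proj₁ (Maya.stable m)
    j = ℤ.∣ - z ∣
    M≤-z : + M ≤ - z
    M≤-z = subst (_≤ - z) (ℤP.neg-involutive (+ M)) (ℤP.neg-mono-≤ le)
    j≡ : + j ≡ - z
    j≡ = ℤP.0≤i⇒+∣i∣≡i (ℤP.≤-trans (ℤ.+≤+ {0} {M} ℕ.z≤n) M≤-z)
    M≤j : + M ≤ + j
    M≤j = subst (+ M ≤_) (sym j≡) M≤-z

  last-true : ∀ {P : ℤ → Set} → (∀ t → Dec (P t)) → ∀ t₀ → P t₀ → ∀ fuel → ¬ P (t₀ + + fuel) → ∃[ t ] (P t × ¬ P (t + + 1))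
  last-true {P} P? t₀ p zero ¬p = ⊥-elim (¬p (subst P (sym (ℤP.+-identityʳ t₀)) p))
  last-true {P} P? t₀ p (suc f) ¬p = case (P? (t₀ + + 1))
    where
    case : Dec (P (t₀ + + 1)) → ∃[ t ] (P t × ¬ P (t + + 1))
    case (no ¬q) = t₀ , p , ¬q
    case (yes q) = last-true P? (t₀ + + 1) q f (λ r → ¬p (subst P (ℤP.+-assoc t₀ (+ 1) (+ f)) r))

  exists-⊨ : ∀ {b} → Maya b → Closed b → ∃[ q ] ((_∈ b) ⊨ q)
  exists-⊨ {b} m cl = tabulate (λ k → proj₁ (top k)) , mk⊨ λ k t → subst (λ w → (pos k + t * N ∈ b) ⇔ t ≤ w) (sym (VP.lookup∘tabulate _ k)) (proj₂ (top k) t)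
    where
    open Maya m
    M = proj₁ stable
    P : Fin n → ℤ → Set
    P k t = pos k + t * N ∈ b
    B = ℤ.∣ b 0 ∣
    top : ∀ k → ∃[ u ] (∀ t → P k t ⇔ t ≤ u)
    top k = u , λ t → mk⇔ (to t) (from t)
      where
      -- Since `pos k ≤ N`, the search starts at most at -M, where everything is a bead. Its fuel
      -- leads to t = B, where `pos k + B * N` exceeds `b 0`.
      t₀ = - + suc M
      low∈ : P k t₀
      low∈ = below-stable m _ (lia 4 (λ p n w m → p :≤ n ⇒ w :≤ m ⊖ n ⇒ [ p ⊕ w :≤ m ]) (pos k) N (t₀ * N) (- + M)
          (ℤ.+≤+ (FP.toℕ<n k)) (ℤP.≤-trans (ℤP.≤-reflexive (trans (cong (λ w → - w * N) (+suc M)) (lem (+ M) N)))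
            (ℤP.+-monoˡ-≤ (- N) (ℤP.neg-mono-≤ (subst (+ M ≤_) (ℤP.pos-* M n) (ℤ.+≤+ (ℕP.m≤m*n M n)))))))
        where
        lem : ∀ m n → - (m + + 1) * n ≡ - (m * n) - n
        lem = solve-∀
      t₁ : t₀ + + (suc M ℕ.+ B) ≡ + B
      t₁ = trans (cong (λ w → t₀ + w) (ℤP.pos-+ (suc M) B)) (lem (+ suc M) (+ B))
        where
        lem : ∀ m b → - m + (m + b) ≡ b
        lem = solve-∀
      abs : ∀ w → w ≤ + ℤ.∣ w ∣
      abs (+ k) = ℤP.≤-refl
      abs -[1+ k ] = ℤ.-≤+
      high∉ : ¬ P k (t₀ + + (suc M ℕ.+ B))
      high∉ (i , e) = lia 5 (λ bi b0 p w B → bi :≡ #1 ⊕ p ⊕ w ⇒ bi :≤ b0 ⇒ b0 :≤ B ⇒ B :≤ w ⇒ #0 :≤ p ⇒ [ ⊥ₐ ])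
         (b i) (b 0) ⌜ k ⌝ (+ B * N) (+ B) (trans e (cong (λ w → pos k + w * N) t₁)) (dec-mono≤ dec {0} {i} ℕ.z≤n) (abs (b 0)) 
         (subst (+ B ≤_) (ℤP.pos-* B n) (ℤ.+≤+ (ℕP.m≤m*n B n))) (0≤⌜⌝ k)
      found = last-true {P k} (λ t → _∈?_ dec _) t₀ low∈ (suc M ℕ.+ B) high∉
      u = proj₁ found
      shift : ∀ {t t'} → t ≤ t' → P k t' → P k t
      shift {t} {t'} le h = closed-≤ cl h (≋-trans {y = pos k} (mk t refl) (≋-sym {y = pos k} (mk t' refl))) (ℤP.+-monoʳ-≤ (pos k) (*N-mono le))
      to : ∀ t → P k t → t ≤ u
      to t h = ℤP.≮⇒≥ (λ lt → proj₂ (proj₂ found) (shift (lia 2 (λ u t → u :< t ⇒ [ u ⊕ #1 :≤ t ]) u t lt) h))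
      from : ∀ t → t ≤ u → P k t
      from t le = shift le (proj₁ (proj₂ found))

  -- Words acting on cores

  record Core (l : Partition) (q : Vec ℤ n) : Set where
    field
      part : IsPartition l
      closed : Closed (β l)
      heights : (_∈ β l) ⊨ q

  core-unique : ∀ {l q q'} → Core l q → Core l q' → q ≡ q'
  core-unique r r' = ⊨-unique (Core.heights r) (Core.heights r')

  core-[] : Core [] ground
  core-[] = record { part = nil ; closed = cl ; heights = ground-⊨ }
    where
    cl : Closed (β [])
    cl i = Equivalence.from (β[]-range _) (lia 2 (λ i n → #0 :≤ i ⇒ #2 :≤ n ⇒ [ #0 ⊖ i ⊖ n :≤ #0 ]) (+ i) N (ℤ.+≤+ ℕ.z≤n) 2≤N)

  ⇔-sym : ∀ {A B : Set} → A ⇔ B → B ⇔ A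
  ⇔-sym e = mk⇔ (Equivalence.from e) (Equivalence.to e)

  ⇔-trans : ∀ {A B C : Set} → A ⇔ B → B ⇔ C → A ⇔ C
  ⇔-trans e f = mk⇔ (λ a → Equivalence.to f (Equivalence.to e a)) (λ c → Equivalence.from e (Equivalence.from f c))

  ∈-cong : ∀ {b b' : Seq} → (∀ i → b i ≡ b' i) → ∀ z → z ∈ b ⇔ z ∈ b'
  ∈-cong h z = mk⇔ (λ { (i , e) → i , trans (sym (h i)) e }) (λ { (i , e) → i , trans (h i) e })

  sAdd-range : ∀ c {l q} → Core l q → HasAddable c (β l) → ∀ z → z ∈ β (sAdd c l) ⇔ s c z ∈ β l
  sAdd-range c r a z = ⇔-trans (∈-cong (sAdd-β c part) z) (up-range c (β-dec part) closed a z)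
    where open Core r

  core-sAdd : ∀ c {l q} → Core l q → HasAddable c (β l) → Core (sAdd c l) (qact c q)
  core-sAdd c {l} {q} r a = record
    { part = sAdd-part c part
    ; closed = range-closed (per-s c) (sAdd-range c r a) closed
    ; heights = ⊨-cong (λ z → ⇔-sym (sAdd-range c r a z)) (⊨-s {_∈ β l} c heights) }
    where open Core r

  qacts : Word n → Vec ℤ n → Vec ℤ n
  qacts [] q = q
  qacts (c ∷ a) q = qact c (qacts a q)

  qacts-++ : ∀ a b q → qacts (a ++ b) q ≡ qacts a (qacts b q)
  qacts-++ [] b q = refl
  qacts-++ (c ∷ a) b q = cong (qact c) (qacts-++ a b q)

  qacts-⊨ : ∀ {P q} a → P ⊨ q → (λ z → P (run⁻¹ a z)) ⊨ qacts a q
  qacts-⊨ [] r = r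
  qacts-⊨ {P} (c ∷ a) r = ⊨-s {λ z → P (run⁻¹ a z)} c (qacts-⊨ {P} a r)

  -- The heights are determined by the pulled back set, and that set only by the map of the word.
  -- Hence `D` after a word depends on the affine permutation alone, without any appeal to Coxeter
  -- relations.
  qacts-run : ∀ {P q a b} → P ⊨ q → (∀ z → run a z ≡ run b z) → qacts a q ≡ qacts b q
  qacts-run {P} {q} {a} {b} r h = ⊨-unique (qacts-⊨ {P} a r)
    (⊨-cong (λ z → mk⇔ (subst P (sym (run⁻¹-cong {a} {b} h z))) (subst P (run⁻¹-cong {a} {b} h z))) (qacts-⊨ {P} b r))

  D-qacts : ∀ a q → D (qacts a q) ℕ.≤ length a ℕ.+ D q
  D-qacts [] q = ℕP.≤-refl
  D-qacts (c ∷ a) q = ℕP.≤-trans (D-step 2≤n (qacts a q) c) (ℕ.s≤s (D-qacts a q))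

  actP : Word n → Partition → Partition
  actP a l = L.foldr sAdd l a

  -- For a core, `degree` is the numerical certificate for `act`: either of them yields all the
  -- rest, by `degree⇒acted` and `wordAct⇒acted`.
  record Acted (a : Word n) (l : Partition) (q : Vec ℤ n) : Set where
    field
      core : Core (actP a l) (qacts a q)
      act : WordAct n a l (actP a l)
      degree : D (qacts a q) ≡ length a ℕ.+ D q
      range : ∀ z → z ∈ β (actP a l) ⇔ run⁻¹ a z ∈ β l

  acted-[] : ∀ {l q} → Core l q → Acted [] l q
  acted-[] r = record { core = r ; act = refl ; degree = refl ; range = λ z → mk⇔ (λ m → m) (λ m → m) }

  acted-∷ : ∀ {c a l q} → Acted a l q → HasAddable c (β (actP a l)) → Acted (c ∷ a) l q
  acted-∷ {c} {a} {l} {q} r ad = record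
    { core = core-sAdd c core ad
    ; act = actP a l , act , sAdd-SAct c (Core.part core) ad
    ; degree = trans (D-addable {β (actP a l)} (Core.heights core) ad) (cong suc degree)
    ; range = λ z → ⇔-trans (sAdd-range c core ad z) (range (s c z)) }
    where open Acted r

  wordAct⇒acted : ∀ a {l m q} → Core l q → WordAct n a l m → m ≡ actP a l × Acted a l q
  wordAct⇒acted [] r refl = refl , acted-[] r
  wordAct⇒acted (c ∷ a) r (k , w , sa) with wordAct⇒acted a r w
  ... | refl , acted = SAct-sAdd (Core.part (Acted.core acted)) sa , acted-∷ acted (SAct-addable (Core.part (Acted.core acted)) sa)

  -- A letter raises `D` by at most one, so a total rise equal to the length forces every letter to
  -- raise it, and a letter that raises `D` has an addable corner.
  degree⇒acted : ∀ a {l q} → Core l q → D (qacts a q) ≡ length a ℕ.+ D q → Acted a l q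
  degree⇒acted [] r e = acted-[] r
  degree⇒acted (c ∷ a) {l} {q} r e = acted-∷ ih (addable-D {β (actP a l)} (Core.heights (Acted.core ih)) (trans e (cong suc (sym tail))))
    where
    tail : D (qacts a q) ≡ length a ℕ.+ D q
    tail = ℕP.≤-antisym (D-qacts a q) (ℕP.≤-pred (ℕP.≤-trans (ℕP.≤-reflexive (sym e)) (D-step 2≤n (qacts a q) c)))
    ih = degree⇒acted a r tail

  acted-++ : ∀ a b {l q} → Core l q → Acted b l q → Acted a (actP b l) (qacts b q) → Acted (a ++ b) l q
  acted-++ a b {l} {q} r B A = degree⇒acted (a ++ b) r
    (trans (cong D (qacts-++ a b q)) (trans (Acted.degree A) (trans (cong (length a ℕ.+_) (Acted.degree B))
      (trans (sym (ℕP.+-assoc (length a) (length b) (D q))) (cong (ℕ._+ D q) (sym (LP.length-++ a)))))))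

  acted-minimal : ∀ {a b} → Acted a [] ground → (∀ z → run b z ≡ run a z) → length a ℕ.≤ length b
  acted-minimal {a} {b} A h = ℕP.≤-trans (ℕP.≤-reflexive eq) (ℕP.≤-trans (D-qacts b ground) (ℕP.≤-reflexive len))
    where
    len : length b ℕ.+ D ground ≡ length b
    len = trans (cong (length b ℕ.+_) D-ground) (ℕP.+-identityʳ _)
    eq : length a ≡ D (qacts b ground)
    eq = sym (trans (cong D (qacts-run {_∈ β []} {ground} {b} {a} ground-⊨ h)) (trans (Acted.degree A) (trans (cong (length a ℕ.+_) D-ground) (ℕP.+-identityʳ _))))

  qact-ground : ∀ c → toℕ c ≢ 0 → qact c ground ≡ ground
  qact-ground c c≢0 = lookup-ext (λ k → trans (go (exchange-view 2≤n -[1+ 0 ] ground c k)) (sym (VP.lookup-replicate k (- + 1))))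
    where
    go : ∀ {k w} → Exchange -[1+ 0 ] ground c k w → w ≡ - + 1
    go (step-up j' _ _) = VP.lookup-replicate j' (- + 1)
    go (step-down j' _ _) = VP.lookup-replicate j' (- + 1)
    go (wrap-up j' e _ _) = ⊥-elim (c≢0 e)
    go (wrap-down j' e _ _) = ⊥-elim (c≢0 e)
    go {k} (still _ _ _) = VP.lookup-replicate k (- + 1)

  qacts-ground : ∀ u → All (λ i → toℕ i ≢ 0) u → qacts u ground ≡ ground
  qacts-ground [] [] = refl
  qacts-ground (c ∷ u) (p ∷ ps) = trans (cong (qact c) (qacts-ground u ps)) (qact-ground c p)

  acted-degree : ∀ {a} → Acted a [] ground → D (qacts a ground) ≡ length a
  acted-degree {a} A = trans (Acted.degree A) (trans (cong (length a ℕ.+_) D-ground) (ℕP.+-identityʳ _))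

  acted-reduced : ∀ {a} → Acted a [] ground → Reduced a
  acted-reduced {a} A b e = acted-minimal {a} {b} A (eval⇒run {b} {a} e)

  acted-Len : ∀ {a} → Acted a [] ground → Len (eval a) (length a)
  acted-Len {a} A = (a , refl , refl) , acted-reduced A

  -- The letters other than 0 fix the heights of the empty core, so the value of `D` after acting on
  -- `ground` is constant on the coset; it is a lower bound for the length of each word there.
  acted-AffGrass : ∀ {a} → Acted a [] ground → AffGrass (eval a)
  acted-AffGrass {a} A k (_ , min) a' u b e pu eb = ℕP.≤-trans (min a refl)
    (ℕP.≤-trans (ℕP.≤-reflexive (sym (trans (cong D same) (acted-degree A))))
      (ℕP.≤-trans (D-qacts b ground) (ℕP.≤-reflexive (trans (cong (length b ℕ.+_) D-ground) (ℕP.+-identityʳ _)))))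
    where
    same : qacts b ground ≡ qacts a ground
    same = trans (qacts-run {_∈ β []} {ground} {b} {a' ++ u} ground-⊨ (eval⇒run {b} {a' ++ u} eb)) (trans (qacts-++ a' u ground)
      (trans (cong (qacts a') (qacts-ground u pu)) (qacts-run {_∈ β []} {ground} {a'} {a} ground-⊨ (eval⇒run {a'} {a} e))))

  acted-Deg : ∀ {a} → Acted a [] ground → Deg n (actP a []) (length a)
  acted-Deg {a} A = eval a , acted-AffGrass A , (a , refl , acted-reduced A , Acted.act A) , acted-Len A

  Deg⇒acted : ∀ {l d} → Deg n l d → ∃[ a ] (Acted a [] ground × l ≡ actP a [] × length a ≡ d)
  Deg⇒acted (w , _ , (a , e , red , wa) , ((a₀ , len , e₀) , min)) with wordAct⇒acted a core-[] wa
  ... | l≡ , A = a , A , l≡ , ℕP.≤-antisym (ℕP.≤-trans (red a₀ (trans e₀ (sym e))) (ℕP.≤-reflexive len)) (min a e)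

  Deg⇒core : ∀ {l d} → Deg n l d → ∃[ q ] (Core l q × D q ≡ d)
  Deg⇒core dg with Deg⇒acted dg
  ... | a , A , refl , e = qacts a ground , Acted.core A , trans (acted-degree A) e

  core⇒IsCore : ∀ {l q} → Core l q → IsCore n l
  core⇒IsCore r = closed⇒core (Core.part r) (Core.closed r)

  -- Increasing windows: a core determines its affine permutation.

  Increasing : (ℤ → ℤ) → Set
  Increasing f = ∀ i j → + 0 < i → i < j → j ≤ N → f i < f j

  s-order : ∀ c {x y} → x < y → s c x < s c y ⊎ (x ≋ ⌜ c ⌝ × y ≡ x + + 1)
  s-order c {x} {y} lt = case (x ≋? ⌜ c ⌝) (x ≋? ⌜ c ⌝ + + 1) (y ≋? ⌜ c ⌝) (y ≋? ⌜ c ⌝ + + 1)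
    where
    case : Dec (x ≋ ⌜ c ⌝) → Dec (x ≋ ⌜ c ⌝ + + 1) → Dec (y ≋ ⌜ c ⌝) → Dec (y ≋ ⌜ c ⌝ + + 1) → s c x < s c y ⊎ (x ≋ ⌜ c ⌝ × y ≡ x + + 1)
    case (yes p) _ (yes q) _ = inj₁ (subst₂ _<_ (sym (s-up {c} p)) (sym (s-up {c} q)) (ℤP.+-monoˡ-< (+ 1) lt))
    case (yes p) _ (no _) (yes q) with ≋-gaps (≋-trans q (≋-sym (≋-+ (+ 1) p)))
    ... | inj₁ e = inj₂ (p , e)
    ... | inj₂ (inj₁ g) = ⊥-elim (lia 3 (λ x y n → x :< y ⇒ y ⊕ n :≤ x ⊕ #1 ⇒ #2 :≤ n ⇒ [ ⊥ₐ ]) x y N lt g 2≤N)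
    ... | inj₂ (inj₂ g) = inj₁ (subst₂ _<_ (sym (s-up {c} p)) (sym (s-down {c} q)) (lia 3 (λ x y n → x ⊕ #1 ⊕ n :≤ y ⇒ #2 :≤ n ⇒ [ x ⊕ #1 :< y ⊖ #1 ]) x y N g 2≤N))
    case (yes p) _ (no q) (no r) with ℤP.<-cmp (x + + 1) y
    ... | tri< g _ _ = inj₁ (subst₂ _<_ (sym (s-up {c} p)) (sym (s-off {c} q r)) g)
    ... | tri≈ _ e _ = inj₂ (p , sym e)
    ... | tri> _ _ g = ⊥-elim (lia 2 (λ x y → x :< y ⇒ y :< x ⊕ #1 ⇒ [ ⊥ₐ ]) x y lt g)
    case (no p) (yes q) (yes r) _ = inj₁ (subst₂ _<_ (sym (s-down {c} q)) (sym (s-up {c} r)) (lia 2 (λ x y → x :< y ⇒ [ x ⊖ #1 :< y ⊕ #1 ]) x y lt))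
    case (no p) (yes q) (no _) (yes r) = inj₁ (subst₂ _<_ (sym (s-down {c} q)) (sym (s-down {c} r)) (ℤP.+-monoˡ-< (- + 1) lt))
    case (no p) (yes q) (no r) (no r') = inj₁ (subst₂ _<_ (sym (s-down {c} q)) (sym (s-off {c} r r')) (lia 2 (λ x y → x :< y ⇒ [ x ⊖ #1 :< y ]) x y lt))
    case (no p) (no q) (yes r) _ = inj₁ (subst₂ _<_ (sym (s-off {c} p q)) (sym (s-up {c} r)) (lia 2 (λ x y → x :< y ⇒ [ x :< y ⊕ #1 ]) x y lt))
    case (no p) (no q) (no r) (no r') = inj₁ (subst₂ _<_ (sym (s-off {c} p q)) (sym (s-off {c} r r')) lt)
    case (no p) (no q) (no _) (yes r) with ℤP.<-cmp (x + + 1) y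
    ... | tri< g _ _ = inj₁ (subst₂ _<_ (sym (s-off {c} p q)) (sym (s-down {c} r)) (lia 2 (λ x y → x ⊕ #1 :< y ⇒ [ x :< y ⊖ #1 ]) x y g))
    ... | tri≈ _ e _ = ⊥-elim (p (≋-shift {x + + 1} {⌜ c ⌝ + + 1} (subst (_≋ ⌜ c ⌝ + + 1) (sym e) r) (lia 2 (λ x c → [ x ⊖ c :≡ x ⊕ #1 ⊖ (c ⊕ #1) ]) x ⌜ c ⌝)))
    ... | tri> _ _ g = ⊥-elim (lia 2 (λ x y → x :< y ⇒ y :< x ⊕ #1 ⇒ [ ⊥ₐ ]) x y lt g)

  -- The letter reverses only a pair x, x + 1 with x of class c. Here x is no bead, but x + 1 - n is
  -- one. The addable bead of class c therefore lies below x, so at most at x - n, and closedness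
  -- makes its right neighbour a bead, which is absurd.
  acted-increasing : ∀ a → Acted a [] ground → Increasing (run a) → ∀ c → HasAddable c (β (actP a [])) → Increasing (run (c ∷ a))
  acted-increasing a A inc c (p , bp≋ , ∉b) i j 0<i i<j j≤N = case (s-order c (inc i j 0<i i<j j≤N))
    where
    b = β (actP a [])
    ∈b : ∀ z → z ≤ + 0 → run a z ∈ b
    ∈b z le = Equivalence.from (Acted.range A _) (subst (_∈ β []) (sym (run⁻¹-run a z)) (Equivalence.from (β[]-range z) le))
    case : s c (run a i) < s c (run a j) ⊎ (run a i ≋ ⌜ c ⌝ × run a j ≡ run a i + + 1) → s c (run a i) < s c (run a j)
    case (inj₁ lt) = lt
    case (inj₂ (x≋ , y≡)) = ⊥-elim (∉b (closed-≤ (Core.closed (Acted.core A)) y-N∈ y≋ le))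
      where
      x = run a i
      x∉ : x ∉ b
      x∉ m = ℤP.<⇒≱ 0<i (Equivalence.to (β[]-range i) (subst (_∈ β []) (run⁻¹-run a i) (Equivalence.to (Acted.range A x) m)))
      y-N∈ : run a j - N ∈ b
      y-N∈ = subst (_∈ b) (per--N (per-run a) j) (∈b (j - N) (lia 2 (λ j n → j :≤ n ⇒ [ j ⊖ n :≤ #0 ]) j N j≤N))
      bp<x : b p < x
      bp<x = ℤP.≰⇒> (λ le → x∉ (closed-≤ (Core.closed (Acted.core A)) (p , refl) (≋-trans x≋ (≋-sym bp≋)) le))
      gp : b p + N ≤ x
      gp = ≋-gap (≋-trans bp≋ (≋-sym x≋)) bp<x
      y≋ : b p + + 1 ≋ run a j - N
      y≋ = ≋-trans (≋-+ (+ 1) (≋-trans bp≋ (≋-sym x≋))) (≋-trans (≡⇒≋ (sym y≡)) (≋-sym ≋-down))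
      le : b p + + 1 ≤ run a j - N
      le = lia 4 (λ b n x y → b ⊕ n :≤ x ⇒ y :≡ x ⊕ #1 ⇒ [ b ⊕ #1 :≤ y ⊖ n ]) (b p) N x (run a j) gp y≡

  wordAct⇒increasing : ∀ a {l} → WordAct n a [] l → Increasing (run a)
  wordAct⇒increasing [] w i j _ lt _ = lt
  wordAct⇒increasing (c ∷ a) (k , w , sa) with wordAct⇒acted a core-[] w
  ... | refl , A = acted-increasing a A (wordAct⇒increasing a w) c (SAct-addable (Core.part (Acted.core A)) sa)

  -- Two increasing windows with the same bead set differ by an increasing permutation of 1 … n.
  word-unique : ∀ {a a' l} → WordAct n a [] l → WordAct n a' [] l → ∀ z → run a z ≡ run a' z
  word-unique {a} {a'} {l} w w' z = trans (sym (run-run⁻¹ a' _)) (cong (run a') (per-ext (per-∘ (per-run⁻¹ a') (per-run a)) (per-run []) (+ 1) identity z))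
    where
    module _ (a a' : Word n) (w : WordAct n a [] l) (w' : WordAct n a' [] l) where
      g : ℤ → ℤ
      g z = run⁻¹ a' (run a z)
      pg : Per g
      pg = per-∘ (per-run⁻¹ a') (per-run a)
      A = wordAct⇒acted a core-[] w
      A' = wordAct⇒acted a' core-[] w'
      g≤0 : ∀ z → g z ≤ + 0 ⇔ z ≤ + 0
      g≤0 z = ⇔-trans (⇔-sym (β[]-range _)) (⇔-trans (⇔-sym (Acted.range (proj₂ A') (run a z)))
        (⇔-trans (subst (λ m → run a z ∈ β m ⇔ run a z ∈ β (actP a [])) (trans (sym (proj₁ A)) (proj₁ A')) (mk⇔ (λ m → m) (λ m → m)))
        (⇔-trans (Acted.range (proj₂ A) (run a z)) (subst (λ y → y ∈ β [] ⇔ z ≤ + 0) (sym (run⁻¹-run a z)) (β[]-range z)))))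
      g>0 : ∀ z → + 0 < z → + 0 < g z
      g>0 z lt = ℤP.≰⇒> (λ le → ℤP.<⇒≱ lt (Equivalence.to (g≤0 z) le))
      g≤N : ∀ z → z ≤ N → g z ≤ N
      g≤N z le = lia 2 (λ g n → g ⊖ n :≤ #0 ⇒ [ g :≤ n ]) (g z) N
        (subst (_≤ + 0) (per--N pg z) (Equivalence.from (g≤0 (z - N)) (lia 2 (λ j n → j :≤ n ⇒ [ j ⊖ n :≤ #0 ]) z N le)))
      g-inc : Increasing g
      g-inc i j 0<i i<j j≤N with ℤP.<-cmp (g i) (g j)
      ... | tri< p _ _ = p
      ... | tri≈ _ e _ = ⊥-elim (ℤP.<-irrefl (run-inj a (trans (sym (run-run⁻¹ a' _)) (trans (cong (run a') e) (run-run⁻¹ a' _)))) i<j)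
      ... | tri> _ _ p = ⊥-elim (ℤP.<-asym (wordAct⇒increasing a w i j 0<i i<j j≤N)
             (subst₂ _<_ (run-run⁻¹ a' _) (run-run⁻¹ a' _) (wordAct⇒increasing a' w' (g j) (g i) (g>0 j (ℤP.<-trans 0<i i<j)) p (g≤N i (ℤP.≤-trans (ℤP.<⇒≤ i<j) j≤N)))))
      -- Positive increasing integers satisfy g k ≥ k. The same bound for the inverse, with `a` and
      -- `a'` interchanged, then forces the identity.
      g≥ : ∀ k → + suc k ≤ N → + suc k ≤ g (+ suc k)
      g≥ zero le = ℤP.i<j⇒suc[i]≤j (g>0 (+ 1) (ℤ.+<+ (ℕ.s≤s ℕ.z≤n)))
      g≥ (suc k) le = lia 4 (λ k k' gk gk' → k' :≡ k ⊕ #1 ⇒ k :≤ gk ⇒ gk :< gk' ⇒ [ k' :≤ gk' ]) (+ suc k) (+ suc (suc k)) (g (+ suc k)) (g (+ suc (suc k)))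
        (+suc (suc k)) (g≥ k (ℤP.≤-trans (ℤ.+≤+ (ℕP.n≤1+n _)) le)) (g-inc (+ suc k) (+ suc (suc k)) (ℤ.+<+ (ℕ.s≤s ℕ.z≤n)) (ℤ.+<+ ℕP.≤-refl) le)
      g≥' : ∀ z → + 0 < z → z ≤ N → z ≤ g z
      g≥' (+ zero) (ℤ.+<+ ()) _
      g≥' (+ suc k) _ le = g≥ k le
    identity : ∀ z → + 1 ≤ z → z < + 1 + N → run⁻¹ a' (run a z) ≡ z
    identity z lo hi = ℤP.≤-antisym
      (subst (g a a' w w' z ≤_) (trans (cong (run⁻¹ a) (run-run⁻¹ a' _)) (run⁻¹-run a z)) (g≥' a' a w' w _ (g>0 a a' w w' z 0<z) (g≤N a a' w w' z z≤N)))
      (g≥' a a' w w' z 0<z z≤N)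
      where
      0<z : + 0 < z
      0<z = ℤP.suc[i]≤j⇒i<j lo
      z≤N : z ≤ N
      z≤N = lia 2 (λ z n → z :< #1 ⊕ n ⇒ [ z :≤ n ]) z N hi

  -- Strict monotonicity of the degree

  record State (b : Seq) (q : Vec ℤ n) : Set where
    field
      maya : Maya b
      closed : Closed b
      levels : (_∈ b) ⊨ q
    open Maya maya public

  core⇒state : ∀ {l q} → Core l q → State (β l) q
  core⇒state r = record { maya = β-maya part ; closed = closed ; levels = heights }
    where open Core r

  -- The only danger is an index with `e i = f i` at which `f` alone loses a cell. Then `e i - 1` is
  -- a later bead of `e`, and inclusion squeezes `f (suc i)` to `f i - 1`, so `f` has no removable
  -- corner there.
  down-mono : ∀ c {e f} → Decreasing e → Decreasing f → e ⊆ f → down c e ⊆ down c f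
  down-mono c {e} {f} de df e⊆f i = case (down-view c df i) (down-view c de i)
    where
    case : ∀ {x y} → DownView c f i y → DownView c e i x → x ≤ y
    case (moved _ _) (moved _ _) = ℤP.+-monoˡ-≤ (- + 1) (e⊆f i)
    case (fixed _) (fixed _) = e⊆f i
    case (fixed _) (moved _ _) = lia 2 (λ x y → x :≤ y ⇒ [ x ⊖ #1 :≤ y ]) (e i) (f i) (e⊆f i)
    case (moved p q) (fixed h) with ℤP.<-cmp (e i) (f i)
    ... | tri< lt _ _ = lia 2 (λ x y → x :< y ⇒ [ x :≤ y ⊖ #1 ]) (e i) (f i) lt
    ... | tri> _ _ gt = ⊥-elim (ℤP.<⇒≱ gt (e⊆f i))
    ... | tri≈ _ eq _ with h (subst (_≋ ⌜ c ⌝ + + 1) (sym eq) p)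
    ...   | j , ej = ⊥-elim (q (suc i , lia 5 (λ ei fi ej e' f' → ei :≡ fi ⇒ ej :≡ ei ⊖ #1 ⇒ ej :≤ e' ⇒ e' :≤ f' ⇒ f' :< fi ⇒ [ f' :≡ fi ⊖ #1 ])
            (e i) (f i) (e j) (e (suc i)) (f (suc i)) eq ej (dec-mono≤ de i<j) (e⊆f (suc i)) (df i)))
      where
      i<j : i ℕ.< j
      i<j = dec-cancel< de (lia 2 (λ ei ej → ej :≡ ei ⊖ #1 ⇒ [ ej :< ei ]) (e i) (e j) ej)

  removable-dec : ∀ c {b} → Maya b → Dec (HasRemovable c b)
  removable-dec c {b} m = case (ℕP.anyUpTo? (λ i → b i ≋? ⌜ c ⌝ + + 1 ×-dec ¬? (_∈?_ dec (b i - + 1))) (proj₁ stable))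
    where
    open Maya m
    case : Dec (∃[ i ] (i ℕ.< proj₁ stable × (b i ≋ ⌜ c ⌝ + + 1 × b i - + 1 ∉ b))) → Dec (HasRemovable c b)
    case (yes (i , _ , r)) = yes (i , r)
    case (no ¬r) = no λ { (i , p , q) → ¬r (i , bound i q , p , q) }
      where
      bound : ∀ i → b i - + 1 ∉ b → i ℕ.< proj₁ stable
      bound i q = ℕP.≰⇒> (λ M≤i → q (suc i , lia 4 (λ b b' i i' → b :≡ i ⇒ b' :≡ i' ⇒ i' :≡ i ⊖ #1 ⇒ [ b' :≡ b ⊖ #1 ])
        (b i) (b (suc i)) (- + i) (- + suc i) (proj₂ stable i M≤i) (proj₂ stable (suc i) (ℕP.m≤n⇒m≤1+n M≤i)) (-+suc i)))

  -- The topmost nonempty row has only empty rows above it, so its last cell is removable.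
  corner : ∀ {b} → Maya b → (∃[ c ] HasRemovable c b) ⊎ (∀ i → b i ≡ - + i)
  corner {b} m = go (proj₁ stable) (proj₂ stable)
    where
    open Maya m
    at-last : ∀ i → b i ≢ - + i → (∀ j → suc i ℕ.≤ j → b j ≡ - + j) → ∃[ c ] HasRemovable c b
    at-last i ne st = residue (b i - + 1) , i , ≋-suc (≋-sym (residue-≋ (b i - + 1))) , notin
      where
      above : - + i < b i
      above = ℤP.≤∧≢⇒< (low i) (λ e → ne (sym e))
      notin : b i - + 1 ∉ b
      notin (j , e) = lia 4 (λ bi b' i i' → i :< bi ⇒ b' :≡ i' ⇒ i' :≡ i ⊖ #1 ⇒ bi ⊖ #1 :≤ b' ⇒ [ ⊥ₐ ])
        (b i) (b (suc i)) (- + i) (- + suc i) above (st (suc i) ℕP.≤-refl) (-+suc i)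
        (subst (_≤ b (suc i)) e (dec-mono≤ dec (dec-cancel< dec (lia 2 (λ bi bj → bj :≡ bi ⊖ #1 ⇒ [ bj :< bi ]) (b i) (b j) e))))
    go : ∀ M → (∀ i → M ℕ.≤ i → b i ≡ - + i) → (∃[ c ] HasRemovable c b) ⊎ (∀ i → b i ≡ - + i)
    go zero st = inj₂ (λ i → st i ℕ.z≤n)
    go (suc M) st = case (b M ℤP.≟ - + M)
      where
      case : Dec (b M ≡ - + M) → (∃[ c ] HasRemovable c b) ⊎ (∀ i → b i ≡ - + i)
      case (no ne) = inj₁ (at-last M ne st)
      case (yes e) = go M st'
        where
        st' : ∀ i → M ℕ.≤ i → b i ≡ - + i
        st' i le with ℕP.m≤n⇒m<n∨m≡n le
        ... | inj₁ lt = st i lt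
        ... | inj₂ refl = e

  down-state : ∀ c {b q} → State b q → HasRemovable c b → State (down c b) (qact c q)
  down-state c {b} {q} st rem = record
    { maya = down-maya c maya
    ; closed = down-closed c dec closed rem
    ; levels = ⊨-cong (λ z → ⇔-sym (down-range c dec closed rem z)) (⊨-s {_∈ b} c levels) }
    where open State st

  D-down : ∀ c {b q} → State b q → HasRemovable c b → D q ≡ suc (D (qact c q))
  D-down c {b} {q} st rem@(i , p , ∉b) = trans (cong D (sym (qact-invol c q))) (D-addable {down c b} (State.levels (down-state c st rem)) (j , c≋ , notin))
    where
    open State st
    x∈ : b i - + 1 ∈ down c b
    x∈ = Equivalence.from (down-range c dec closed rem (b i - + 1)) (i , sym (trans (s-up {c} (≋-pred p)) (lem' (b i))))
      where
      lem' : ∀ b → b - + 1 + + 1 ≡ b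
      lem' = solve-∀
    j = proj₁ x∈
    c≋ : down c b j ≋ ⌜ c ⌝
    c≋ = subst (_≋ ⌜ c ⌝) (sym (proj₂ x∈)) (≋-pred p)
    notin : down c b j + + 1 ∉ down c b
    notin m = ∉b (subst (_∈ b) (s-down {c} p) (Equivalence.to (down-range c dec closed rem (b i)) (subst (_∈ down c b) (trans (cong (λ w → w + + 1) (proj₂ x∈)) (lem' (b i))) m)))
      where
      lem' : ∀ b → b - + 1 + + 1 ≡ b
      lem' = solve-∀

  -- Removing all corners of one residue preserves inclusion, so the degree is strictly monotone on cores.
  degree-mono : ∀ d {e f p q} → State e p → State f q → D q ≡ d → e ⊆ f → (∀ i → e i ≡ f i) ⊎ D p ℕ.< D q
  degree-mono d {e} {f} {p} {q} se sf Dq e⊆f = step d Dq (corner (State.maya sf))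
    where
    step : ∀ d → D q ≡ d → (∃[ c ] HasRemovable c f) ⊎ (∀ i → f i ≡ - + i) → (∀ i → e i ≡ f i) ⊎ D p ℕ.< D q
    step d _ (inj₂ ground) = inj₁ (λ i → ℤP.≤-antisym (e⊆f i) (subst (_≤ e i) (sym (ground i)) (State.low se i)))
    step zero Dq (inj₁ (c , rem)) = ⊥-elim (ℕP.1+n≢0 (trans (sym (D-down c sf rem)) Dq))
    step (suc d) Dq (inj₁ (c , rem)) = case (removable-dec c (State.maya se))
      where
      sf' = down-state c sf rem
      Dq' : D (qact c q) ≡ d
      Dq' = ℕP.suc-injective (trans (sym (D-down c sf rem)) Dq)
      mono : down c e ⊆ down c f
      mono = down-mono c (State.dec se) (State.dec sf) e⊆f
      back : ∀ {b p} → State b p → HasRemovable c b → ∀ z → z ∈ b ⇔ s c z ∈ down c b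
      back {b} sb r z = subst (λ w → w ∈ b ⇔ s c z ∈ down c b) (s-invol c z) (⇔-sym (down-range c (State.dec sb) (State.closed sb) r (s c z)))
      unmoved : ¬ HasRemovable c e → ∀ i {w} → DownView c e i w → w ≡ e i
      unmoved ¬r i (moved x y) = ⊥-elim (¬r (i , x , y))
      unmoved ¬r i (fixed _) = refl
      both : HasRemovable c e → (∀ i → down c e i ≡ down c f i) ⊎ D (qact c p) ℕ.< D (qact c q) → (∀ i → e i ≡ f i) ⊎ D p ℕ.< D q
      both r (inj₁ eq) = inj₁ (range-≡ (State.dec se) (State.dec sf) (λ z → ⇔-trans (back se r z) (⇔-trans (∈-cong eq (s c z)) (⇔-sym (back sf rem z)))))
      both r (inj₂ lt) = inj₂ (subst₂ ℕ._<_ (sym (D-down c se r)) (sym (D-down c sf rem)) (ℕ.s≤s lt))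
      -- Without a removable corner of residue c, `e` itself lies inside `down c f`, which is
      -- already one degree below `f`; equality there still gives a strict inequality.
      one-sided : (∀ i → e i ≡ down c f i) ⊎ D p ℕ.< D (qact c q) → (∀ i → e i ≡ f i) ⊎ D p ℕ.< D q
      one-sided (inj₁ eq) = inj₂ (ℕP.≤-reflexive (trans (cong (λ v → suc (D v)) (⊨-unique (⊨-cong (∈-cong eq) (State.levels se)) (State.levels sf'))) (sym (D-down c sf rem))))
      one-sided (inj₂ lt) = inj₂ (ℕP.<-trans lt (ℕP.≤-reflexive (sym (D-down c sf rem))))
      case : Dec (HasRemovable c e) → (∀ i → e i ≡ f i) ⊎ D p ℕ.< D q
      case (yes r) = both r (degree-mono d (down-state c se r) sf' Dq' mono)
      case (no ¬r) = one-sided (degree-mono d se sf' Dq' (λ i → ℤP.≤-trans (ℤP.≤-reflexive (sym (unmoved ¬r i (down-view c (State.dec se) i)))) (mono i)))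

  -- Strong covers

  last-index : ∀ {P : ℕ → Set} → (∀ i → Dec (P i)) → P 0 → ∀ M → (∀ i → M ℕ.≤ i → ¬ P i) → ∃[ i ] (P i × (∀ j → i ℕ.< j → ¬ P j))
  last-index P? p zero above = ⊥-elim (above 0 ℕ.z≤n p)
  last-index {P} P? p (suc M) above = case (P? M)
    where
    case : Dec (P M) → ∃[ i ] (P i × (∀ j → i ℕ.< j → ¬ P j))
    case (yes q) = M , q , above
    case (no ¬q) = last-index P? p M above'
      where
      above' : ∀ i → M ℕ.≤ i → ¬ P i
      above' i le with ℕP.m≤n⇒m<n∨m≡n le
      ... | inj₁ lt = above i lt
      ... | inj₂ refl = ¬q

  -- c is a core and e, f are cores with  c i ≤ e i ≤ f i < c (i - 1), where c (-1) = c 0 + n.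
  module Sandwich {c e f : Seq} {p q : Vec ℤ n} (dc : Decreasing c) (cc : Closed c) (se : State e p) (sf : State f q)
    (c⊆e : c ⊆ e) (e⊆f : e ⊆ f) (f<c : ∀ i → f (suc i) < c i) (f0< : f 0 < c 0 + N) where

    private
      de = State.dec se
      df = State.dec sf
      ce = State.closed se
      cf = State.closed sf

    -- Interlacing: a bead of `e` with an index below i is at least `c (i - 1)`, which is beyond
    -- `f i`. So the interval from `e i` to `f i` meets no other bead of `e`.
    e-slot : ∀ i j → e i < e j → f i < e j
    e-slot i j lt = go j i (dec-cancel< de lt)
      where
      go : ∀ j i → j ℕ.< i → f i < e j
      go j (suc i) (ℕ.s≤s j≤i) = ℤP.<-≤-trans (f<c i) (ℤP.≤-trans (c⊆e i) (dec-mono≤ de j≤i))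

    e-below : ∀ i {z} → z ∈ e → z ≤ f i → z ≤ e i
    e-below i (j , refl) le = ℤP.≮⇒≥ (λ lt → ℤP.<⇒≱ (e-slot i j lt) le)

    -- Closedness puts `c i - N` among the beads of `c` after index i, so consecutive beads of `c`
    -- are at most n apart, and so is the room for one bead.
    width : ∀ i → f i < e i + N
    width zero = ℤP.<-≤-trans f0< (ℤP.+-monoˡ-≤ N (c⊆e 0))
    width (suc i) = case (cc i)
      where
      case : c i - N ∈ c → f (suc i) < e (suc i) + N
      case (j , ej) = lia 6 (λ f ci cj c' e n → f :< ci ⇒ cj :≡ ci ⊖ n ⇒ cj :≤ c' ⇒ c' :≤ e ⇒ [ f :< e ⊕ n ])
        (f (suc i)) (c i) (c j) (c (suc i)) (e (suc i)) N (f<c i) ej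
        (dec-mono≤ dc (dec-cancel< dc (lia 3 (λ ci cj n → cj :≡ ci ⊖ n ⇒ #2 :≤ n ⇒ [ cj :< ci ]) (c i) (c j) N ej 2≤N))) (c⊆e (suc i))

    -- The runner of f 0 takes beads from the runner of e i, where i is the lowest row in which it gains; g performs just that exchange.
    module Cover (e0<f0 : e 0 < f 0) (Dq : D q ≡ suc (D p)) where
      private
        y = f 0

        Gain : ℕ → Set
        Gain i = f i ≋ y × f i ≢ e i

        M = proj₁ (State.stable se) ℕ.+ proj₁ (State.stable sf)

        found : ∃[ i ] (Gain i × (∀ j → i ℕ.< j → ¬ Gain j))
        found = last-index (λ i → f i ≋? y ×-dec ¬? (f i ℤP.≟ e i)) (≋-refl , λ eq → ℤP.<-irrefl (sym eq) e0<f0) M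
          (λ i le h → proj₂ h (trans (proj₂ (State.stable sf) i (ℕP.≤-trans (ℕP.m≤n+m _ _) le)) (sym (proj₂ (State.stable se) i (ℕP.≤-trans (ℕP.m≤m+n _ _) le)))))

        i = proj₁ found
        fi≋y = proj₁ (proj₁ (proj₂ found))
        fi≢ei = proj₂ (proj₁ (proj₂ found))
        u = e i

        Raised : ℕ → Set
        Raised j = f j ≋ y × e j ≋ u

        raised? : ∀ j → Dec (Raised j)
        raised? j = f j ≋? y ×-dec e j ≋? u

        pick : ∀ {j} → Dec (Raised j) → ℤ
        pick {j} (yes _) = f j
        pick {j} (no _) = e j

        abstract
          g : Seq
          g j = pick (raised? j)

          g-raised : ∀ {j} → Raised j → g j ≡ f j
          g-raised {j} r = go (raised? j)
            where
            go : (d : Dec (Raised j)) → pick d ≡ f j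
            go (yes _) = refl
            go (no ¬r) = ⊥-elim (¬r r)

          g-kept : ∀ {j} → ¬ Raised j → g j ≡ e j
          g-kept {j} r = go (raised? j)
            where
            go : (d : Dec (Raised j)) → pick d ≡ e j
            go (yes r') = ⊥-elim (r r')
            go (no _) = refl

        e⊆g : e ⊆ g
        e⊆g j = go (raised? j)
          where
          go : Dec (Raised j) → e j ≤ g j
          go (yes r) = ℤP.≤-trans (e⊆f j) (ℤP.≤-reflexive (sym (g-raised r)))
          go (no r) = ℤP.≤-reflexive (sym (g-kept r))

        g⊆f : g ⊆ f
        g⊆f j = go (raised? j)
          where
          go : Dec (Raised j) → g j ≤ f j
          go (yes r) = ℤP.≤-reflexive (g-raised r)
          go (no r) = ℤP.≤-trans (ℤP.≤-reflexive (g-kept r)) (e⊆f j)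

        maya : Maya g
        maya = record
          { dec = λ j → ℤP.≤-<-trans (g⊆f (suc j)) (ℤP.<-≤-trans (f<c j) (ℤP.≤-trans (c⊆e j) (e⊆g j)))
          ; low = λ j → ℤP.≤-trans (State.low se j) (e⊆g j)
          ; stable = M , λ j le → ℤP.≤-antisym
              (ℤP.≤-trans (g⊆f j) (ℤP.≤-reflexive (proj₂ (State.stable sf) j (ℕP.≤-trans (ℕP.m≤n+m _ _) le))))
              (ℤP.≤-trans (State.low se j) (e⊆g j)) }

        -- As i is the last gaining index, `f j - f i` is a nonnegative multiple of n. Lowering
        -- `e j` by it gives a bead of `e` that is at most `f i`, hence at most `e i` by `e-below`.
        gain≤ : ∀ {j} → f j ≋ y → f j ≢ e j → e j ≤ u + (f j - f i)
        gain≤ {j} fj≋y ne = lia 4 (λ ej u fj fi → ej ⊖ (fj ⊖ fi) :≤ u ⇒ [ ej :≤ u ⊕ (fj ⊖ fi) ]) (e j) u (f j) (f i)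
            (e-below i (closed-≤ ce (j , refl) (≋-shift (≋-trans fi≋y (≋-sym fj≋y)) (lem (e j) (f j) (f i)))
              (lia 3 (λ ej fj fi → fi :≤ fj ⇒ [ ej ⊖ (fj ⊖ fi) :≤ ej ]) (e j) (f j) (f i) fi≤fj))
              (lia 3 (λ ej fj fi → ej :≤ fj ⇒ [ ej ⊖ (fj ⊖ fi) :≤ fi ]) (e j) (f j) (f i) (e⊆f j)))
          where
          lem : ∀ e fj fi → e - (fj - fi) - e ≡ fi - fj
          lem = solve-∀
          fi≤fj : f i ≤ f j
          fi≤fj = dec-mono≤ df (ℕP.≮⇒≥ (λ lt → proj₂ (proj₂ found) j lt (fj≋y , ne)))

        -- The gains `f j - e j` and `f i - u` are congruent, and `width` confines both to the
        -- interval from 0 to n - 1.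
        raised≡ : ∀ {j} → Raised j → e j ≡ u + (f j - f i)
        raised≡ {j} (fj≋y , ej≋u) = ≋-near (≋-trans ej≋u (≋-sym (≋-shift (≋-trans fj≋y (≋-sym fi≋y)) (lem u (f j) (f i)))))
            (lia 5 (λ ej u fj fi n → ej :≤ fj ⇒ fi :< u ⊕ n ⇒ [ ej :< u ⊕ (fj ⊖ fi) ⊕ n ]) (e j) u (f j) (f i) N (e⊆f j) (width i))
            (lia 5 (λ ej u fj fi n → fj :< ej ⊕ n ⇒ u :≤ fi ⇒ [ u ⊕ (fj ⊖ fi) :< ej ⊕ n ]) (e j) u (f j) (f i) N (width j) (e⊆f i))
          where
          lem : ∀ u fj fi → u + (fj - fi) - u ≡ fj - fi
          lem = solve-∀

        -- Let `f l = f j - N`. If row l gains, then `gain≤` bounds `e l` above by `e j - N` and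
        -- `e-below` bounds it below, so row l is raised too; if it does not gain, all three
        -- sequences agree there.
        closed-raised : ∀ {j} → Raised j → f j - N ∈ g
        closed-raised {j} r = case (cf j)
          where
          case : f j - N ∈ f → f j - N ∈ g
          case (l , fl) = case' (f l ℤP.≟ e l)
            where
            fl≋y : f l ≋ y
            fl≋y = ≋-trans (≡⇒≋ fl) (≋-trans ≋-down (proj₁ r))
            case' : Dec (f l ≡ e l) → f j - N ∈ g
            case' (yes eq) = l , trans (ℤP.≤-antisym (g⊆f l) (ℤP.≤-trans (ℤP.≤-reflexive eq) (e⊆g l))) fl
            case' (no ne) = l , trans (g-raised (fl≋y , ≋-trans (≡⇒≋ el) (≋-trans ≋-down (proj₂ r)))) fl
              where
              el : e l ≡ e j - N
              el = ℤP.≤-antisym (lia 6 (λ el ej u fl fj d → el :≤ u ⊕ fl ⊖ d ⇒ ej :≡ u ⊕ fj ⊖ d ⇒ fl :≡ fj ⇒ [ el :≤ ej ])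
                  (e l) (e j - N) u (f l) (f j - N) (f i)
                  (ℤP.≤-trans (gain≤ fl≋y ne) (ℤP.≤-reflexive (l1 u (f l) (f i)))) (trans (cong (λ w → w - N) (raised≡ r)) (l2 u (f j) (f i) N)) fl)
                (e-below l (ce j) (ℤP.≤-trans (ℤP.+-monoˡ-≤ (- N) (e⊆f j)) (ℤP.≤-reflexive (sym fl))))
                where
                l1 : ∀ u a b → u + (a - b) ≡ u + a - b
                l1 = solve-∀
                l2 : ∀ u a b n → u + (a - b) - n ≡ u + (a - n) - b
                l2 = solve-∀

        -- The danger is that the bead `e l = e j - N` has been raised away. Then `f l + N` is a
        -- bead `f k`, because `f 0` tops that runner; row k gains as well, and the two bounds give
        -- `e k = e l + N = e j`. So k = j, and row j was raised after all.
        closed-kept : ∀ {j} → ¬ Raised j → e j - N ∈ g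
        closed-kept {j} ¬r = case (ce j)
          where
          case : e j - N ∈ e → e j - N ∈ g
          case (l , el) = case' (raised? l)
            where
            case' : Dec (Raised l) → e j - N ∈ g
            case' (no ¬r') = l , trans (g-kept ¬r') el
            case' (yes r'@(fl≋y , el≋u)) = case'' (f l ℤP.≟ e l)
              where
              j<l : j ℕ.< l
              j<l = dec-cancel< de (lia 3 (λ ej el n → el :≡ ej ⊖ n ⇒ #2 :≤ n ⇒ [ el :< ej ]) (e j) (e l) N el 2≤N)
              fl+N≤ : f l + N ≤ f 0
              fl+N≤ = ≋-gap fl≋y (dec-mono< df (ℕP.≤-<-trans ℕ.z≤n j<l))
              case'' : Dec (f l ≡ e l) → e j - N ∈ g
              case'' (yes eq) = l , trans (trans (g-raised r') eq) el
              case'' (no ne) with closed-≤ cf {f 0} {f l + N} (0 , refl) (≋-trans ≋-up fl≋y) fl+N≤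
              ... | k , fk = ⊥-elim (¬r (subst Raised k≡j (fk≋y , subst (_≋ u) (sym ek) (≋-trans ≋-up el≋u))))
                where
                fk≋y : f k ≋ y
                fk≋y = ≋-trans (≡⇒≋ fk) (≋-trans ≋-up fl≋y)
                el<fl : e l < f l
                el<fl = ℤP.≤∧≢⇒< (e⊆f l) (λ h → ne (sym h))
                fk≢ek : f k ≢ e k
                fk≢ek eq = ℤP.<⇒≱ el<fl (e-below l (closed-≤ ce (k , refl) (≋-trans (≋-sym ≋-up) (≡⇒≋ (trans (sym fk) eq)))
                  (lia 4 (λ fl fk ek n → fk :≡ fl ⊕ n ⇒ fk :≡ ek ⇒ #2 :≤ n ⇒ [ fl :≤ ek ]) (f l) (f k) (e k) N fk eq 2≤N)) ℤP.≤-refl)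
                ej≡ : e j ≡ e l + N
                ej≡ = lia 3 (λ ej el n → el :≡ ej ⊖ n ⇒ [ ej :≡ el ⊕ n ]) (e j) (e l) N el
                ek : e k ≡ e l + N
                ek = ℤP.≤-antisym
                  (lia 7 (λ ek el u fk fl fi n → ek :≤ u ⊕ (fk ⊖ fi) ⇒ el :≡ u ⊕ (fl ⊖ fi) ⇒ fk :≡ fl ⊕ n ⇒ [ ek :≤ el ⊕ n ])
                     (e k) (e l) u (f k) (f l) (f i) N (gain≤ fk≋y fk≢ek) (raised≡ r') fk)
                  (subst (_≤ e k) ej≡ (e-below k (j , refl) (lia 5 (λ ej el fk fl n → ej :≡ el ⊕ n ⇒ el :< fl ⇒ fk :≡ fl ⊕ n ⇒ [ ej :≤ fk ]) (e j) (e l) (f k) (f l) N ej≡ el<fl fk)))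
                k≡j : k ≡ j
                k≡j = dec-inj de (trans ek (sym ej≡))

        closed : Closed g
        closed j = go (raised? j)
          where
          go : Dec (Raised j) → g j - N ∈ g
          go (yes r) = subst (λ w → w - N ∈ g) (sym (g-raised r)) (closed-raised r)
          go (no r) = subst (λ w → w - N ∈ g) (sym (g-kept r)) (closed-kept r)

        ex = exists-⊨ maya closed
        sg : State g (proj₁ ex)
        sg = record { maya = maya ; closed = closed ; levels = proj₂ ex }

        g≡f : ∀ j → g j ≡ f j
        g≡f = case (degree-mono (D q) sg sf refl g⊆f) (degree-mono (D (proj₁ ex)) se sg refl e⊆g)
          where
          case : (∀ j → g j ≡ f j) ⊎ D (proj₁ ex) ℕ.< D q → (∀ j → e j ≡ g j) ⊎ D p ℕ.< D (proj₁ ex) → ∀ j → g j ≡ f j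
          case (inj₁ h) _ = h
          case (inj₂ _) (inj₁ h) = ⊥-elim (fi≢ei (trans (sym (g-raised (fi≋y , ≋-refl))) (sym (h i))))
          case (inj₂ lt) (inj₂ lt') = ⊥-elim (ℕP.<⇒≱ lt' (ℕ.s≤s⁻¹ (subst (D (proj₁ ex) ℕ.<_) Dq lt)))

        -- Row 0 differs between `e` and `f`, and now that g equals `f`, only raised rows differ.
        e0≋u : e 0 ≋ u
        e0≋u = go (raised? 0)
          where
          go : Dec (Raised 0) → e 0 ≋ u
          go (yes r) = proj₂ r
          go (no ¬r) = ⊥-elim (ℤP.<-irrefl (trans (sym (g-kept ¬r)) (g≡f 0)) e0<f0)

      x≋̸y : ¬ e 0 ≋ f 0
      x≋̸y h = ℤP.<⇒≱ (width 0) (≋-gap h e0<f0)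

      -- Gaining rows are raised rows and move by `y - x`. For an unmoved bead of class x, the
      -- target is still a bead of `f`, lying at most at `f 0`; had it been raised, it would come
      -- from that very bead, so it belongs to `e` already.
      cover-range : ∀ z → z ∈ f ⇔ tr (e 0) (f 0) z ∈ e
      cover-range = moves-range x≋̸y moves back
        where
        x = e 0
        raised-tr : ∀ {j} → f j ≋ y → e j ≋ x → f j ≡ e j + (y - x)
        raised-tr {j} fj≋ ej≋ = ≋-near (≋-trans fj≋ (≋-sym (≋-move ej≋)))
          (lia 5 (λ ej fj x y n → fj :< ej ⊕ n ⇒ x :< y ⇒ [ fj :< ej ⊕ (y ⊖ x) ⊕ n ]) (e j) (f j) x y N (width j) e0<f0)
          (lia 5 (λ ej fj x y n → ej :≤ fj ⇒ y :< x ⊕ n ⇒ [ ej ⊕ (y ⊖ x) :< fj ⊕ n ]) (e j) (f j) x y N (e⊆f j) (width 0))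
        back : ∀ z → z ∈ e → z ≋ y → tr x y z ∈ e
        back z (j , ej) z≋y = subst (_∈ e) (sym (tr-snd x≋̸y z≋y)) (closed-≤ ce (0 , refl) (≋-move z≋y)
          (lia 3 (λ x y z → x :< y ⇒ z :≤ x ⇒ [ z ⊕ (x ⊖ y) :≤ x ]) x y z e0<f0 (subst (_≤ x) ej (dec-mono≤ de {0} {j} ℕ.z≤n))))
        moves : Moves x y e f
        moves j = case (f j ℤP.≟ e j)
          where
          case : Dec (f j ≡ e j) → (Movable x y e j × f j ≡ tr x y (e j)) ⊎ ((e j ≋ x → tr x y (e j) ∈ e) × f j ≡ e j)
          case (no ne) = inj₁ ((ej≋x , λ m → ℤP.<⇒≱ (ℤP.≤∧≢⇒< (e⊆f j) (λ h → ne (sym h))) (e-below j (subst (_∈ e) (sym fj≡) m) ℤP.≤-refl)) , fj≡)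
            where
            r : Raised j
            r = go (raised? j)
              where
              go : Dec (Raised j) → Raised j
              go (yes r) = r
              go (no ¬r) = ⊥-elim (ne (trans (sym (g≡f j)) (g-kept ¬r)))
            ej≋x : e j ≋ x
            ej≋x = ≋-trans (proj₂ r) (≋-sym e0≋u)
            fj≡ : f j ≡ tr x y (e j)
            fj≡ = trans (raised-tr (proj₁ r) ej≋x) (sym (tr-fst ej≋x))
          case (yes eq) = inj₂ (into , eq)
            where
            into : e j ≋ x → tr x y (e j) ∈ e
            into ej≋x with closed-≤ cf {y} {e j + (y - x)} (0 , refl) (≋-move ej≋x)
                          (lia 3 (λ x y z → z :≤ x ⇒ [ z ⊕ (y ⊖ x) :≤ y ]) x y (e j) (dec-mono≤ de {0} {j} ℕ.z≤n))
            ... | l , fl = subst (_∈ e) (sym (tr-fst ej≋x)) (case' (f l ℤP.≟ e l))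
              where
              case' : Dec (f l ≡ e l) → e j + (y - x) ∈ e
              case' (yes eq') = l , trans (sym eq') fl
              case' (no ne) = ⊥-elim (ne (subst (λ m → f m ≡ e m) (sym l≡j) eq))
                where
                r : Raised l
                r = go (raised? l)
                  where
                  go : Dec (Raised l) → Raised l
                  go (yes r) = r
                  go (no ¬r) = ⊥-elim (ne (trans (sym (g≡f l)) (g-kept ¬r)))
                l≡j : l ≡ j
                l≡j = dec-inj de (lia 5 (λ el ej fl x y → fl :≡ el ⊕ (y ⊖ x) ⇒ fl :≡ ej ⊕ (y ⊖ x) ⇒ [ el :≡ ej ]) (e l) (e j) (f l) x y
                  (raised-tr (proj₁ r) (≋-trans (proj₂ r) (≋-sym e0≋u))) fl)

  -- Cyclically decreasing words

  Letter : Word n → ℤ → Set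
  Letter [] z = ⊥
  Letter (c ∷ a) z = z ≋ ⌜ c ⌝ ⊎ Letter a z

  letter? : ∀ a z → Dec (Letter a z)
  letter? [] z = no (λ ())
  letter? (c ∷ a) z = case (z ≋? ⌜ c ⌝) (letter? a z)
    where
    case : Dec (z ≋ ⌜ c ⌝) → Dec (Letter a z) → Dec (Letter (c ∷ a) z)
    case (yes p) _ = yes (inj₁ p)
    case (no p) (yes q) = yes (inj₂ q)
    case (no p) (no q) = no (λ { (inj₁ x) → p x ; (inj₂ y) → q y })

  letter-≋ : ∀ a {z w} → z ≋ w → Letter a z → Letter a w
  letter-≋ (c ∷ a) h (inj₁ p) = inj₁ (≋-trans (≋-sym h) p)
  letter-≋ (c ∷ a) h (inj₂ p) = inj₂ (letter-≋ a h p)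

  CD : Word n → Set
  CD [] = ⊤
  CD (c ∷ a) = ¬ Letter a ⌜ c ⌝ × ¬ Letter a (⌜ c ⌝ + + 1) × CD a

  -- The cyclically decreasing element with letter set P moves z one down if z - 1 ∈ P, and otherwise up to the next integer outside P.
  data Shift (P : ℤ → Set) (z : ℤ) : ℤ → Set where
    left : P (z - + 1) → Shift P z (z - + 1)
    carry : ∀ {m} → ¬ P (z - + 1) → z ≤ m → (∀ w → z ≤ w → w < m → P w) → ¬ P m → Shift P z m

  shift-unique : ∀ {P z x y} → Shift P z x → Shift P z y → x ≡ y
  shift-unique (left _) (left _) = refl
  shift-unique (left p) (carry q _ _ _) = ⊥-elim (q p)
  shift-unique (carry q _ _ _) (left p) = ⊥-elim (q p)
  shift-unique {x = x} {y} (carry _ l f p) (carry _ l' f' p') with ℤP.<-cmp x y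
  ... | tri< lt _ _ = ⊥-elim (p (f' x l lt))
  ... | tri≈ _ e _ = e
  ... | tri> _ _ gt = ⊥-elim (p' (f y l' gt))

  shift-cong : ∀ {P Q z x} → (∀ w → P w ⇔ Q w) → Shift P z x → Shift Q z x
  shift-cong h (left p) = left (Equivalence.to (h _) p)
  shift-cong h (carry p l f q) = carry (λ x → p (Equivalence.from (h _) x)) l (λ w a b → Equivalence.to (h w) (f w a b)) (λ x → q (Equivalence.from (h _) x))

  -- Neither c nor c + 1 is a letter of `a`. So a left step, which lands on a letter, is untouched
  -- by `s c`; a carry ending in class c is prolonged by one; a carry ending in class c + 1 has
  -- length zero, its predecessor being no letter, and becomes a left step.
  run-shift : ∀ a → CD a → ∀ z → Shift (Letter a) z (run a z)
  run-shift [] _ z = carry (λ ()) ℤP.≤-refl (λ w l g → ⊥-elim (ℤP.<⇒≱ g l)) (λ ())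
  run-shift (c ∷ a) (c∉ , c+1∉ , cd) z = extend (run-shift a cd z)
    where
    ¬c : ∀ {w} → Letter a w → ¬ w ≋ ⌜ c ⌝
    ¬c l h = c∉ (letter-≋ a h l)
    ¬c+1 : ∀ {w} → Letter a w → ¬ w ≋ ⌜ c ⌝ + + 1
    ¬c+1 l h = c+1∉ (letter-≋ a h l)
    extend : ∀ {x} → Shift (Letter a) z x → Shift (Letter (c ∷ a)) z (s c x)
    extend (left p) = subst (Shift _ z) (sym (s-off {c} (¬c p) (¬c+1 p))) (left (inj₂ p))
    extend (carry {m} p l f q) = case (m ≋? ⌜ c ⌝) (m ≋? ⌜ c ⌝ + + 1) (ℤP.<-cmp z m)
      where
      case : Dec (m ≋ ⌜ c ⌝) → Dec (m ≋ ⌜ c ⌝ + + 1) → Tri (z < m) (z ≡ m) (m < z) → Shift (Letter (c ∷ a)) z (s c m)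
      case _ _ (tri> _ _ gt) = ⊥-elim (ℤP.<⇒≱ gt l)
      case (yes h) _ t = subst (Shift _ z) (sym (s-up {c} h)) (carry (nopred t) (lia 2 (λ z m → z :≤ m ⇒ [ z :≤ m ⊕ #1 ]) z m l) all (λ { (inj₁ k) → ≋̸-suc (≋-trans h (≋-sym k)) ; (inj₂ k) → ¬c+1 k (≋-+ (+ 1) h) }))
        where
        nopred : Tri (z < m) (z ≡ m) (m < z) → ¬ Letter (c ∷ a) (z - + 1)
        nopred _ (inj₂ k) = p k
        nopred (tri< lt _ _) (inj₁ k) = ¬c+1 (f z ℤP.≤-refl lt) (≋-suc k)
        nopred (tri≈ _ e _) (inj₁ k) = ≋̸-suc (≋-trans (≋-sym h) (subst (_≋ ⌜ c ⌝ + + 1) e (≋-suc k)))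
        nopred (tri> _ _ gt) _ = ℤP.<⇒≱ gt l
        all : ∀ w → z ≤ w → w < m + + 1 → Letter (c ∷ a) w
        all w a≤ b< with ℤP.<-cmp w m
        ... | tri< lt _ _ = inj₂ (f w a≤ lt)
        ... | tri≈ _ e _ = inj₁ (≋-trans (≡⇒≋ e) h)
        ... | tri> _ _ gt = ⊥-elim (lia 2 (λ w m → m :< w ⇒ w :< m ⊕ #1 ⇒ [ ⊥ₐ ]) w m gt b<)
      case (no _) (yes h) (tri≈ _ refl _) = subst (Shift _ z) (sym (s-down {c} h)) (left (inj₁ (≋-pred h)))
      case (no _) (yes h) (tri< lt _ _) = ⊥-elim (¬c (f (m - + 1) (lia 2 (λ z m → z :< m ⇒ [ z :≤ m ⊖ #1 ]) z m lt) (lia 1 (λ m → [ m ⊖ #1 :< m ]) m)) (≋-pred h))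
      case (no h) (no h') t = subst (Shift _ z) (sym (s-off {c} h h')) (carry (nopred t) l (λ w x y → inj₂ (f w x y)) (λ { (inj₁ k) → h k ; (inj₂ k) → q k }))
        where
        nopred : Tri (z < m) (z ≡ m) (m < z) → ¬ Letter (c ∷ a) (z - + 1)
        nopred _ (inj₂ k) = p k
        nopred (tri< lt _ _) (inj₁ k) = ¬c+1 (f z ℤP.≤-refl lt) (≋-suc k)
        nopred (tri≈ _ e _) (inj₁ k) = h' (subst (_≋ ⌜ c ⌝ + + 1) e (≋-suc k))
        nopred (tri> _ _ gt) _ = ℤP.<⇒≱ gt l

  cd-run : ∀ {a b} → CD a → CD b → (∀ z → Letter a z ⇔ Letter b z) → ∀ z → run a z ≡ run b z
  cd-run {a} {b} ca cb h z = shift-unique (shift-cong h (run-shift a ca z)) (run-shift b cb z)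

  sucMod-≋ : ∀ i → ⌜ sucMod i ⌝ ≋ ⌜ i ⌝ + + 1
  sucMod-≋ = go n refl
    where
    go : ∀ m → m ≡ n → (i : Fin m) → + toℕ (sucMod i) ≋ + toℕ i + + 1
    go (suc m) refl i = subst (λ w → + w ≋ + toℕ i + + 1) (sym (FP.toℕ-fromℕ< (m%n<n k (suc m))))
      (≋-sym (mk (+ (k / suc m)) (trans (sym (+suc (toℕ i))) (trans (cong +_ (m≡m%n+[m/n]*n k (suc m))) (cong (λ w → + (k % suc m) + w) (ℤP.pos-* (k / suc m) (suc m)))))))
      where k = suc (toℕ i)

  letter⇒∈ : ∀ {a c z} → z ≋ ⌜ c ⌝ → Letter a z → c ∈w a
  letter⇒∈ {d ∷ a} {c} h (inj₁ p) = F.zero , ⌜⌝-inj (≋-trans (≋-sym p) h)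
  letter⇒∈ {d ∷ a} h (inj₂ p) with letter⇒∈ {a} h p
  ... | i , e = F.suc i , e

  ∈⇒letter : ∀ {a c z} → z ≋ ⌜ c ⌝ → c ∈w a → Letter a z
  ∈⇒letter {d ∷ a} h (F.zero , e) = inj₁ (≋-trans h (≡⇒≋ (cong ⌜_⌝ (sym e))))
  ∈⇒letter {d ∷ a} h (F.suc i , e) = inj₂ (∈⇒letter h (i , e))

  Ordered : Word n → Set
  Ordered a = ∀ i → sucMod i ∈w a → i ∈w a → Precedes (sucMod i) i a

  all≢ : ∀ {c : Fin n} {a : Word n} → All (λ d → c ≢ d) a → ¬ (c ∈w a)
  all≢ (p ∷ ps) (F.zero , e) = p (sym e)
  all≢ (p ∷ ps) (F.suc i , e) = all≢ ps (i , e)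

  all≢⁻¹ : ∀ {c : Fin n} (a : Word n) → ¬ (c ∈w a) → All (λ d → c ≢ d) a
  all≢⁻¹ [] h = []
  all≢⁻¹ (d ∷ a) h = (λ e → h (F.zero , sym e)) ∷ all≢⁻¹ a (λ { (i , e) → h (F.suc i , e) })

  ordered⇒CD : ∀ a → Unique a → Ordered a → CD a
  ordered⇒CD [] _ _ = tt
  ordered⇒CD (c ∷ a) (c∉ ∷ u) o = (λ l → all≢ c∉ (letter⇒∈ ≋-refl l)) , after , ordered⇒CD a u tail
    where
    after : ¬ Letter a (⌜ c ⌝ + + 1)
    after l with o c (∈⇒letter⁻ l) (F.zero , refl)
      where
      ∈⇒letter⁻ : Letter a (⌜ c ⌝ + + 1) → sucMod c ∈w (c ∷ a)
      ∈⇒letter⁻ l with letter⇒∈ {a} {sucMod c} (≋-sym (sucMod-≋ c)) l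
      ... | i , e = F.suc i , e
    ... | p , F.zero , () , _
    ... | p , F.suc q , _ , _ , e = all≢ c∉ (q , e)
    tail : Ordered a
    tail i (j , ej) (k , ek) with o i (F.suc j , ej) (F.suc k , ek)
    ... | F.zero , q , _ , e , _ = ⊥-elim (all≢ c∉ (j , trans ej (sym e)))
    ... | F.suc p , F.zero , () , _
    ... | F.suc p , F.suc q , ℕ.s≤s lt , e , e' = p , q , lt , e , e'

  CD⇒unique : ∀ a → CD a → Unique a
  CD⇒unique [] _ = []
  CD⇒unique (c ∷ a) (c∉ , _ , cd) = all≢⁻¹ a (λ m → c∉ (∈⇒letter ≋-refl m)) ∷ CD⇒unique a cd

  CD⇒ordered : ∀ a → CD a → Ordered a
  CD⇒ordered [] _ i (() , _) _
  CD⇒ordered (c ∷ a) (_ , c+1∉ , cd) i (F.zero , e) (F.zero , e') = ⊥-elim (≋̸-suc (≋-trans (≡⇒≋ (cong ⌜_⌝ (trans (sym e') e))) (sucMod-≋ i)))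
  CD⇒ordered (c ∷ a) (_ , c+1∉ , cd) i (F.zero , e) (F.suc k , e') = F.zero , F.suc k , ℕ.s≤s ℕ.z≤n , e , e'
  CD⇒ordered (c ∷ a) (_ , c+1∉ , cd) i (F.suc j , e) (F.zero , refl) = ⊥-elim (c+1∉ (∈⇒letter (≋-sym (sucMod-≋ c)) (j , e)))
  CD⇒ordered (c ∷ a) (_ , c+1∉ , cd) i (F.suc j , e) (F.suc k , e') with CD⇒ordered a cd i (j , e) (k , e')
  ... | p , q , lt , x , y = F.suc p , F.suc q , ℕ.s≤s lt , x , y

  -- Cyclically decreasing words written on a window of consecutive integers.

  offset-≤ : ∀ lo j → lo ≤ lo + + j
  offset-≤ lo j = lia 2 (λ l j → #0 :≤ j ⇒ [ l :≤ l ⊕ j ]) lo (+ j) (ℤ.+≤+ ℕ.z≤n)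

  offset-< : ∀ lo j → lo + + j < lo + + suc j
  offset-< lo j = ℤP.+-monoʳ-< lo (ℤ.+<+ ℕP.≤-refl)

  offset-gap : ∀ lo j {w} → lo + + j < w → w < lo + + suc j → ⊥
  offset-gap lo j {w} = lia 4 (λ w l j j' → j' :≡ j ⊕ #1 ⇒ l ⊕ j :< w ⇒ w :< l ⊕ j' ⇒ [ ⊥ₐ ]) w lo (+ j) (+ suc j) (+suc j)

  InWindow : ℤ → ℕ → (ℤ → Set) → ℤ → Set
  InWindow lo j P z = ∃[ w ] (lo ≤ w × w < lo + + j × z ≋ w × P w)

  Filled : ℤ → ℕ → (ℤ → Set) → Set
  Filled lo j P = ∀ w → lo ≤ w → w < lo + + j → P w

  FirstGap : ℤ → ℕ → (ℤ → Set) → Set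
  FirstGap lo j P = ∃[ x ] (lo ≤ x × x < lo + + j × ¬ P x × (∀ w → lo ≤ w → w < x → P w))

  module _ (P : ℤ → Set) (P? : ∀ z → Dec (P z)) (lo : ℤ) where

    extendBy : ℤ → ∀ {A : Set} → Dec A → Word n → Word n
    extendBy z (yes _) a = residue z ∷ a
    extendBy z (no _) a = a

    -- Larger entries are put in front, so the word reads the window downwards. This order is
    -- cyclically decreasing as long as the window does not close up.
    window : ℕ → Word n
    window zero = []
    window (suc j) = extendBy (lo + + j) (P? (lo + + j)) (window j)

    window-letter : ∀ j z → Letter (window j) z ⇔ InWindow lo j P z
    window-letter zero z = mk⇔ (λ ()) (λ { (w , l , g , _) → ℤP.<⇒≱ (subst (w <_) (ℤP.+-identityʳ lo) g) l })
    window-letter (suc j) z = go (P? (lo + + j))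
      where
      ih = window-letter j z
      go : (d : Dec (P (lo + + j))) → Letter (extendBy (lo + + j) d (window j)) z ⇔ InWindow lo (suc j) P z
      go (yes p) = mk⇔ to from
        where
        to : z ≋ ⌜ residue (lo + + j) ⌝ ⊎ Letter (window j) z → InWindow lo (suc j) P z
        to (inj₁ h) = lo + + j , offset-≤ lo j
          , offset-< lo j , ≋-trans h (residue-≋ _) , p
        to (inj₂ l) with Equivalence.to ih l
        ... | w , a , b , r = w , a , ℤP.<-trans b (offset-< lo j) , r
        from : InWindow lo (suc j) P z → z ≋ ⌜ residue (lo + + j) ⌝ ⊎ Letter (window j) z
        from (w , a , b , h , pw) with ℤP.<-cmp w (lo + + j)
        ... | tri< lt _ _ = inj₂ (Equivalence.from ih (w , a , lt , h , pw))
        ... | tri≈ _ e _ = inj₁ (≋-trans h (≋-trans (≡⇒≋ e) (≋-sym (residue-≋ _))))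
        ... | tri> _ _ gt = ⊥-elim (offset-gap lo j gt b)
      go (no ¬p) = mk⇔ to from
        where
        to : Letter (window j) z → InWindow lo (suc j) P z
        to l with Equivalence.to ih l
        ... | w , a , b , r = w , a , ℤP.<-trans b (offset-< lo j) , r
        from : InWindow lo (suc j) P z → Letter (window j) z
        from (w , a , b , h , pw) with ℤP.<-cmp w (lo + + j)
        ... | tri< lt _ _ = Equivalence.from ih (w , a , lt , h , pw)
        ... | tri≈ _ refl _ = ⊥-elim (¬p pw)
        ... | tri> _ _ gt = ⊥-elim (offset-gap lo j gt b)

    -- With at most n - 1 places, neither `lo + j` nor its successor can wrap round to an earlier
    -- entry.
    window-CD : ∀ j → j ℕ.< n → CD (window j)
    window-CD zero _ = tt
    window-CD (suc j) j<n = go (P? (lo + + j))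
      where
      lt : + j + + 1 < N
      lt = subst (_< N) (+suc j) (ℤ.+<+ j<n)
      ih = window-CD j (ℕP.<-trans ℕP.≤-refl j<n)
      out : ∀ {z d} → d ≡ + 0 ⊎ d ≡ + 1 → z ≋ lo + + j + d → ¬ Letter (window j) z
      out {z} {d} hd h l with Equivalence.to (window-letter j z) l
      ... | w , a , b , zw , _ = ℤP.<⇒≱ (near hd) (≋-gap (≋-trans (≋-sym zw) h) (far hd))
        where
        far : d ≡ + 0 ⊎ d ≡ + 1 → w < lo + + j + d
        far (inj₁ refl) = lia 3 (λ w l j → w :< l ⊕ j ⇒ [ w :< l ⊕ j ⊕ #0 ]) w lo (+ j) b
        far (inj₂ refl) = lia 3 (λ w l j → w :< l ⊕ j ⇒ [ w :< l ⊕ j ⊕ #1 ]) w lo (+ j) b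
        near : d ≡ + 0 ⊎ d ≡ + 1 → lo + + j + d < w + N
        near (inj₁ refl) = lia 4 (λ w l j n → l :≤ w ⇒ j ⊕ #1 :< n ⇒ [ l ⊕ j ⊕ #0 :< w ⊕ n ]) w lo (+ j) N a lt
        near (inj₂ refl) = lia 4 (λ w l j n → l :≤ w ⇒ j ⊕ #1 :< n ⇒ [ l ⊕ j ⊕ #1 :< w ⊕ n ]) w lo (+ j) N a lt
      go : (d : Dec (P (lo + + j))) → CD (extendBy (lo + + j) d (window j))
      go (yes p) = out (inj₁ refl) (≋-trans (residue-≋ (lo + + j)) (≡⇒≋ (sym (ℤP.+-identityʳ (lo + + j))))) , out (inj₂ refl) (≋-+ (+ 1) (residue-≋ (lo + + j))) , ih
      go (no _) = ih

    window-≤ : ∀ j → length (window j) ℕ.≤ j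
    window-≤ zero = ℕ.z≤n
    window-≤ (suc j) = go (P? (lo + + j))
      where
      go : (d : Dec (P (lo + + j))) → length (extendBy (lo + + j) d (window j)) ℕ.≤ suc j
      go (yes _) = ℕ.s≤s (window-≤ j)
      go (no _) = ℕP.m≤n⇒m≤1+n (window-≤ j)

    window-gap : ∀ j → Filled lo j P ⊎ FirstGap lo j P
    window-gap zero = inj₁ (λ w l g → ⊥-elim (ℤP.<⇒≱ (subst (w <_) (ℤP.+-identityʳ lo) g) l))
    window-gap (suc j) = go (window-gap j) (P? (lo + + j))
      where
      go : Filled lo j P ⊎ FirstGap lo j P → Dec (P (lo + + j)) →
           Filled lo (suc j) P ⊎ FirstGap lo (suc j) P
      go (inj₂ (x , a , b , r)) _ = inj₂ (x , a , ℤP.<-trans b (offset-< lo j) , r)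
      go (inj₁ f) (no ¬p) = inj₂ (lo + + j , offset-≤ lo j
        , offset-< lo j , ¬p , f)
      go (inj₁ f) (yes p) = inj₁ all
        where
        all : Filled lo (suc j) P
        all w a b with ℤP.<-cmp w (lo + + j)
        ... | tri< lt _ _ = f w a lt
        ... | tri≈ _ refl _ = p
        ... | tri> _ _ gt = ⊥-elim (offset-gap lo j gt b)

    window-full : ∀ j → Filled lo j P → length (window j) ≡ j
    window-full zero f = refl
    window-full (suc j) f = go (P? (lo + + j))
      where
      go : (d : Dec (P (lo + + j))) → length (extendBy (lo + + j) d (window j)) ≡ suc j
      go (yes _) = cong suc (window-full j (λ w a b → f w a (ℤP.<-trans b (offset-< lo j))))
      go (no ¬p) = ⊥-elim (¬p (f _ (offset-≤ lo j)
        (offset-< lo j)))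

  window-same : ∀ {P Q} (P? : ∀ z → Dec (P z)) (Q? : ∀ z → Dec (Q z)) lo j → (∀ w → lo ≤ w → w < lo + + j → P w ⇔ Q w) → length (window P P? lo j) ≡ length (window Q Q? lo j)
  window-same P? Q? lo zero h = refl
  window-same {P} {Q} P? Q? lo (suc j) h = go (P? (lo + + j)) (Q? (lo + + j))
    where
    last = h (lo + + j) (offset-≤ lo j) (offset-< lo j)
    ih = window-same P? Q? lo j (λ w a b → h w a (ℤP.<-trans b (offset-< lo j)))
    go : (d : Dec (P (lo + + j))) (d' : Dec (Q (lo + + j))) → length (extendBy P P? lo (lo + + j) d (window P P? lo j)) ≡ length (extendBy Q Q? lo (lo + + j) d' (window Q Q? lo j))
    go (yes _) (yes _) = cong suc ih
    go (no _) (no _) = ih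
    go (yes p) (no q) = ⊥-elim (q (Equivalence.to last p))
    go (no p) (yes q) = ⊥-elim (p (Equivalence.from last q))

  window-remove : ∀ {P Q} (P? : ∀ z → Dec (P z)) (Q? : ∀ z → Dec (Q z)) lo j x → lo ≤ x → x < lo + + j → P x → ¬ Q x →
    (∀ w → w ≢ x → lo ≤ w → w < lo + + j → P w ⇔ Q w) → length (window P P? lo j) ≡ suc (length (window Q Q? lo j))
  window-remove P? Q? lo zero x a b _ _ _ = ⊥-elim (ℤP.<⇒≱ (subst (x <_) (ℤP.+-identityʳ lo) b) a)
  window-remove {P} {Q} P? Q? lo (suc j) x a b px qx h = go (ℤP.<-cmp x (lo + + j)) (P? (lo + + j)) (Q? (lo + + j))
    where
    last : lo + + j ≢ x → P (lo + + j) ⇔ Q (lo + + j)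
    last ne = h (lo + + j) ne (offset-≤ lo j) (offset-< lo j)
    go : Tri (x < lo + + j) (x ≡ lo + + j) (lo + + j < x) → (d : Dec (P (lo + + j))) (d' : Dec (Q (lo + + j))) →
      length (extendBy P P? lo (lo + + j) d (window P P? lo j)) ≡ suc (length (extendBy Q Q? lo (lo + + j) d' (window Q Q? lo j)))
    go (tri> _ _ gt) _ _ = ⊥-elim (offset-gap lo j gt b)
    go (tri≈ _ refl _) (yes _) (no _) = cong suc (window-same P? Q? lo j (λ w a b → h w (λ e → ℤP.<-irrefl e b) a (ℤP.<-trans b (offset-< lo j))))
    go (tri≈ _ refl _) (no p) _ = ⊥-elim (p px)
    go (tri≈ _ refl _) (yes _) (yes q) = ⊥-elim (qx q)
    go (tri< lt ne _) (yes _) (yes _) = cong suc (window-remove P? Q? lo j x a lt px qx (λ w n a b → h w n a (ℤP.<-trans b (offset-< lo j))))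
    go (tri< lt ne _) (no _) (no _) = window-remove P? Q? lo j x a lt px qx (λ w n a b → h w n a (ℤP.<-trans b (offset-< lo j)))
    go (tri< lt ne _) (yes p) (no q) = ⊥-elim (q (Equivalence.to (last (λ e → ne (sym e))) p))
    go (tri< lt ne _) (no p) (yes q) = ⊥-elim (p (Equivalence.from (last (λ e → ne (sym e))) q))

  -- Letter sets

  -- Moving the class of the first bead upwards sends distinct beads to distinct beads of `e'`, none
  -- lower than before. If `e' i < e i`, the first i + 1 of them would lie among the first i beads
  -- of `e'`, against the pigeonhole principle.
  dominance : ∀ {e e' x y} → Decreasing e → Closed e → Decreasing e' → e 0 ≡ x → x < y → ¬ x ≋ y →
    (∀ z → z ∈ e' ⇔ tr x y z ∈ e) → e ⊆ e'
  dominance {e} {e'} {x} {y} de ce de' refl x<y ¬xy h i = ℤP.≮⇒≥ impossible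
    where
    mv : Seq
    mv = move x y e
    mvs : Moves x y e mv
    mvs = move-moves x y e de
    back : ∀ z → z ∈ e → z ≋ y → tr x y z ∈ e
    back z (j , ej) z≋y = subst (_∈ e) (sym (tr-snd ¬xy z≋y)) (closed-≤ ce (0 , refl) (≋-move z≋y)
      (lia 3 (λ x y z → x :< y ⇒ z :≤ x ⇒ [ z ⊕ (x ⊖ y) :≤ x ]) x y z x<y (subst (_≤ x) ej (dec-mono≤ de {0} {j} ℕ.z≤n))))
    σ : ∀ j → mv j ∈ e'
    σ j = Equivalence.from (h (mv j)) (Equivalence.to (moves-range ¬xy mvs back (mv j)) (j , refl))
    mv≥ : ∀ j → e j ≤ mv j
    mv≥ j with mvs j
    ... | inj₁ ((p , _) , eq) = ℤP.≤-trans (lia 3 (λ x y z → x :< y ⇒ [ z :≤ z ⊕ (y ⊖ x) ]) x y (e j) x<y) (ℤP.≤-reflexive (sym (trans eq (tr-fst p))))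
    ... | inj₂ (_ , eq) = ℤP.≤-reflexive (sym eq)
    mv-inj : ∀ j k → mv j ≡ mv k → j ≡ k
    mv-inj j k eq with mvs j | mvs k
    ... | inj₁ (_ , ej) | inj₁ (_ , ek) = dec-inj de (trans (sym (tr-invol ¬xy (e j))) (trans (cong (tr x y) (trans (sym ej) (trans eq ek))) (tr-invol ¬xy (e k))))
    ... | inj₁ ((_ , q) , ej) | inj₂ (_ , ek) = ⊥-elim (q (k , trans (sym ek) (trans (sym eq) ej)))
    ... | inj₂ (_ , ej) | inj₁ ((_ , q) , ek) = ⊥-elim (q (j , trans (sym ej) (trans eq ek)))
    ... | inj₂ (_ , ej) | inj₂ (_ , ek) = dec-inj de (trans (sym ej) (trans eq ek))
    impossible : ¬ e' i < e i
    impossible lt with FP.pigeonhole (ℕP.n<1+n i) (λ j → fromℕ< (small j))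
      where
      small : (j : Fin (suc i)) → proj₁ (σ (toℕ j)) ℕ.< i
      small j = dec-cancel< de' (ℤP.<-≤-trans lt (ℤP.≤-trans (dec-mono≤ de (FP.toℕ≤pred[n] j)) (ℤP.≤-trans (mv≥ (toℕ j)) (ℤP.≤-reflexive (sym (proj₂ (σ (toℕ j))))))))
    ... | j , k , j<k , eq = ℕP.<-irrefl (mv-inj (toℕ j) (toℕ k) (trans (sym (proj₂ (σ (toℕ j)))) (trans (cong e' σ≡) (proj₂ (σ (toℕ k)))))) j<k
      where
      σ≡ : proj₁ (σ (toℕ j)) ≡ proj₁ (σ (toℕ k))
      σ≡ = trans (sym (FP.toℕ-fromℕ< _)) (trans (cong toℕ eq) (FP.toℕ-fromℕ< _))

  -- Serves words not yet known to raise the degree: a letter adds corners, removes corners or fixes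
  -- the set, so the result is a core in every case.
  act-letter : ∀ c {b q} → State b q → ∃[ b' ] (State b' (qact c q) × (∀ z → z ∈ b' ⇔ s c z ∈ b))
  act-letter c {b} {q} st = case (D (qact c q) ℕP.≟ suc (D q)) (removable-dec c maya)
    where
    open State st
    case : Dec (D (qact c q) ≡ suc (D q)) → Dec (HasRemovable c b) → ∃[ b' ] (State b' (qact c q) × (∀ z → z ∈ b' ⇔ s c z ∈ b))
    case (yes eq) _ = up c b , record { maya = up-maya c maya ; closed = up-closed c dec closed ad
        ; levels = ⊨-cong (λ z → ⇔-sym (up-range c dec closed ad z)) (⊨-s {_∈ b} c levels) } , up-range c dec closed ad
      where ad = addable-D {b} levels eq
    case (no _) (yes rem) = down c b , down-state c st rem , down-range c dec closed rem
    case (no ne) (no ¬rem) = b , record { maya = maya ; closed = closed ; levels = ⊨-cong (λ z → ⇔-sym (stable-range z)) (⊨-s {_∈ b} c levels) } , stable-range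
      where
      right : ∀ z → z ∈ b → z ≋ ⌜ c ⌝ → z + + 1 ∈ b
      right z (i , refl) p = case' (_∈?_ dec (b i + + 1))
        where
        case' : Dec (b i + + 1 ∈ b) → b i + + 1 ∈ b
        case' (yes m) = m
        case' (no m) = ⊥-elim (ne (D-addable {b} levels (i , p , m)))
      left' : ∀ z → z ∈ b → z ≋ ⌜ c ⌝ + + 1 → z - + 1 ∈ b
      left' z (i , refl) p = case' (_∈?_ dec (b i - + 1))
        where
        case' : Dec (b i - + 1 ∈ b) → b i - + 1 ∈ b
        case' (yes m) = m
        case' (no m) = ⊥-elim (¬rem (i , p , m))
      half : ∀ z → z ∈ b → s c z ∈ b
      half z m = go (z ≋? ⌜ c ⌝) (z ≋? ⌜ c ⌝ + + 1)
        where
        go : Dec (z ≋ ⌜ c ⌝) → Dec (z ≋ ⌜ c ⌝ + + 1) → s c z ∈ b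
        go (yes p) _ = subst (_∈ b) (sym (s-up {c} p)) (right z m p)
        go (no _) (yes p) = subst (_∈ b) (sym (s-down {c} p)) (left' z m p)
        go (no p) (no p') = subst (_∈ b) (sym (s-off {c} p p')) m
      stable-range : ∀ z → z ∈ b ⇔ s c z ∈ b
      stable-range z = mk⇔ (half z) (λ m → subst (_∈ b) (s-invol c z) (half (s c z) m))

  act-word : ∀ a {b q} → State b q → ∃[ b' ] (State b' (qacts a q) × (∀ z → z ∈ b' ⇔ run⁻¹ a z ∈ b))
  act-word [] st = _ , st , λ z → mk⇔ (λ m → m) (λ m → m)
  act-word (c ∷ a) st = let (b₁ , st₁ , r₁) = act-word a st ; (b₂ , st₂ , r₂) = act-letter c st₁ in
    b₂ , st₂ , λ z → ⇔-trans (r₂ z) (r₁ (s c z))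

  +pred : + (n ℕ.∸ 1) ≡ N - + 1
  +pred = +∸ (ℕP.≤-trans (ℕ.s≤s ℕ.z≤n) 2≤n)

  -- Letter sets avoiding lo - 1, whose cyclically decreasing word is written on the window lo … lo + n - 2.
  record Letters (lo : ℤ) (P : ℤ → Set) : Set where
    field
      letter-dec : ∀ z → Dec (P z)
      periodic : ∀ {z w} → z ≋ w → P z → P w
      free : ¬ P (lo - + 1)

    word : Word n
    word = window P letter-dec lo (n ℕ.∸ 1)

    end≡ : lo + + (n ℕ.∸ 1) ≡ lo + N - + 1
    end≡ = trans (cong (λ w → lo + w) +pred) (sym (ℤP.+-assoc lo N (- + 1)))

    end-free : ¬ P (lo + N - + 1)
    end-free p = free (periodic (≋-shift (≋-up {lo}) (lem lo N)) p)
      where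
      lem : ∀ l n → l + n - + 1 - (l - + 1) ≡ l + n - l
      lem = solve-∀

    inside : ∀ w → w < lo + N → P w → w < lo + + (n ℕ.∸ 1)
    inside w lt p = subst (w <_) (sym end≡) (ℤP.≤∧≢⇒< (lia 3 (λ w l n → w :< l ⊕ n ⇒ [ w :≤ l ⊕ n ⊖ #1 ]) w lo N lt) (λ e → end-free (subst P e p)))

    word-letters : ∀ z → Letter word z ⇔ P z
    word-letters z = mk⇔ to from
      where
      to : Letter word z → P z
      to l with Equivalence.to (window-letter P letter-dec lo (n ℕ.∸ 1) z) l
      ... | w , _ , _ , h , p = periodic (≋-sym h) p
      from : P z → Letter word z
      from p with representative z lo
      ... | w , h , a , b = Equivalence.from (window-letter P letter-dec lo (n ℕ.∸ 1) z) (w , a , inside w b p' , ≋-sym h , p')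
        where p' = periodic (≋-sym h) p

    word-CD : CD word
    word-CD = window-CD P letter-dec lo (n ℕ.∸ 1) (ℕP.≤-reflexive (ℕP.suc-pred n))

    word-shift : ∀ z → Shift P z (run word z)
    word-shift z = shift-cong word-letters (run-shift word word-CD z)

    first-free : ∃[ x ] (lo ≤ x × x < lo + N × ¬ P x × (∀ w → lo ≤ w → w < x → P w))
    first-free with window-gap P letter-dec lo (n ℕ.∸ 1)
    -- If all n - 1 places are letters, the first gap is the end of the period, congruent to
    -- `lo - 1`.
    ... | inj₁ all = lo + N - + 1 , lia 2 (λ l n → #2 :≤ n ⇒ [ l :≤ l ⊕ n ⊖ #1 ]) lo N 2≤N
          , lia 1 (λ x → [ x ⊖ #1 :< x ]) (lo + N) , end-free , λ w a b → all w a (subst (w <_) (sym end≡) b)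
    ... | inj₂ (x , a , b , r) = x , a , ℤP.<-trans (subst (x <_) end≡ b) (lia 1 (λ x → [ x ⊖ #1 :< x ]) (lo + N)) , r

  module Insert {P P' : ℤ → Set} (P? : ∀ z → Dec (P z)) (periodic : ∀ {z w} → z ≋ w → P z → P w) {lo x y : ℤ} (lo≤x : lo ≤ x) (x<y : x < y) (y<lo+N : y < lo + N)
    (below : ∀ w → lo ≤ w → w < y → P w) (¬Py : ¬ P y) (P'⇔ : ∀ z → P' z ⇔ (P z × ¬ z ≋ x)) where

    x≋̸y : ¬ x ≋ y
    x≋̸y h = lia 4 (λ x y l n → x ⊕ n :≤ y ⇒ l :≤ x ⇒ y :< l ⊕ n ⇒ [ ⊥ₐ ]) x y lo N (≋-gap h x<y) lo≤x y<lo+N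

    private
      block : ∀ {x'} → x' ≋ x → ∀ w → x' ≤ w → w < x' + (y - x) → P w
      block {x'} h w a b = periodic (≋-sym (≋-shift h (lem w x' x)))
        (below (w - x' + x) (lia 4 (λ w x' x l → l :≤ x ⇒ x' :≤ w ⇒ [ l :≤ w ⊖ x' ⊕ x ]) w x' x lo lo≤x a)
          (lia 4 (λ w x' x y → w :< x' ⊕ (y ⊖ x) ⇒ [ w ⊖ x' ⊕ x :< y ]) w x' x y b))
        where
        lem : ∀ w x' x → w - (w - x' + x) ≡ x' - x
        lem = solve-∀

      strictly : ∀ {x'} → x' ≋ x → ∀ w → x' < w → w < x' + (y - x) → ¬ w ≋ x
      strictly {x'} h w a b k = lia 6 (λ w x' x y l n → x' ⊕ n :≤ w ⇒ w :< x' ⊕ (y ⊖ x) ⇒ l :≤ x ⇒ y :< l ⊕ n ⇒ [ ⊥ₐ ]) w x' x y lo N (≋-gap (≋-trans h (≋-sym k)) a) b lo≤x y<lo+N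

      not-y : ∀ {w} → P w → ¬ w ≋ y
      not-y p h = ¬Py (periodic h p)

      P'⇒P : ∀ {w} → P' w → P w
      P'⇒P p = proj₁ (Equivalence.to (P'⇔ _) p)

    -- Only two kinds of values feel the new letter x. A carry that stopped at x now runs on to y,
    -- since x, ..., y - 1 are all letters. The value x + 1, which was carried to y, now steps left
    -- to x. Modulo n this is the transposition of x and y after the old element.
    shift-tr : ∀ {z m} → Shift P' z m → Shift P z (tr x y m)
    shift-tr {z} (left p) = subst (Shift P z) (sym (tr-off (proj₂ (Equivalence.to (P'⇔ _) p)) (not-y (P'⇒P p)))) (left (P'⇒P p))
    shift-tr {z} {m} v@(carry ¬p l f ¬q) = case (P? (z - + 1)) (z - + 1 ≋? x) (m ≋? x) (m ≋? y)
      where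
      case : Dec (P (z - + 1)) → Dec (z - + 1 ≋ x) → Dec (m ≋ x) → Dec (m ≋ y) → Shift P z (tr x y m)
      case (yes p) (no h) _ _ = ⊥-elim (¬p (Equivalence.from (P'⇔ _) (p , h)))
      case (yes p) (yes h) _ _ = subst (Shift P z) (sym (trans (tr-snd x≋̸y (≋-trans (≡⇒≋ m≡) (≋-move h))) (trans (cong (λ w → w + (x - y)) m≡) (move-back x y (z - + 1))))) (left p)
        where
        m≡ : m ≡ z - + 1 + (y - x)
        m≡ = shift-unique v (carry ¬p (lia 3 (λ x y z → x :< y ⇒ [ z :≤ z ⊖ #1 ⊕ (y ⊖ x) ]) x y z x<y)
          (λ w a b → Equivalence.from (P'⇔ w) (block h w (lia 2 (λ z w → z :≤ w ⇒ [ z ⊖ #1 :≤ w ]) z w a) b , strictly h w (lia 2 (λ z w → z :≤ w ⇒ [ z ⊖ #1 :< w ]) z w a) b))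
          (λ q → not-y (P'⇒P q) (≋-move h)))
      case (no ¬p') _ (yes h) _ = subst (Shift P z) (sym (tr-fst h)) (carry ¬p' (lia 4 (λ z m x y → z :≤ m ⇒ x :< y ⇒ [ z :≤ m ⊕ (y ⊖ x) ]) z m x y l x<y) all (λ q → not-y q (≋-move h)))
        where
        all : ∀ w → z ≤ w → w < m + (y - x) → P w
        all w a b with ≤-<-connexℤ m w
        ... | inj₁ le = block h w le b
        ... | inj₂ lt = P'⇒P (f w a lt)
      case (no ¬p') _ (no h) (yes k) = ⊥-elim (¬p' (block (≋-move k) (z - + 1) (lia 2 (λ x z → x :< z ⇒ [ x :≤ z ⊖ #1 ]) (m + (x - y)) z x'<z)
          (subst (z - + 1 <_) (sym (move-back y x m)) (lia 2 (λ z m → z :≤ m ⇒ [ z ⊖ #1 :< m ]) z m l))))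
        where
        x'<z : m + (x - y) < z
        x'<z = ℤP.≰⇒> (λ le → proj₂ (Equivalence.to (P'⇔ _) (f (m + (x - y)) le (lia 3 (λ m x y → x :< y ⇒ [ m ⊕ (x ⊖ y) :< m ]) m x y x<y))) (≋-move k))
      case (no ¬p') _ (no h) (no k) = subst (Shift P z) (sym (tr-off h k)) (carry ¬p' l (λ w a b → P'⇒P (f w a b)) (λ q → ¬q (Equivalence.from (P'⇔ _) (q , h))))

  module _ {lo : ℤ} {P P' : ℤ → Set} (L : Letters lo P) (L' : Letters lo P') {x y : ℤ} (lo≤x : lo ≤ x) (x<y : x < y) (y<lo+N : y < lo + N)
    (below : ∀ w → lo ≤ w → w < y → P w) (¬Py : ¬ P y) (P'⇔ : ∀ z → P' z ⇔ (P z × ¬ z ≋ x)) where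
    private
      module A = Letters L
      module A' = Letters L'
      module I = Insert A.letter-dec A.periodic lo≤x x<y y<lo+N below ¬Py P'⇔

    word-tr : ∀ z → run A.word z ≡ tr x y (run A'.word z)
    word-tr z = shift-unique (A.word-shift z) (I.shift-tr (A'.word-shift z))

    word⁻¹-tr : ∀ z → run⁻¹ A.word z ≡ run⁻¹ A'.word (tr x y z)
    word⁻¹-tr z = run-inj A'.word (trans (sym (tr-invol I.x≋̸y _)) (trans (cong (tr x y) (trans (sym (word-tr (run⁻¹ A.word z))) (run-run⁻¹ A.word z))) (sym (run-run⁻¹ A'.word (tr x y z)))))

    word-length : length A.word ≡ suc (length A'.word)
    word-length = window-remove A.letter-dec A'.letter-dec lo (n ℕ.∸ 1) x lo≤x (A.inside x (ℤP.<-trans x<y y<lo+N) Px) Px (λ p → proj₂ (Equivalence.to (P'⇔ x) p) ≋-refl)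
        (λ w ne a b → mk⇔ (λ p → Equivalence.from (P'⇔ w) (p , λ h → ne (≋-near h (hi w b) (lo' w a)))) (λ p → proj₁ (Equivalence.to (P'⇔ w) p)))
      where
      Px = below x lo≤x x<y
      hi : ∀ w → w < lo + + (n ℕ.∸ 1) → w < x + N
      hi w b = lia 4 (λ w l x n → w :< l ⊕ n ⊖ #1 ⇒ l :≤ x ⇒ [ w :< x ⊕ n ]) w lo x N (subst (w <_) A.end≡ b) lo≤x
      lo' : ∀ w → lo ≤ w → x < w + N
      lo' w a = lia 5 (λ w l x y n → l :≤ w ⇒ x :< y ⇒ y :< l ⊕ n ⇒ [ x :< w ⊕ n ]) w lo x y N a x<y y<lo+N

  -- The full letter set and R(n - 1, λ).

  module Full (c : Seq) (dc : Decreasing c) (cc : Closed c) where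

    Full : ℤ → Set
    Full z = ¬ z ≋ c 0 - + 1

    full : Letters (c 0) Full
    full = record { letter-dec = λ z → ¬? (z ≋? c 0 - + 1) ; periodic = λ h p q → p (≋-trans h q) ; free = λ p → p ≋-refl }

    open Letters full

    full-length : length word ≡ n ℕ.∸ 1
    full-length = window-full Full letter-dec (c 0) (n ℕ.∸ 1) (λ w a b h → lia 3 (λ w l n → l ⊖ #1 ⊕ n :≤ w ⇒ w :< l ⊕ n ⊖ #1 ⇒ [ ⊥ₐ ]) w (c 0) N
      (≋-gap (≋-sym h) (lia 2 (λ l w → l :≤ w ⇒ [ l ⊖ #1 :< w ]) (c 0) w a)) (subst (w <_) end≡ b))

    shift1 : ∀ {z} → z - + 1 ≋ c 0 - + 1 → z ≋ c 0
    shift1 {z} h = ≋-shift h (lem z (c 0))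
      where
      lem : ∀ z l → z - l ≡ z - + 1 - (l - + 1)
      lem = solve-∀

    run-top : ∀ {z} → z ≋ c 0 → run word z ≡ z + N - + 1
    run-top {z} h = shift-unique (word-shift z) (carry (λ p → p h') (lia 2 (λ z n → #2 :≤ n ⇒ [ z :≤ z ⊕ n ⊖ #1 ]) z N 2≤N)
       (λ w a b k → lia 3 (λ w l n → l ⊖ #1 ⊕ n :≤ w ⇒ w :< l ⊕ n ⊖ #1 ⇒ [ ⊥ₐ ]) w z N (≋-gap (≋-trans h' (≋-sym k)) (lia 2 (λ l w → l :≤ w ⇒ [ l ⊖ #1 :< w ]) z w a)) b)
       (λ p → p (≋-trans (≋-shift (≋-up {z}) (lem z N)) h')))
      where
      h' : z - + 1 ≋ c 0 - + 1
      h' = ≋-+ (- + 1) h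
      lem : ∀ l n → l + n - + 1 - (l - + 1) ≡ l + n - l
      lem = solve-∀

    run-other : ∀ {z} → ¬ z ≋ c 0 → run word z ≡ z - + 1
    run-other {z} h = shift-unique (word-shift z) (left (λ k → h (shift1 k)))

    -- All classes move one to the left, except that of the first bead, which also rises by a
    -- period. As a set this is a shift by -1 with the one new bead `c 0 + N - 1`: a new bottom row
    -- pushes the other rows up.
    full-range : ∀ {r : Seq} → r 0 ≡ c 0 + N - + 1 → (∀ i → r (suc i) ≡ c i - + 1) → ∀ z → z ∈ r ⇔ run⁻¹ word z ∈ c
    full-range {r} r0 rs z = mk⇔ to from
      where
      image : ∀ i → run word (c i) ∈ r
      image i = go i (c i ≋? c 0)
        where
        go : ∀ i → Dec (c i ≋ c 0) → run word (c i) ∈ r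
        go i (no h) = suc i , trans (rs i) (sym (run-other h))
        go zero (yes h) = 0 , trans r0 (sym (run-top h))
        go (suc i) (yes h) with closed-≤ cc {c 0} {c (suc i) + N} (0 , refl) (≋-trans ≋-up h) (≋-gap h (dec-mono< dc {0} (ℕ.s≤s ℕ.z≤n)))
        ... | j , e = suc j , trans (rs j) (trans (cong (λ w → w - + 1) e) (sym (run-top h)))
      preimage : ∀ j → ∃[ w ] (w ∈ c × run word w ≡ r j)
      preimage zero = c 0 , (0 , refl) , trans (run-top ≋-refl) (sym r0)
      preimage (suc j) = go (c j ≋? c 0)
        where
        go : Dec (c j ≋ c 0) → ∃[ w ] (w ∈ c × run word w ≡ r (suc j))
        go (no h) = c j , (j , refl) , trans (run-other h) (sym (rs j))
        go (yes h) = c j - N , cc j , trans (run-top (≋-trans ≋-down h)) (trans (lem (c j) N) (sym (rs j)))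
          where
          lem : ∀ c n → c - n + n - + 1 ≡ c - + 1
          lem = solve-∀
      to : z ∈ r → run⁻¹ word z ∈ c
      to (j , e) with preimage j
      ... | w , m , e' = subst (_∈ c) (trans (sym (run⁻¹-run word w)) (cong (run⁻¹ word) (trans e' e))) m
      from : run⁻¹ word z ∈ c → z ∈ r
      from (i , e) = subst (_∈ r) (trans (cong (run word) e) (run-run⁻¹ word z)) (image i)

  Rop-head : ∀ l → β (Rop n l) 0 ≡ β l 0 + N - + 1
  Rop-head l = trans (cong (λ w → w - + 0) (trans (ℤP.pos-+ (row l 1) (n ℕ.∸ 1)) (cong (λ w → + row l 1 + w) +pred))) (lem (+ row l 1) N)
    where
    lem : ∀ r n → r + (n - + 1) - + 0 ≡ r - + 0 + n - + 1
    lem = solve-∀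

  Rop-tail : ∀ l i → β (Rop n l) (suc i) ≡ β l i - + 1
  Rop-tail l i = trans (cong (λ w → + row l (suc i) - w) (+suc i)) (lem (+ row l (suc i)) (+ i))
    where
    lem : ∀ r i → r - (i + + 1) ≡ r - i - + 1
    lem = solve-∀

  -- Strong strips are weak strips

  row<⇒β< : ∀ {l m} → row l 1 ℕ.< row m 1 → β l 0 < β m 0
  row<⇒β< h = ℤP.+-monoˡ-< (- + 0) (ℤ.+<+ h)

  β<⇒row< : ∀ {l m} → β l 0 < β m 0 → row l 1 ℕ.< row m 1
  β<⇒row< {l} {m} h = ℤP.drop‿+<+ (subst₂ _<_ (ℤP.+-identityʳ (+ row l 1)) (ℤP.+-identityʳ (+ row m 1)) h)

  module Strong⇒Weak {l ql} (core : Core l ql) (ch : ℕ → Partition) (k : ℕ) (l⊆ : l ⊆ₚ ch 0) (end : ch k ≡ Rop n l)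
    (steps : ∀ t → t ℕ.< k → BruhatCover n (ch t) (ch (suc t)) × row (ch t) 1 ℕ.< row (ch (suc t)) 1) where

    private
      c = β l
      lo = c 0
      dc = β-dec (Core.part core)
      cc = Core.closed core
      open Full c dc cc using (Full; full; full-length; full-range)

      included : ∀ t → t ℕ.< k → β (ch t) ⊆ β (ch (suc t))
      included t lt = ⊆ₚ⇒⊆ (proj₁ (proj₂ (proj₂ (proj₁ (steps t lt)))))

      lower : ∀ t → t ℕ.≤ k → c ⊆ β (ch t)
      lower zero _ = ⊆ₚ⇒⊆ l⊆
      lower (suc t) le i = ℤP.≤-trans (lower t (ℕP.<⇒≤ le) i) (included t le i)

      upper : ∀ s t → s ℕ.+ t ≡ k → β (ch t) ⊆ β (Rop n l)
      upper zero t refl i = ℤP.≤-reflexive (cong (λ m → β m i) end)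
      upper (suc s) t e i = ℤP.≤-trans (included t (ℕP.≤-trans (ℕ.s≤s (ℕP.m≤n+m t s)) (ℕP.≤-reflexive e)) i) (upper s (suc t) (trans (ℕP.+-suc s t) e) i)

      head< : ∀ s t → s ℕ.+ t ≡ k → β (ch t) 0 < lo + N
      head< s t e = ℤP.≤-<-trans (ℤP.≤-trans (upper s t e 0) (ℤP.≤-reflexive (Rop-head l))) (lia 1 (λ x → [ x ⊖ #1 :< x ]) (lo + N))

    -- The invariant of the descent from `Rop n l`, s covers below it. `below` and `top` make the
    -- first bead of `ch t` the first integer of the window outside the letter set, which is what
    -- `word-tr` asks of y when the next letter is deleted.
    record Stage (t s : ℕ) : Set₁ where
      field
        {P} : ℤ → Set
        letters : Letters lo P
      open Letters letters using (word) public
      field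
        range : ∀ z → z ∈ β (ch t) ⇔ run⁻¹ word z ∈ c
        below : ∀ w → lo ≤ w → w < β (ch t) 0 → P w
        top : ¬ P (β (ch t) 0)
        len : length word ℕ.+ s ≡ n ℕ.∸ 1

    private
      down-one : ∀ s t → suc s ℕ.+ t ≡ k → Stage (suc t) s → Stage t (suc s)
      down-one s t e st = record
        { letters = letters' ; range = range' ; below = λ w a b → below w a (ℤP.<-trans b x<y) , away w a b
        ; top = λ p → proj₂ p ≋-refl ; len = trans (ℕP.+-suc _ s) (trans (cong (ℕ._+ s) (sym wl)) len) }
        where
        open Stage st
        t<k : t ℕ.< k
        t<k = ℕP.≤-trans (ℕ.s≤s (ℕP.m≤n+m t s)) (ℕP.≤-reflexive e)
        e' : s ℕ.+ suc t ≡ k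
        e' = trans (ℕP.+-suc s t) e
        x = β (ch t) 0
        y = β (ch (suc t)) 0
        x<y : x < y
        x<y = row<⇒β< {ch t} {ch (suc t)} (proj₂ (steps t t<k))
        lo≤x : lo ≤ x
        lo≤x = lower t (ℕP.<⇒≤ t<k) 0
        away : ∀ w → lo ≤ w → w < x → ¬ w ≋ x
        away w a b h = lia 4 (λ w l x n → w ⊕ n :≤ x ⇒ l :≤ w ⇒ x :< l ⊕ n ⇒ [ ⊥ₐ ]) w lo x N (≋-gap h b) a (head< (suc s) t e)
        -- The cover is the transposition of the first beads x < y, and undoing it amounts to
        -- deleting the letter x.
        P' : ℤ → Set
        P' z = P z × ¬ z ≋ x
        letters' : Letters lo P'
        letters' = record { letter-dec = λ z → Letters.letter-dec letters z ×-dec ¬? (z ≋? x)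
          ; periodic = λ h p → Letters.periodic letters h (proj₁ p) , λ k → proj₂ p (≋-trans h k)
          ; free = λ p → Letters.free letters (proj₁ p) }
        wl = word-length letters letters' lo≤x x<y (head< s (suc t) e') below top (λ z → mk⇔ (λ p → p) (λ p → p))
        cover : BruhatCover n (ch t) (ch (suc t))
        cover = proj₁ (steps t t<k)
        d = proj₁ (proj₂ (proj₂ (proj₂ cover)))
        degs = proj₂ (proj₂ (proj₂ (proj₂ cover)))
        E : ∃[ q ] (Core (ch t) q × D q ≡ d)
        E = Deg⇒core (proj₁ degs)
        F : ∃[ q ] (Core (ch (suc t)) q × D q ≡ suc d)
        F = Deg⇒core (proj₂ degs)
        f<c : ∀ i → β (ch (suc t)) (suc i) < c i
        f<c i = ℤP.≤-<-trans (ℤP.≤-trans (upper s (suc t) e' (suc i)) (ℤP.≤-reflexive (Rop-tail l i))) (lia 1 (λ x → [ x ⊖ #1 :< x ]) (c i))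
        module S = Sandwich {c} {β (ch t)} {β (ch (suc t))} dc cc (core⇒state (proj₁ (proj₂ E))) (core⇒state (proj₁ (proj₂ F)))
          (lower t (ℕP.<⇒≤ t<k)) (included t t<k) f<c (head< s (suc t) e')
        module C = S.Cover x<y (trans (proj₂ (proj₂ F)) (cong suc (sym (proj₂ (proj₂ E)))))
        range' : ∀ z → z ∈ β (ch t) ⇔ run⁻¹ (Letters.word letters') z ∈ c
        range' z = subst₂ (λ u v → u ∈ β (ch t) ⇔ v ∈ c) (tr-invol C.x≋̸y z) run≡ (⇔-trans (⇔-sym (C.cover-range (tr x y z))) (range (tr x y z)))
          where
          run≡ : run⁻¹ word (tr x y z) ≡ run⁻¹ (Letters.word letters') z
          run≡ = trans (word⁻¹-tr letters letters' lo≤x x<y (head< s (suc t) e') below top (λ z → mk⇔ (λ p → p) (λ p → p)) (tr x y z))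
            (cong (run⁻¹ (Letters.word letters')) (tr-invol C.x≋̸y z))

    stage : ∀ s t → s ℕ.+ t ≡ k → Stage t s
    stage zero t refl = record
      { letters = full
      ; range = λ z → subst (λ m → z ∈ β m ⇔ run⁻¹ (Letters.word full) z ∈ c) (sym end) (full-range (Rop-head l) (Rop-tail l) z)
      ; below = λ w a b h → lia 3 (λ w l n → l ⊖ #1 ⊕ n :≤ w ⇒ w :< l ⊕ n ⊖ #1 ⇒ [ ⊥ₐ ]) w lo N
          (≋-gap (≋-sym h) (lia 2 (λ l w → l :≤ w ⇒ [ l ⊖ #1 :< w ]) lo w a)) (subst (w <_) head≡ b)
      ; top = λ p → Letters.end-free full (subst Full head≡ p)
      ; len = trans (ℕP.+-identityʳ _) full-length }
      where
      head≡ : β (ch k) 0 ≡ lo + N - + 1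
      head≡ = trans (cong (λ m → β m 0) end) (Rop-head l)
    stage (suc s) t e = down-one s t e (stage s (suc t) (trans (ℕP.+-suc s t) e))

    -- At the bottom of the chain the bead sets agree, hence the heights. The strip's degree
    -- equation together with `length word + k = n - 1` shows that the word raises `D` by its full
    -- length, so it acts by adding corners.
    weak : ∀ {qm} → Core (ch 0) qm → D qm ℕ.+ k ≡ (n ℕ.∸ 1) ℕ.+ D ql →
      ∃[ a ] (CD a × Acted a l ql × ch 0 ≡ actP a l × length a ℕ.+ k ≡ n ℕ.∸ 1)
    weak {qm} cm deg = word , Letters.word-CD letters , acted , range-ext (Core.part cm) (Core.part (Acted.core acted)) (λ z → ⇔-trans (range z) (⇔-sym (Acted.range acted z))) , len
      where
      open Stage (stage k 0 (ℕP.+-identityʳ k))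
      q≡ : qacts word ql ≡ qm
      q≡ = ⊨-unique (⊨-cong (λ z → ⇔-sym (range z)) (qacts-⊨ {_∈ c} word (Core.heights core))) (Core.heights cm)
      acted : Acted word l ql
      acted = degree⇒acted word core (trans (cong D q≡) (ℕP.+-cancelʳ-≡ k (D qm) (length word ℕ.+ D ql)
        (trans deg (trans (cong (ℕ._+ D ql) (sym len)) (trans (ℕP.+-assoc (length word) k (D ql)) (trans (cong (length word ℕ.+_) (ℕP.+-comm k (D ql))) (sym (ℕP.+-assoc (length word) (D ql) k))))))))

  acted-⊆ : ∀ a {l q} → Core l q → Acted a l q → β l ⊆ β (actP a l)
  acted-⊆ [] r A i = ℤP.≤-refl
  acted-⊆ (c ∷ a) {l} r A i = step (wordAct⇒acted (c ∷ a) r (Acted.act A)) (Acted.act A)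
    where
    step : _ → WordAct n (c ∷ a) l (actP (c ∷ a) l) → β l i ≤ β (actP (c ∷ a) l) i
    step _ (k , w , sa) with wordAct⇒acted a r w
    ... | refl , A' = ℤP.≤-trans (acted-⊆ a r A' i) (ℤP.≤-trans (up-≥ c (β-dec part) i) (ℤP.≤-reflexive (sym (sAdd-β c part i))))
      where part = Core.part (Acted.core A')

  acted-tail : ∀ c a {l q} → Core l q → Acted (c ∷ a) l q → Acted a l q × HasAddable c (β (actP a l))
  acted-tail c a {l} r A = step (Acted.act A)
    where
    step : WordAct n (c ∷ a) l (actP (c ∷ a) l) → Acted a l _ × HasAddable c (β (actP a l))
    step (k , w , sa) with wordAct⇒acted a r w
    ... | refl , A' = A' , SAct-addable (Core.part (Acted.core A')) sa

  -- The first bead of a core cannot be filled from below, so its residue minus one is not a letter.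
  first-bead-free : ∀ a {l q} → Core l q → CD a → Acted a l q → ¬ Letter a (β l 0 - + 1)
  first-bead-free (c ∷ a) {l} r (c∉ , c+1∉ , cd) A = go (acted-tail c a r A)
    where
    lo = β l 0
    go : Acted a l _ × HasAddable c (β (actP a l)) → ¬ Letter (c ∷ a) (lo - + 1)
    go (A' , _) (inj₂ k) = first-bead-free a r cd A' k
    -- Suppose c is the residue of `lo - 1`. Then `a` fixes the bead lo, so by closedness the
    -- addable bead x of class c lies above lo. But x comes from a bead g of `l` with g ≤ lo, and a
    -- carry from g to x would have to cross lo, which is no letter of `a`.
    go (A' , (i , x≋c , x+1∉)) (inj₁ h) = ℤP.<⇒≱ g≤lo' (dec-mono≤ (β-dec (Core.part r)) {0} {proj₁ g∈} ℕ.z≤n)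
      where
      E = β (actP a l)
      ih = first-bead-free a r cd A'
      lo≋ : lo ≋ ⌜ c ⌝ + + 1
      lo≋ = ≋-suc h
      lo∉ : ¬ Letter a lo
      lo∉ k = c+1∉ (letter-≋ a lo≋ k)
      run-lo : run a lo ≡ lo
      run-lo = shift-unique (run-shift a cd lo) (carry ih ℤP.≤-refl (λ w p q → ⊥-elim (ℤP.<⇒≱ q p)) lo∉)
      lo∈E : lo ∈ E
      lo∈E = Equivalence.from (Acted.range A' lo) (subst (_∈ β l) (trans (sym (run⁻¹-run a lo)) (cong (run⁻¹ a) run-lo)) (0 , refl))
      x = E i
      lo<x : lo < x
      lo<x = lia 4 (λ l x n y → l ⊕ n :≤ x ⊕ #1 ⇒ #2 :≤ n ⇒ [ l :< x ]) lo x N (+ 0)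
        (≋-gap (≋-trans lo≋ (≋-sym (≋-+ (+ 1) x≋c))) (ℤP.≰⇒> (λ le → x+1∉ (closed-≤ (Core.closed (Acted.core A')) lo∈E (≋-trans (≋-+ (+ 1) x≋c) (≋-sym lo≋)) le)))) 2≤N
      g = run⁻¹ a x
      g∈ : g ∈ β l
      g∈ = Equivalence.to (Acted.range A' x) (i , refl)
      rg : Shift (Letter a) g x
      rg = subst (Shift (Letter a) g) (run-run⁻¹ a x) (run-shift a cd g)
      g≤lo' : lo < β l (proj₁ g∈)
      g≤lo' = subst (lo <_) (sym (proj₂ g∈)) (case rg)
        where
        case : Shift (Letter a) g x → lo < g
        case v = ℤP.≰⇒> (λ le → no-jump le v lo<x)
          where
          no-jump : ∀ {x} → g ≤ lo → Shift (Letter a) g x → lo < x → ⊥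
          no-jump le (left _) lt = lia 2 (λ g l → g :≤ l ⇒ l :< g ⊖ #1 ⇒ [ ⊥ₐ ]) g lo le lt
          no-jump le (carry _ _ f _) lt = lo∉ (f lo le lt)

  unique-length : ∀ {a b} → CD a → CD b → (∀ z → Letter a z ⇔ Letter b z) → length a ≡ length b
  unique-length {a} {b} ca cb h = ↭-length (∼bag⇒↭ (unique∧set⇒bag (CD⇒unique a ca) (CD⇒unique b cb)
    (λ {c} → mk⇔ (conv a b (λ z → Equivalence.to (h z))) (conv b a (λ z → Equivalence.from (h z))))))
    where
    into : ∀ {c} a → c ∈ₗ a → Letter a ⌜ c ⌝
    into (d ∷ a) (here refl) = inj₁ ≋-refl
    into (d ∷ a) (there m) = inj₂ (into a m)
    out : ∀ {c} a → Letter a ⌜ c ⌝ → c ∈ₗ a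
    out (d ∷ a) (inj₁ k) = here (⌜⌝-inj k)
    out (d ∷ a) (inj₂ k) = there (out a k)
    conv : ∀ {c} a b → (∀ z → Letter a z → Letter b z) → c ∈ₗ a → c ∈ₗ b
    conv a b f m = out b (f _ (into a m))

  -- Weak strips are strong strips

  at-tabulate : ∀ {A : Set} (d : A) (g : ℕ → A) {m x} → x ℕ.< m → at d (tabulate {n = m} (λ i → g (toℕ i))) x ≡ g x
  at-tabulate d g {suc m} {zero} _ = refl
  at-tabulate d g {suc m} {suc x} (ℕ.s≤s lt) = at-tabulate d (λ i → g (suc i)) lt

  module Weak⇒Strong (al : Word n) (Aal : Acted al [] ground) where

    private
      l = actP al []
      ql = qacts al ground
      core = Acted.core Aal
      c = β l
      lo = c 0
      dc = β-dec (Core.part core)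
      cc = Core.closed core
      open Full c dc cc using (full; full-length; full-range)

    Deg-of : ∀ {a} → Acted a l ql → Deg n (actP a l) (length a ℕ.+ length al)
    Deg-of {a} A = subst₂ (Deg n) (LP.foldr-++ sAdd [] a al) (LP.length-++ a) (acted-Deg (acted-++ a al core-[] Aal A))

    module _ {P : ℤ → Set} (L : Letters lo P) where
      open Letters L

      -- The bead lo is carried to the first gap x, and a bead at most lo cannot be carried beyond
      -- x, which is no letter.
      first-bead : Acted word l ql → β (actP word l) 0 ≡ proj₁ first-free
      first-bead A = ℤP.≤-antisym (E0≤ (subst (Shift P g) (run-run⁻¹ word (E 0)) (word-shift g))) x≤
        where
        x = proj₁ first-free
        lo≤x = proj₁ (proj₂ first-free)
        ¬Px = proj₁ (proj₂ (proj₂ (proj₂ first-free)))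
        below = proj₂ (proj₂ (proj₂ (proj₂ first-free)))
        E = β (actP word l)
        run-lo : run word lo ≡ x
        run-lo = shift-unique (word-shift lo) (carry free lo≤x below ¬Px)
        x∈ : x ∈ E
        x∈ = Equivalence.from (Acted.range A x) (subst (_∈ c) (trans (sym (run⁻¹-run word lo)) (cong (run⁻¹ word) run-lo)) (0 , refl))
        x≤ : x ≤ E 0
        x≤ = subst (_≤ E 0) (proj₂ x∈) (dec-mono≤ (β-dec (Core.part (Acted.core A))) {0} {proj₁ x∈} ℕ.z≤n)
        g = run⁻¹ word (E 0)
        g≤lo : g ≤ lo
        g≤lo with Equivalence.to (Acted.range A (E 0)) (0 , refl)
        ... | j , e = subst (_≤ lo) e (dec-mono≤ dc {0} {j} ℕ.z≤n)
        E0≤ : ∀ {m} → Shift P g m → m ≤ x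
        E0≤ (left _) = lia 3 (λ g l x → g :≤ l ⇒ l :≤ x ⇒ [ g ⊖ #1 :≤ x ]) g lo x g≤lo lo≤x
        E0≤ (carry _ _ f _) = ℤP.≮⇒≥ (λ lt → ¬Px (f x (ℤP.≤-trans g≤lo lo≤x) lt))

      full-case : proj₁ first-free ≡ lo + N - + 1 → ∀ z → Letter word z ⇔ Letter (Letters.word full) z
      full-case x≡ z = ⇔-trans (word-letters z) (⇔-trans (mk⇔ to from) (⇔-sym (Letters.word-letters full z)))
        where
        to : P z → ¬ z ≋ lo - + 1
        to p h = free (periodic h p)
        from : ¬ z ≋ lo - + 1 → P z
        from h with representative z lo
        ... | w , w≋z , a , b = periodic w≋z (proj₂ (proj₂ (proj₂ (proj₂ first-free))) w a (subst (w <_) (sym x≡)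
            (ℤP.≤∧≢⇒< (lia 3 (λ w l n → w :< l ⊕ n ⇒ [ w :≤ l ⊕ n ⊖ #1 ]) w lo N b) (λ e → h (≋-trans (≋-sym w≋z) (≋-trans (≡⇒≋ e) (≋-shift (≋-up {lo}) (lem lo N))))))))
          where
          lem : ∀ l n → l + n - + 1 - (l - + 1) ≡ l + n - l
          lem = solve-∀

      full-len : proj₁ first-free ≡ lo + N - + 1 → length word ≡ n ℕ.∸ 1
      full-len x≡ = trans (unique-length word-CD (Letters.word-CD full) (full-case x≡)) full-length

    module _ {P : ℤ → Set} (L : Letters lo P) where
      open Letters L

      module Extend (x< : proj₁ first-free < lo + N - + 1) where
        x = proj₁ first-free
        private
          lo≤x = proj₁ (proj₂ first-free)
          ¬Px = proj₁ (proj₂ (proj₂ (proj₂ first-free)))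
          below-x = proj₂ (proj₂ (proj₂ (proj₂ first-free)))

        P⁺ : ℤ → Set
        P⁺ z = P z ⊎ z ≋ x

        L⁺ : Letters lo P⁺
        L⁺ = record { letter-dec = λ z → dec⊎ (letter-dec z) (z ≋? x)
          ; periodic = λ { h (inj₁ p) → inj₁ (periodic h p) ; h (inj₂ k) → inj₂ (≋-trans (≋-sym h) k) }
          ; free = λ { (inj₁ p) → free p
                     ; (inj₂ k) → lia 3 (λ l x n → l ⊖ #1 ⊕ n :≤ x ⇒ x :< l ⊕ n ⊖ #1 ⇒ [ ⊥ₐ ]) lo x N
                         (≋-gap k (lia 2 (λ l w → l :≤ w ⇒ [ l ⊖ #1 :< w ]) lo x lo≤x)) x< } }
          where
          dec⊎ : ∀ {A B : Set} → Dec A → Dec B → Dec (A ⊎ B)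
          dec⊎ (yes a) _ = yes (inj₁ a)
          dec⊎ (no _) (yes b) = yes (inj₂ b)
          dec⊎ (no a) (no b) = no λ { (inj₁ p) → a p ; (inj₂ p) → b p }

        word⁺ = Letters.word L⁺
        y = proj₁ (Letters.first-free L⁺)
        private
          y<lo+N = proj₁ (proj₂ (proj₂ (Letters.first-free L⁺)))
          ¬P⁺y = proj₁ (proj₂ (proj₂ (proj₂ (Letters.first-free L⁺))))
          below-y = proj₂ (proj₂ (proj₂ (proj₂ (Letters.first-free L⁺))))

        x<y : x < y
        x<y = case (ℤP.<-cmp x y)
          where
          case : Tri (x < y) (x ≡ y) (y < x) → x < y
          case (tri< lt _ _) = lt
          case (tri≈ _ e _) = ⊥-elim (¬P⁺y (inj₂ (≡⇒≋ (sym e))))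
          case (tri> _ _ gt) = ⊥-elim (¬P⁺y (inj₁ (below-x y (proj₁ (proj₂ (Letters.first-free L⁺))) gt)))

        P⇔ : ∀ z → P z ⇔ (P⁺ z × ¬ z ≋ x)
        P⇔ z = mk⇔ (λ p → inj₁ p , λ h → ¬Px (periodic h p)) (λ { (inj₁ p , _) → p ; (inj₂ k , h) → ⊥-elim (h k) })

        longer : length word⁺ ≡ suc (length word)
        longer = word-length L⁺ L lo≤x x<y y<lo+N below-y ¬P⁺y P⇔

        module _ (A : Acted word l ql) where
          private
            E = β (actP word l)
            dE = β-dec (Core.part (Acted.core A))
            cE = Core.closed (Acted.core A)
            E0 : E 0 ≡ x
            E0 = first-bead L A
            x≋̸y : ¬ x ≋ y
            x≋̸y h = lia 4 (λ x y l n → x ⊕ n :≤ y ⇒ l :≤ x ⇒ y :< l ⊕ n ⇒ [ ⊥ₐ ]) x y lo N (≋-gap h x<y) lo≤x y<lo+N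

            via-tr : ∀ {b : Seq} → (∀ z → z ∈ b ⇔ run⁻¹ word⁺ z ∈ c) → ∀ z → z ∈ b ⇔ tr x y z ∈ E
            via-tr h z = ⇔-trans (h z) (subst (λ w → w ∈ c ⇔ tr x y z ∈ E) (sym (word⁻¹-tr L⁺ L lo≤x x<y y<lo+N below-y ¬P⁺y P⇔ z)) (⇔-sym (Acted.range A (tr x y z))))

            -- The longer word is not yet known to add corners, so its result is first taken as a
            -- mere bead set. This set dominates `E` and differs from it, so its degree is larger;
            -- as one letter was added, the increase is exactly one and the word acts.
            new = act-word word⁺ (core⇒state core)
            E' = proj₁ new
            sE' = proj₁ (proj₂ new)
            rE' = via-tr (proj₂ (proj₂ new))

            raised : D (qacts word ql) ℕ.< D (qacts word⁺ ql)
            raised = case (degree-mono _ (core⇒state (Acted.core A)) sE' refl (dominance dE cE (State.dec sE') E0 x<y x≋̸y rE'))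
              where
              y∈ : y ∈ E'
              y∈ = Equivalence.from (rE' y) (0 , trans E0 (sym (trans (tr-snd x≋̸y ≋-refl) (lem x y))))
                where
                lem : ∀ x y → y + (x - y) ≡ x
                lem = solve-∀
              case : (∀ i → E i ≡ E' i) ⊎ D (qacts word ql) ℕ.< D (qacts word⁺ ql) → D (qacts word ql) ℕ.< D (qacts word⁺ ql)
              case (inj₂ lt) = lt
              case (inj₁ eq) = ⊥-elim (ℤP.<⇒≱ x<y (subst₂ _≤_ (proj₂ y∈) (trans (sym (eq 0)) E0) (dec-mono≤ (State.dec sE') {0} {proj₁ y∈} ℕ.z≤n)))

          acted⁺ : Acted word⁺ l ql
          acted⁺ = degree⇒acted word⁺ core (ℕP.≤-antisym (D-qacts word⁺ ql)
            (ℕP.≤-trans (ℕP.≤-reflexive (cong (ℕ._+ D ql) longer)) (ℕP.≤-trans (ℕP.≤-reflexive (cong suc (sym (Acted.degree A)))) raised)))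

          cover : BruhatCover n (actP word l) (actP word⁺ l) × row (actP word l) 1 ℕ.< row (actP word⁺ l) 1
          cover = (core⇒IsCore (Acted.core A) , core⇒IsCore (Acted.core acted⁺)
              , ⊆⇒⊆ₚ {actP word l} {actP word⁺ l} (dominance dE cE (β-dec (Core.part (Acted.core acted⁺))) E0 x<y x≋̸y (via-tr (Acted.range acted⁺)))
              , length word ℕ.+ length al , Deg-of A , subst (Deg n _) (cong (ℕ._+ length al) longer) (Deg-of acted⁺))
            , β<⇒row< {actP word l} {actP word⁺ l} (subst₂ _<_ (sym E0) (sym (first-bead L⁺ acted⁺)) x<y)

    Chain : ℕ → Partition → Set
    Chain k m = Σ (ℕ → Partition) (λ ch → ch 0 ≡ m × ch k ≡ Rop n l × (∀ t → t ℕ.< k → BruhatCover n (ch t) (ch (suc t)) × row (ch t) 1 ℕ.< row (ch (suc t)) 1))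

    extend-chain : ∀ {k m m'} → BruhatCover n m m' × row m 1 ℕ.< row m' 1 → Chain k m' → Chain (suc k) m
    extend-chain {k} {m} cov (ch , refl , e , st) = ch' , refl , e , st'
      where
      ch' : ℕ → Partition
      ch' zero = m
      ch' (suc t) = ch t
      st' : ∀ t → t ℕ.< suc k → BruhatCover n (ch' t) (ch' (suc t)) × row (ch' t) 1 ℕ.< row (ch' (suc t)) 1
      st' zero _ = cov
      st' (suc t) (ℕ.s≤s lt) = st t lt

    first-free-cmp : ∀ {P} (L : Letters lo P) → proj₁ (Letters.first-free L) ≡ lo + N - + 1 ⊎ proj₁ (Letters.first-free L) < lo + N - + 1
    first-free-cmp L = case (ℤP.<-cmp x (lo + N - + 1))
      where
      x = proj₁ (Letters.first-free L)
      case : Tri (x < lo + N - + 1) (x ≡ lo + N - + 1) (lo + N - + 1 < x) → x ≡ lo + N - + 1 ⊎ x < lo + N - + 1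
      case (tri< lt _ _) = inj₂ lt
      case (tri≈ _ e _) = inj₁ e
      case (tri> _ _ gt) = ⊥-elim (lia 3 (λ x l n → l ⊕ n ⊖ #1 :< x ⇒ x :< l ⊕ n ⇒ [ ⊥ₐ ]) x lo N gt (proj₁ (proj₂ (proj₂ (Letters.first-free L)))))

    -- Here k counts the letters missing from the full set; each link of the chain inserts the first
    -- missing one.
    chain : ∀ k {P} (L : Letters lo P) → Acted (Letters.word L) l ql → length (Letters.word L) ℕ.+ k ≡ n ℕ.∸ 1 → Chain k (actP (Letters.word L) l)
    chain zero L A len = (λ _ → actP (Letters.word L) l) , refl , is-Rop (first-free-cmp L) , λ _ ()
      where
      open Letters L
      is-Rop : proj₁ first-free ≡ lo + N - + 1 ⊎ proj₁ first-free < lo + N - + 1 → actP word l ≡ Rop n l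
      is-Rop (inj₁ e) = range-ext (Core.part (Acted.core A)) (Rop-part (Core.part core)) (λ z → ⇔-trans (Acted.range A z)
        (⇔-trans (subst (λ w → run⁻¹ word z ∈ c ⇔ w ∈ c) (run⁻¹-cong {word} {Letters.word full} (cd-run word-CD (Letters.word-CD full) (full-case L e)) z) (mk⇔ (λ m → m) (λ m → m)))
          (⇔-sym (full-range (Rop-head l) (Rop-tail l) z))))
      -- An earlier gap would admit an n-th letter in a window of n - 1 places.
      is-Rop (inj₂ lt) = ⊥-elim (ℕP.1+n≰n (ℕP.≤-trans (ℕP.≤-reflexive (trans (cong suc (trans (sym len) (ℕP.+-identityʳ _))) (sym (Extend.longer L lt))))
        (window-≤ (Extend.P⁺ L lt) (Letters.letter-dec (Extend.L⁺ L lt)) lo (n ℕ.∸ 1))))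
    chain (suc k) L A len = go (first-free-cmp L)
      where
      open Letters L
      go : proj₁ first-free ≡ lo + N - + 1 ⊎ proj₁ first-free < lo + N - + 1 → Chain (suc k) (actP word l)
      go (inj₁ e) = ⊥-elim (ℕP.m≢1+m+n (n ℕ.∸ 1) (trans (sym len) (trans (cong (ℕ._+ suc k) (full-len L e)) (ℕP.+-suc (n ℕ.∸ 1) k))))
      go (inj₂ lt) = extend-chain (Extend.cover L lt A) (chain k (Extend.L⁺ L lt) (Extend.acted⁺ L lt A)
        (trans (cong (ℕ._+ k) (Extend.longer L lt)) (trans (sym (ℕP.+-suc (length word) k)) len)))

    strong : ∀ {a k} → CD a → Acted a l ql → length a ℕ.+ k ≡ n ℕ.∸ 1 → HorizontalStrongStrip n k l (actP a l)
    strong {a} {k} cd A len = ⊆⇒⊆ₚ {l} {actP a l} (acted-⊆ a core A)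
      , (length al , length a ℕ.+ length al , acted-Deg Aal , Deg-of A
          , trans (sym (ℕP.+-assoc k (length a) (length al))) (cong (ℕ._+ length al) (trans (ℕP.+-comm k (length a)) len)))
      , chv , trans (at-ch (ℕ.s≤s ℕ.z≤n)) (trans ch0 same) , trans (at-ch ℕP.≤-refl) chk
      , λ t lt → subst₂ (λ u v → BruhatCover n u v × row u 1 ℕ.< row v 1) (sym (at-ch (ℕP.m≤n⇒m≤1+n lt))) (sym (at-ch (ℕ.s≤s lt))) (st t lt)
      where
      -- The letters of `a` may come in another order than in the window, but cyclically decreasing
      -- words with the same letter set give the same map and have the same length.
      L : Letters lo (Letter a)
      L = record { letter-dec = letter? a ; periodic = letter-≋ a ; free = first-bead-free a core cd A }
      open Letters L
      run≡ : ∀ z → run word z ≡ run a z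
      run≡ = cd-run word-CD cd word-letters
      len≡ : length word ≡ length a
      len≡ = unique-length word-CD cd word-letters
      AW : Acted word l ql
      AW = degree⇒acted word core (trans (cong D (qacts-run {_∈ c} {ql} {word} {a} (Core.heights core) run≡)) (trans (Acted.degree A) (cong (ℕ._+ D ql) (sym len≡))))
      same : actP word l ≡ actP a l
      same = range-ext (Core.part (Acted.core AW)) (Core.part (Acted.core A)) (λ z → ⇔-trans (Acted.range AW z)
        (⇔-trans (subst (λ w → run⁻¹ word z ∈ c ⇔ w ∈ c) (run⁻¹-cong {word} {a} run≡ z) (mk⇔ (λ m → m) (λ m → m))) (⇔-sym (Acted.range A z))))
      C = chain k L AW (trans (cong (ℕ._+ k) len≡) len)
      ch = proj₁ C
      ch0 = proj₁ (proj₂ C)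
      chk = proj₁ (proj₂ (proj₂ C))
      st = proj₂ (proj₂ (proj₂ C))
      chv : Vec Partition (suc k)
      chv = tabulate (λ i → ch (toℕ i))
      at-ch : ∀ {x} → x ℕ.< suc k → at [] chv x ≡ ch x
      at-ch = at-tabulate [] ch

  -- Factorizations and countertableaux

  r∸ : ∀ {y r} → suc y ℕ.≤ r → r ℕ.∸ y ≡ suc (r ℕ.∸ suc y)
  r∸ {zero} {suc r} _ = refl
  r∸ {suc y} {suc r} (ℕ.s≤s h) = r∸ {y} {r} h

  vec-ext : ∀ {A : Set} (d : A) {m} (u v : Vec A m) → (∀ x → x ℕ.< m → at d u x ≡ at d v x) → u ≡ v
  vec-ext d V.[] V.[] h = refl
  vec-ext d (a V.∷ u) (b V.∷ v) h = cong₂ V._∷_ (h 0 (ℕ.s≤s ℕ.z≤n)) (vec-ext d u v (λ x lt → h (suc x) (ℕ.s≤s lt)))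

  tot : (ℕ → Word n) → ℕ → Word n
  tot as zero = []
  tot as (suc x) = as x ++ tot as x

  tot-snoc : ∀ as x → tot as (suc x) ≡ tot (λ i → as (suc i)) x ++ as 0
  tot-snoc as zero = LP.++-identityʳ (as 0)
  tot-snoc as (suc x) = trans (cong (as (suc x) ++_) (tot-snoc as x)) (sym (LP.++-assoc (as (suc x)) (tot (λ i → as (suc i)) x) (as 0)))

  concat-reverse : ∀ {r} (ws : Vec (Word n) r) → L.concat (L.reverse (V.toList ws)) ≡ tot (at [] ws) r
  concat-reverse V.[] = refl
  concat-reverse {suc r} (w V.∷ ws) = trans (cong L.concat (LP.unfold-reverse w (V.toList ws)))
    (trans (sym (LP.concat-++ (L.reverse (V.toList ws)) (w ∷ [])))
      (trans (cong₂ _++_ (concat-reverse ws) (LP.++-identityʳ w)) (sym (tot-snoc (at [] (w V.∷ ws)) r))))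

  tot-length : ∀ {r} (α : Vec ℕ r) as → (∀ x → x ℕ.< r → length (as x) ≡ at 0 α x) → length (tot as r) ≡ V.sum α
  tot-length V.[] as h = refl
  tot-length {suc r} (a V.∷ α) as h = trans (cong length (tot-snoc as r)) (trans (LP.length-++ (tot (λ i → as (suc i)) r))
    (trans (cong₂ ℕ._+_ (tot-length α (λ i → as (suc i)) (λ x lt → h (suc x) (ℕ.s≤s lt))) (h 0 (ℕ.s≤s ℕ.z≤n))) (ℕP.+-comm (V.sum α) a)))

  tot-run : ∀ r {as bs} → (∀ x → x ℕ.< r → ∀ z → run (as x) z ≡ run (bs x) z) → ∀ z → run (tot as r) z ≡ run (tot bs r) z
  tot-run zero h z = refl
  tot-run (suc r) {as} {bs} h z = trans (run-++ (as r) (tot as r) z) (trans (cong (run (as r)) (tot-run r (λ x lt → h x (ℕP.m≤n⇒m≤1+n lt)) z))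
    (trans (h r ℕP.≤-refl _) (sym (run-++ (bs r) (tot bs r) z))))

  acted-split : ∀ a b {l q} → Core l q → Acted (a ++ b) l q → Acted b l q × Acted a (actP b l) (qacts b q)
  acted-split [] b r A = A , acted-[] (Acted.core A)
  acted-split (c ∷ a) b {l} r A = step (acted-tail c (a ++ b) r A)
    where
    step : Acted (a ++ b) l _ × HasAddable c (β (actP (a ++ b) l)) → _
    step (A' , ad) = proj₁ ih , acted-∷ (proj₂ ih) (subst (λ m → HasAddable c (β m)) (LP.foldr-++ sAdd l a b) ad)
      where ih = acted-split a b r A'

  acted-same : ∀ {a b l q} → Core l q → Acted a l q → (∀ z → run b z ≡ run a z) → length b ≡ length a → Acted b l q × actP b l ≡ actP a l
  acted-same {a} {b} {l} {q} r A h len = B , range-ext (Core.part (Acted.core B)) (Core.part (Acted.core A)) (λ z → ⇔-trans (Acted.range B z)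
      (⇔-trans (subst (λ w → run⁻¹ b z ∈ β l ⇔ w ∈ β l) (run⁻¹-cong {b} {a} h z) (mk⇔ (λ m → m) (λ m → m))) (⇔-sym (Acted.range A z))))
    where
    B : Acted b l q
    B = degree⇒acted b r (trans (cong D (qacts-run {_∈ β l} {q} {b} {a} (Core.heights r) h)) (trans (Acted.degree A) (cong (ℕ._+ D q) (sym len))))

  acted-Reduced : ∀ {a l q} → Core l q → Acted a l q → Reduced a
  acted-Reduced {a} {l} {q} r A b e = ℕP.+-cancelʳ-≤ (D q) (length a) (length b) (ℕP.≤-trans (ℕP.≤-reflexive (trans (sym (Acted.degree A))
    (cong D (sym (qacts-run {_∈ β l} {q} {b} {a} (Core.heights r) (eval⇒run {b} {a} e)))))) (D-qacts b q))

  -- sAdd fixes a core without addable corners of the given residue, so only the degree certifies that a word acts.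
  actP-bound : ∀ b {l q} → Core l q → ∃[ q' ] (Core (actP b l) q' × D q' ℕ.≤ length b ℕ.+ D q × (D q' ≡ length b ℕ.+ D q → Acted b l q))
  actP-bound [] {l} {q} r = q , r , ℕP.≤-refl , λ _ → acted-[] r
  actP-bound (c ∷ b) {l} {q} r = step (actP-bound b r)
    where
    m = actP b l
    step : ∃[ q' ] (Core m q' × D q' ℕ.≤ length b ℕ.+ D q × (D q' ≡ length b ℕ.+ D q → Acted b l q)) →
      ∃[ q'' ] (Core (sAdd c m) q'' × D q'' ℕ.≤ suc (length b ℕ.+ D q) × (D q'' ≡ suc (length b ℕ.+ D q) → Acted (c ∷ b) l q))
    step (q' , r' , le , f) = case (D (qact c q') ℕP.≟ suc (D q'))
      where
      case : Dec (D (qact c q') ≡ suc (D q')) → ∃[ q'' ] (Core (sAdd c m) q'' × D q'' ℕ.≤ suc (length b ℕ.+ D q) × (D q'' ≡ suc (length b ℕ.+ D q) → Acted (c ∷ b) l q))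
      case (yes e) = qact c q' , core-sAdd c r' ad , subst (ℕ._≤ suc (length b ℕ.+ D q)) (sym e) (ℕ.s≤s le)
          , λ e' → acted-∷ (f (ℕP.suc-injective (trans (sym e) e'))) ad
        where ad = addable-D {β m} (Core.heights r') e
      case (no ne) = q' , subst (λ m' → Core m' q') (sym fixed-m) r' , ℕP.m≤n⇒m≤1+n le , λ e' → ⊥-elim (ℕP.<⇒≱ (ℕ.s≤s le) (ℕP.≤-reflexive (sym e')))
        where
        unmoved : ∀ i {w} → UpView c (β m) i w → w ≡ β m i
        unmoved i (moved x y) = ⊥-elim (ne (D-addable {β m} (Core.heights r') (i , x , y)))
        unmoved i (fixed _) = refl
        fixed-m : sAdd c m ≡ m
        fixed-m = β-ext (sAdd-part c (Core.part r')) (Core.part r') (λ i → trans (sAdd-β c (Core.part r') i) (unmoved i (up-view c (β-dec (Core.part r')) i)))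

  -- Words recovered by exhaustive search.

  anyWord : ∀ k {P : Word n → Set} → (∀ a → Dec (P a)) → Dec (∃[ a ] (length a ≡ k × P a))
  anyWord zero P? = case (P? [])
    where
    case : _ → _
    case (yes p) = yes ([] , refl , p)
    case (no p) = no λ { ([] , _ , q) → p q ; (_ ∷ _ , () , _) }
  anyWord (suc k) P? = case (FP.any? (λ c → anyWord k (λ a → P? (c ∷ a))))
    where
    case : _ → _
    case (yes (c , a , e , p)) = yes (c ∷ a , cong suc e , p)
    case (no p) = no λ { ([] , () , _) ; (c ∷ a , e , q) → p (c , a , ℕP.suc-injective e , q) }

  -- The default `[]` makes the search total, so that the maps of the bijection are defined without
  -- their irrelevant proofs; `chosen-holds` uses existence only afterwards.
  chosen : ∀ {P : Word n → Set} → Dec (∃ P) → Word n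
  chosen (yes (a , _)) = a
  chosen (no _) = []

  chosen-holds : ∀ {P : Word n → Set} (d : Dec (∃ P)) → ∃ P → P (chosen d)
  chosen-holds (yes (_ , p)) _ = p
  chosen-holds (no ¬p) ex = ⊥-elim (¬p ex)

  search : ∀ k {P : Word n → Set} → (∀ a → Dec (P a)) → Word n
  search k P? = chosen (anyWord k P?)

  search-finds : ∀ k {P : Word n → Set} (P? : ∀ a → Dec (P a)) → ∃[ a ] (length a ≡ k × P a) → length (search k P?) ≡ k × P (search k P?)
  search-finds k P? = chosen-holds (anyWord k P?)

  wordBetween : ℕ → Partition → Partition → Word n
  wordBetween k l m = search k {λ a → actP a l ≡ m} (λ a → LP.≡-dec ℕP._≟_ (actP a l) m)

  wordFor : ℕ → Window n → Word n
  wordFor k v = search k {λ a → eval a ≡ v} (λ a → VP.≡-dec ℤP._≟_ (eval a) v)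

  strip⊆ : ∀ {k l m} → HorizontalStrongStrip n k l m → m ⊆ₚ Rop n l
  strip⊆ {k} {l} {m} (_ , _ , ch , e0 , ek , st) i = subst₂ (λ u v → row u i ℕ.≤ row v i) e0 ek (go k ℕP.≤-refl)
    where
    go : ∀ t → t ℕ.≤ k → row (at [] ch 0) i ℕ.≤ row (at [] ch t) i
    go zero _ = ℕP.≤-refl
    go (suc t) le = ℕP.≤-trans (go t (ℕP.<⇒≤ le)) (proj₁ (proj₂ (proj₂ (proj₁ (st t le)))) i)

  weak-of : ∀ {k l m} → k ℕ.≤ n ℕ.∸ 1 → HorizontalStrongStrip n ((n ℕ.∸ 1) ℕ.∸ k) l m →
    ∃[ q ] (Core l q × ∃[ a ] (CD a × length a ≡ k × Acted a l q × m ≡ actP a l))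
  weak-of {k} {l} {m} k≤ (l⊆ , (dl , dm , degl , degm , deg) , ch , e0 , ek , st) = proj₁ cl , proj₁ (proj₂ cl)
      , a , cd , ℕP.+-cancelʳ-≡ _ (length a) k (trans len (sym (ℕP.m+[n∸m]≡n k≤))) , A , trans (sym e0) ch≡
    where
    cl = Deg⇒core degl
    cm = Deg⇒core degm
    core0 : Core (at [] ch 0) (proj₁ cm)
    core0 = subst (λ x → Core x (proj₁ cm)) (sym e0) (proj₁ (proj₂ cm))
    W = Strong⇒Weak.weak (proj₁ (proj₂ cl)) (at [] ch) ((n ℕ.∸ 1) ℕ.∸ k) (subst (l ⊆ₚ_) (sym e0) l⊆) ek st core0
          (trans (ℕP.+-comm (D (proj₁ cm)) _) (trans (cong (((n ℕ.∸ 1) ℕ.∸ k) ℕ.+_) (proj₂ (proj₂ cm))) (trans deg (cong ((n ℕ.∸ 1) ℕ.+_) (sym (proj₂ (proj₂ cl)))))))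
    a = proj₁ W
    cd = proj₁ (proj₂ W)
    A = proj₁ (proj₂ (proj₂ W))
    ch≡ = proj₁ (proj₂ (proj₂ (proj₂ W)))
    len = proj₂ (proj₂ (proj₂ (proj₂ W)))

  module _ (g : ℕ → ℕ) where

    row-low : ∀ y t {i} → i ℕ.< y → row (applyUpTo g y ++ t) (suc i) ≡ g i
    row-low y t {i} lt = go g y i lt
      where
      go : ∀ g y i → i ℕ.< y → row (applyUpTo g y ++ t) (suc i) ≡ g i
      go g (suc y) zero _ = refl
      go g (suc y) (suc i) (ℕ.s≤s lt) = go (λ j → g (suc j)) y i lt

    row-high : ∀ y t j → row (applyUpTo g y ++ t) (suc (y ℕ.+ j)) ≡ row t (suc j)
    row-high y t j = go g y
      where
      go : ∀ g y → row (applyUpTo g y ++ t) (suc (y ℕ.+ j)) ≡ row t (suc j)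
      go g zero = refl
      go g (suc y) = go (λ i → g (suc i)) y

  shape-part : ∀ g y {t} → IsPartition t → (∀ i → 1 ℕ.≤ g i) → (∀ i → suc i ℕ.< y → g (suc i) ℕ.≤ g i) → (∀ i → suc i ≡ y → row t 1 ℕ.≤ g i) →
    IsPartition (applyUpTo g y ++ t)
  shape-part g zero p _ _ _ = p
  shape-part g (suc zero) p pos _ last = cons-part (pos 0) (last 0 refl) p
  shape-part g (suc (suc y)) p pos mono last = cons-part (pos 0) (mono 0 (ℕ.s≤s (ℕ.s≤s ℕ.z≤n)))
    (shape-part (λ i → g (suc i)) (suc y) p (λ i → pos (suc i)) (λ i lt → mono (suc i) (ℕ.s≤s lt)) (λ i e → last (suc i) (cong suc e)))

  -- The bijection between countertableaux and factorizations.

  module Bijection {r : ℕ} (α : Vec ℕ r) (α≤ : ∀ x → x ℕ.< r → at 0 α x ℕ.≤ n ℕ.∸ 1) (lam : Partition) (w : Window n)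
    (a₀ : Word n) (A₀ : Acted a₀ [] ground) (lam≡ : lam ≡ actP a₀ []) (eval≡ : eval a₀ ≡ w) (sum≡ : V.sum α ≡ length a₀) where

    L : (ℕ → Word n) → ℕ → Partition
    L as x = actP (tot as x) []

    Q : (ℕ → Word n) → ℕ → Vec ℤ n
    Q as x = qacts (tot as x) ground

    L-suc : ∀ as x → L as (suc x) ≡ actP (as x) (L as x)
    L-suc as x = LP.foldr-++ sAdd [] (as x) (tot as x)

    -- The common ground of both sides: a factorization supplies such words directly, a
    -- countertableau through its strong strips. Only the first r entries carry information.
    record Factorization (as : ℕ → Word n) : Set where
      field
        cyc : ∀ x → x ℕ.< r → CD (as x)
        len : ∀ x → x ℕ.< r → length (as x) ≡ at 0 α x
        total : Acted (tot as r) [] ground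
        ends : L as r ≡ lam

      prefix : ∀ s x → s ℕ.+ x ≡ r → Acted (tot as x) [] ground
      prefix zero x refl = total
      prefix (suc s) x e = proj₁ (acted-split (as x) (tot as x) core-[] (prefix s (suc x) (trans (ℕP.+-suc s x) e)))

      upto : ∀ x → x ℕ.≤ r → Acted (tot as x) [] ground
      upto x le = prefix (r ℕ.∸ x) x (ℕP.m∸n+n≡m le)

      core-at : ∀ x → x ℕ.≤ r → Core (L as x) (Q as x)
      core-at x le = Acted.core (upto x le)

      step : ∀ x → x ℕ.< r → Acted (as x) (L as x) (Q as x)
      step x lt = proj₂ (acted-split (as x) (tot as x) core-[] (upto (suc x) lt))

      step⊆ : ∀ x → x ℕ.< r → L as x ⊆ₚ L as (suc x)
      step⊆ x lt = subst (L as x ⊆ₚ_) (sym (L-suc as x)) (⊆⇒⊆ₚ {L as x} {actP (as x) (L as x)} (acted-⊆ (as x) (core-at x (ℕP.<⇒≤ lt)) (step x lt)))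

      strip : ∀ x → x ℕ.< r → HorizontalStrongStrip n ((n ℕ.∸ 1) ℕ.∸ at 0 α x) (L as x) (L as (suc x))
      strip x lt = subst (HorizontalStrongStrip n _ (L as x)) (sym (L-suc as x))
        (Weak⇒Strong.strong (tot as x) (upto x (ℕP.<⇒≤ lt)) (cyc x lt) (step x lt) (trans (cong (ℕ._+ ((n ℕ.∸ 1) ℕ.∸ at 0 α x)) (len x lt)) (ℕP.m+[n∸m]≡n (α≤ x lt))))

    open Factorization

    -- The partition with index y consists of y further rows below the core with index r - y, so a
    -- countertableau determines its cores by deleting rows.
    lams : Vec Partition (suc r) → ℕ → Partition
    lams mus x = drop (r ℕ.∸ x) (at [] mus (r ℕ.∸ x))

    first : (ℕ → Partition) → ℕ → ℕ
    first K i = row (K (r ℕ.∸ suc i)) 1 ℕ.+ (n ℕ.∸ 1)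

    shape : (ℕ → Partition) → ℕ → Partition
    shape K zero = K r
    shape K (suc y) = applyUpTo (first K) y ++ Rop n (K (r ℕ.∸ suc y))

    drop-shape-lam : ∀ K y → drop y (shape K y) ≡ K (r ℕ.∸ y)
    drop-shape-lam K zero = refl
    drop-shape-lam K (suc y) = go (first K) y
      where
      go : ∀ g y {h t} → drop (suc y) (applyUpTo g y ++ h ∷ t) ≡ t
      go g zero = refl
      go g (suc y) = go (λ i → g (suc i)) y

    musOf : (ℕ → Partition) → Vec Partition (suc r)
    musOf K = tabulate (λ i → shape K (toℕ i))

    at-musOf : ∀ K {x} → x ℕ.≤ r → at [] (musOf K) x ≡ shape K x
    at-musOf K le = at-tabulate [] (shape K) (ℕ.s≤s le)

    windows : (ℕ → Partition) → Vec (Window n) r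
    windows K = tabulate (λ i → eval (wordBetween (at 0 α (toℕ i)) (K (toℕ i)) (K (suc (toℕ i)))))

    cores : Vec (Window n) r → ℕ → Partition
    cores vs zero = []
    cores vs (suc x) = actP (wordFor (at 0 α x) (at idW vs x)) (cores vs x)

    shape-cong : ∀ {K K'} → (∀ x → x ℕ.≤ r → K x ≡ K' x) → ∀ y → y ℕ.≤ r → shape K y ≡ shape K' y
    shape-cong h zero _ = h r ℕP.≤-refl
    shape-cong {K} {K'} h (suc y) le = cong₂ _++_ (prefix≡ y (first K) (first K') (λ i → cong (λ l → row l 1 ℕ.+ (n ℕ.∸ 1)) (h (r ℕ.∸ suc i) (ℕP.m∸n≤m r (suc i)))))
        (cong (Rop n) (h (r ℕ.∸ suc y) (ℕP.m∸n≤m r (suc y))))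
      where
      prefix≡ : ∀ y g g' → (∀ i → g i ≡ g' i) → applyUpTo g y ≡ applyUpTo g' y
      prefix≡ zero g g' h = refl
      prefix≡ (suc y) g g' h = cong₂ _∷_ (h 0) (prefix≡ y (λ i → g (suc i)) (λ i → g' (suc i)) (λ i → h (suc i)))

    musOf-cong : ∀ {K K'} → (∀ x → x ℕ.≤ r → K x ≡ K' x) → musOf K ≡ musOf K'
    musOf-cong {K} {K'} h = vec-ext [] (musOf K) (musOf K') (λ x lt → trans (at-musOf K (ℕ.s≤s⁻¹ lt)) (trans (shape-cong h x (ℕ.s≤s⁻¹ lt)) (sym (at-musOf K' (ℕ.s≤s⁻¹ lt)))))

    row-shape : ∀ K t → row (shape K (suc t)) (suc t) ≡ first K t
    row-shape K t = trans (cong (λ i → row (shape K (suc t)) (suc i)) (sym (ℕP.+-identityʳ t))) (row-high (first K) t (Rop n (K (r ℕ.∸ suc t))) 0)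

    applyUpTo-≗ : ∀ y (f : ℕ → ℕ) g → (∀ i → i ℕ.< y → f i ≡ g i) → applyUpTo f y ≡ applyUpTo g y
    applyUpTo-≗ zero f g h = refl
    applyUpTo-≗ (suc y) f g h = cong₂ _∷_ (h 0 (ℕ.s≤s ℕ.z≤n)) (applyUpTo-≗ y (λ i → f (suc i)) (λ i → g (suc i)) (λ i lt → h (suc i) (ℕ.s≤s lt)))

    muShape-shape : ∀ (mus : Vec Partition (suc r)) K y → (∀ t → t ℕ.< y → row (at [] mus (suc t)) (suc t) ≡ first K t) →
      muShape n mus (suc y) (K (r ℕ.∸ suc y)) ≡ shape K (suc y)
    muShape-shape mus K y h = cong (_++ Rop n (K (r ℕ.∸ suc y)))
      (trans (LP.map-applyUpTo suc (λ t → row (at [] mus t) t) y) (applyUpTo-≗ y (λ i → row (at [] mus (suc i)) (suc i)) (first K) h))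

    IsABC⇒shape : ∀ {mus} ((_ , _ , _ , K , _) : IsABC n lam α mus) → ∀ y → y ℕ.≤ r → at [] mus y ≡ shape (at [] K) y
    IsABC⇒shape {mus} (_ , m0 , _ , K , _ , Kr , _ , _ , shp) y le = go y y ℕP.≤-refl le
      where
      go : ∀ b y → y ℕ.≤ b → y ℕ.≤ r → at [] mus y ≡ shape (at [] K) y
      go b zero _ _ = trans m0 (sym Kr)
      go (suc b) (suc y) (ℕ.s≤s y≤b) le = trans (shp (suc y) (ℕ.s≤s ℕ.z≤n) le) (muShape-shape mus (at [] K) y
        (λ t lt → trans (cong (λ l → row l (suc t)) (go b (suc t) (ℕP.≤-trans lt y≤b) (ℕP.≤-trans (ℕP.≤-trans lt (ℕP.n≤1+n y)) le))) (row-shape (at [] K) t)))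

    record Encodes (mus : Vec Partition (suc r)) (as : ℕ → Word n) : Set where
      field
        fact : Factorization as
        shapes : ∀ x → x ℕ.≤ r → at [] mus x ≡ shape (L as) x

    encodes-lams : ∀ {mus as} → Encodes mus as → ∀ x → x ℕ.≤ r → lams mus x ≡ L as x
    encodes-lams {mus} {as} e x le = trans (cong (drop (r ℕ.∸ x)) (Encodes.shapes e (r ℕ.∸ x) (ℕP.m∸n≤m r x)))
      (trans (drop-shape-lam (L as) (r ℕ.∸ x)) (cong (L as) (ℕP.m∸[m∸n]≡n le)))

    encode-ABC : ∀ {mus} → IsABC n lam α mus → ∃[ as ] Encodes mus as
    encode-ABC {mus} abc@(_ , _ , _ , K , K0 , Kr , _ , hss , _) = as , record { fact = fact ; shapes = λ x le → trans (IsABC⇒shape abc x le) (shape-cong (λ x le → sym (proj₂ (upto' x le))) x le) }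
      where
      W : ∀ x → x ℕ.< r → ∃[ q ] (Core (at [] K x) q × ∃[ a ] (CD a × length a ≡ at 0 α x × Acted a (at [] K x) q × at [] K (suc x) ≡ actP a (at [] K x)))
      W x lt = weak-of (α≤ x lt) (hss (suc x) (ℕ.s≤s ℕ.z≤n) lt)
      as : ℕ → Word n
      as x = pick (x ℕP.<? r)
        where
        pick : Dec (x ℕ.< r) → Word n
        pick (yes lt) = proj₁ (proj₂ (proj₂ (W x lt)))
        pick (no _) = []
      props : ∀ x → x ℕ.< r → ∃[ q ] (Core (at [] K x) q × CD (as x) × length (as x) ≡ at 0 α x × Acted (as x) (at [] K x) q × at [] K (suc x) ≡ actP (as x) (at [] K x))
      props x lt with x ℕP.<? r
      ... | yes lt' = let (q , c , a , rest) = W x lt' in q , c , rest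
      ... | no ¬lt = ⊥-elim (¬lt lt)
      upto' : ∀ x → x ℕ.≤ r → Acted (tot as x) [] ground × L as x ≡ at [] K x
      upto' zero _ = acted-[] core-[] , sym K0
      upto' (suc x) lt = next (upto' x (ℕP.<⇒≤ lt)) (props x lt)
        where
        next : Acted (tot as x) [] ground × L as x ≡ at [] K x →
          ∃[ q ] (Core (at [] K x) q × CD (as x) × length (as x) ≡ at 0 α x × Acted (as x) (at [] K x) q × at [] K (suc x) ≡ actP (as x) (at [] K x)) →
          Acted (tot as (suc x)) [] ground × L as (suc x) ≡ at [] K (suc x)
        next (A , e) (q , c , _ , _ , B , e') = acted-++ (as x) (tot as x) core-[] A B' , trans (L-suc as x) (trans (cong (actP (as x)) e) (sym e'))
          where
          cB : Core (L as x) q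
          cB = subst (λ l → Core l q) (sym e) c
          B' : Acted (as x) (L as x) (Q as x)
          B' = subst₂ (Acted (as x)) (sym e) (core-unique cB (Acted.core A)) B
      fact : Factorization as
      fact = record { cyc = λ x lt → proj₁ (proj₂ (proj₂ (props x lt))) ; len = λ x lt → proj₁ (proj₂ (proj₂ (proj₂ (props x lt))))
        ; total = proj₁ (upto' r ℕP.≤-refl) ; ends = trans (proj₂ (upto' r ℕP.≤-refl)) Kr }

    -- The word found by the search is only known to have the right length and to lead from one core
    -- to the next under `actP`, where letters may idle. The degrees show that it adds corners at
    -- every letter; so both products create the same core from the empty one, `word-unique`
    -- identifies them, and the common right factor cancels.
    windows-eval : ∀ {as} (f : Factorization as) {K} → (∀ x → x ℕ.≤ r → K x ≡ L as x) → ∀ x → x ℕ.< r → at idW (windows K) x ≡ eval (as x)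
    windows-eval {as} f {K} K≡ x lt = trans (at-tabulate idW (λ x → eval (wordBetween (at 0 α x) (K x) (K (suc x)))) lt) (run⇒eval {b} {as x} same-run)
      where
      b = wordBetween (at 0 α x) (K x) (K (suc x))
      found = search-finds (at 0 α x) {λ a → actP a (K x) ≡ K (suc x)} (λ a → LP.≡-dec ℕP._≟_ (actP a (K x)) (K (suc x)))
        (as x , len f x lt , trans (cong (actP (as x)) (K≡ x (ℕP.<⇒≤ lt))) (trans (sym (L-suc as x)) (sym (K≡ (suc x) lt))))
      b-acts : actP b (L as x) ≡ L as (suc x)
      b-acts = trans (cong (actP b) (sym (K≡ x (ℕP.<⇒≤ lt)))) (trans (proj₂ found) (K≡ (suc x) lt))
      cx = core-at f x (ℕP.<⇒≤ lt)
      bound = actP-bound b cx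
      q≡ : proj₁ bound ≡ Q as (suc x)
      q≡ = core-unique (proj₁ (proj₂ bound)) (subst (λ l → Core l (Q as (suc x))) (sym b-acts) (core-at f (suc x) lt))
      degree : D (proj₁ bound) ≡ length b ℕ.+ D (Q as x)
      degree = trans (cong D (trans q≡ (qacts-++ (as x) (tot as x) ground))) (trans (Acted.degree (step f x lt)) (cong (ℕ._+ D (Q as x)) (trans (len f x lt) (sym (proj₁ found)))))
      B : Acted b (L as x) (Q as x)
      B = proj₂ (proj₂ (proj₂ bound)) degree
      AB : Acted (b ++ tot as x) [] ground
      AB = acted-++ b (tot as x) core-[] (upto f x (ℕP.<⇒≤ lt)) B
      same-total : ∀ z → run (b ++ tot as x) z ≡ run (tot as (suc x)) z
      same-total = word-unique {b ++ tot as x} {tot as (suc x)} {L as (suc x)}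
        (subst (WordAct n (b ++ tot as x) []) (trans (LP.foldr-++ sAdd [] b (tot as x)) b-acts) (Acted.act AB)) (Acted.act (upto f (suc x) lt))
      same-run : ∀ z → run b z ≡ run (as x) z
      same-run z = subst (λ y → run b y ≡ run (as x) y) (run-run⁻¹ (tot as x) z)
        (trans (sym (run-++ b (tot as x) _)) (trans (same-total (run⁻¹ (tot as x) z)) (run-++ (as x) (tot as x) _)))

    encode-AF : ∀ {vs} → IsAffineFactorization w α vs → ∃[ as ] (Factorization as × (∀ x → x ℕ.< r → eval (as x) ≡ at idW vs x))
    encode-AF {vs} (cds , ws , evs , prod) = as , record { cyc = λ x lt → proj₁ (proj₂ (props x lt)) ; len = λ x lt → proj₂ (proj₂ (props x lt)) ; total = proj₁ tots ; ends = trans (proj₂ tots) (sym lam≡) } , λ x lt → proj₁ (props x lt)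
      where
      as : ℕ → Word n
      as x = pick (x ℕP.<? r)
        where
        pick : Dec (x ℕ.< r) → Word n
        pick (yes lt) = proj₁ (proj₁ (cds x lt))
        pick (no _) = []
      good : ∀ x → (c : CycDec (at idW vs x) × Len (at idW vs x) (at 0 α x)) → eval (proj₁ (proj₁ c)) ≡ at idW vs x × CD (proj₁ (proj₁ c)) × length (proj₁ (proj₁ c)) ≡ at 0 α x
      good x ((a , e , red , u , o) , ((b , lb , eb) , min)) = e , ordered⇒CD a u o , ℕP.≤-antisym (ℕP.≤-trans (red b (trans eb (sym e))) (ℕP.≤-reflexive lb)) (min a e)
      props : ∀ x → x ℕ.< r → eval (as x) ≡ at idW vs x × CD (as x) × length (as x) ≡ at 0 α x
      props x lt with x ℕP.<? r
      ... | yes lt' = good x (cds x lt')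
      ... | no ¬lt = ⊥-elim (¬lt lt)
      runs : ∀ z → run (tot as r) z ≡ run a₀ z
      runs z = trans (tot-run r (λ x lt → eval⇒run {as x} {at [] ws x} (trans (proj₁ (props x lt)) (sym (evs x lt)))) z)
        (eval⇒run {tot (at [] ws) r} {a₀} (trans (trans (cong eval (sym (concat-reverse ws))) prod) (sym eval≡)) z)
      -- The product is the same element as `a₀`, and the parts of α add up to the length of `a₀`;
      -- so it raises the degree by its own length.
      tots : Acted (tot as r) [] ground × L as r ≡ actP a₀ []
      tots = acted-same {a₀} {tot as r} core-[] A₀ runs (trans (tot-length α as (λ x lt → proj₂ (proj₂ (props x lt)))) sum≡)

    cores-L : ∀ {as vs} → Factorization as → (∀ x → x ℕ.< r → eval (as x) ≡ at idW vs x) → ∀ x → x ℕ.≤ r → cores vs x ≡ L as x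
    cores-L f h zero _ = refl
    cores-L {as} {vs} f h (suc x) lt = trans (cong (actP b) (cores-L {as} {vs} f h x (ℕP.<⇒≤ lt))) (trans (proj₂ both) (sym (L-suc as x)))
      where
      b = wordFor (at 0 α x) (at idW vs x)
      found = search-finds (at 0 α x) {λ a → eval a ≡ at idW vs x} (λ a → VP.≡-dec ℤP._≟_ (eval a) (at idW vs x)) (as x , len f x lt , h x lt)
      both = acted-same {as x} {b} (core-at f x (ℕP.<⇒≤ lt)) (step f x lt) (eval⇒run {b} {as x} (trans (proj₂ found) (sym (h x lt)))) (trans (proj₁ found) (sym (len f x lt)))

    module _ {as : ℕ → Word n} (f : Factorization as) where
      private
        K = L as

        part : ∀ x → x ℕ.≤ r → IsPartition (K x)
        part x le = Core.part (core-at f x le)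

        first-mono : ∀ i → suc (suc i) ℕ.≤ r → first K (suc i) ℕ.≤ first K i
        first-mono i le = ℕP.+-monoˡ-≤ (n ℕ.∸ 1) (subst (λ x → row (K (r ℕ.∸ suc (suc i))) 1 ℕ.≤ row (K x) 1) (sym (r∸ le))
          (step⊆ f (r ℕ.∸ suc (suc i)) (ℕP.≤-trans (ℕP.≤-reflexive (sym (r∸ le))) (ℕP.m∸n≤m r (suc i))) 1))

        shape-partition : ∀ y → y ℕ.≤ r → IsPartition (shape K y)
        shape-partition zero _ = part r ℕP.≤-refl
        shape-partition (suc y) le = shape-part (first K) y (Rop-part (part (r ℕ.∸ suc y) (ℕP.m∸n≤m r (suc y))))
          (λ i → ℕP.≤-trans 1≤n-1 (ℕP.m≤n+m _ (row (K (r ℕ.∸ suc i)) 1)))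
          (λ i lt → first-mono i (ℕP.≤-trans lt (ℕP.≤-trans (ℕP.n≤1+n y) le)))
          (λ { i refl → first-mono i le })

        upper-low : ∀ y {i} → i ℕ.< y → row (shape K (suc y)) (suc i) ≡ first K i
        upper-low y lt = row-low (first K) y (Rop n (K (r ℕ.∸ suc y))) lt

        upper-high : ∀ y j → row (shape K (suc y)) (suc (y ℕ.+ j)) ≡ row (Rop n (K (r ℕ.∸ suc y))) (suc j)
        upper-high y j = row-high (first K) y (Rop n (K (r ℕ.∸ suc y))) j

        lower-low : ∀ y {i} → i ℕ.< y → row (shape K y) (suc i) ≡ first K i
        lower-low (suc y) {i} (ℕ.s≤s le) with ℕP.m≤n⇒m<n∨m≡n le
        ... | inj₁ lt = upper-low y lt
        ... | inj₂ refl = row-shape K i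

        lower-high : ∀ y j → row (shape K y) (suc (y ℕ.+ j)) ≡ row (K (r ℕ.∸ y)) (suc j)
        lower-high zero j = refl
        lower-high (suc y) j = trans (cong (λ i → row (shape K (suc y)) (suc i)) (sym (ℕP.+-suc y j))) (upper-high y (suc j))

      -- The lowest y rows agree. Above them the strong strip gives the inclusion. With z = r - y -
      -- 1, the later rows of `Rop n (K z)` are rows of `K z` moved up by one, so each fits within
      -- the row just below it of the smaller shape, and no two new cells share a column.
      horizontal : ∀ y → suc y ℕ.≤ r → HorizontalStrip (shape K y) (shape K (suc y))
      horizontal y lt = included , columns
        where
        z = r ℕ.∸ suc y
        z< : z ℕ.< r
        z< = ℕP.≤-trans (ℕP.≤-reflexive (sym (r∸ lt))) (ℕP.m∸n≤m r y)
        K⊆ : K (r ℕ.∸ y) ⊆ₚ Rop n (K z)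
        K⊆ = subst (λ x → K x ⊆ₚ Rop n (K z)) (sym (r∸ lt)) (strip⊆ {l = K z} (strip f z z<))
        ⊆K : K z ⊆ₚ K (r ℕ.∸ y)
        ⊆K = subst (λ x → K z ⊆ₚ K x) (sym (r∸ lt)) (step⊆ f z z<)
        included : shape K y ⊆ₚ shape K (suc y)
        included zero = ℕ.z≤n
        included (suc i) with ℕP.<-≤-connex i y
        ... | inj₁ lt' = ℕP.≤-reflexive (trans (lower-low y lt') (sym (upper-low y lt')))
        ... | inj₂ le with ℕP.m≤n⇒∃[o]m+o≡n le
        ...   | j , refl = subst₂ ℕ._≤_ (sym (lower-high y j)) (sym (upper-high y j)) (K⊆ (suc j))
        blocked : ∀ i i' → i ℕ.< i' → ∀ j → InDiagram (shape K (suc y)) i j → ¬ InDiagram (shape K y) i j → InDiagram (shape K (suc y)) i' j → ⊥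
        blocked zero i' _ j (() , _) _ _
        blocked (suc i) (suc i') (ℕ.s≤s i<i') j (_ , 1≤j , u) out (_ , _ , u') with ℕP.<-≤-connex i y
        ... | inj₁ lt' = out (ℕ.s≤s ℕ.z≤n , 1≤j , subst (j ℕ.≤_) (trans (upper-low y lt') (sym (lower-low y lt'))) u)
        ... | inj₂ le with ℕP.m≤n⇒∃[o]m+o≡n (ℕP.≤-trans le (ℕP.<⇒≤ i<i')) | ℕP.m≤n⇒∃[o]m+o≡n le
        ...   | zero , e | k , refl = ℕP.<⇒≱ i<i' (ℕP.≤-trans (ℕP.≤-reflexive (trans (sym e) (ℕP.+-identityʳ y))) (ℕP.m≤m+n y k))
        ...   | suc k' , refl | k , refl = out (ℕ.s≤s ℕ.z≤n , 1≤j , ℕP.≤-trans u' (ℕP.≤-trans (ℕP.≤-reflexive (upper-high y (suc k')))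
                  (ℕP.≤-trans (⊆K (suc k')) (ℕP.≤-trans (row-mono (part (r ℕ.∸ y) (ℕP.m∸n≤m r y)) k≤k') (ℕP.≤-reflexive (sym (lower-high y k)))))))
          where
          k≤k' : k ℕ.≤ k'
          k≤k' = ℕ.s≤s⁻¹ (ℕP.+-cancelˡ-≤ y (suc k) (suc k') (ℕP.≤-trans (ℕP.≤-reflexive (ℕP.+-suc y k)) i<i'))
        columns : ∀ i i' j → InDiagram (shape K (suc y)) i j → ¬ InDiagram (shape K y) i j →
          InDiagram (shape K (suc y)) i' j → ¬ InDiagram (shape K y) i' j → i ≡ i'
        columns i i' j u o u' o' with ℕP.<-cmp i i'
        ... | tri< lt' _ _ = ⊥-elim (blocked i i' lt' j u o u')
        ... | tri≈ _ e _ = e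
        ... | tri> _ _ gt = ⊥-elim (blocked i' i gt j u' o' u)

      isABC : IsABC n lam α (musOf K)
      isABC = (λ x le → subst IsPartition (sym (at-musOf K le)) (shape-partition x le))
        , trans (at-musOf K ℕ.z≤n) (ends f)
        , strips
        , lamv
        , at-lam ℕ.z≤n , trans (at-lam ℕP.≤-refl) (ends f)
        , (λ x le → subst (IsCore n) (sym (at-lam le)) (core⇒IsCore (core-at f x le)))
        , strongs
        , shapes
        where
        lamv : Vec Partition (suc r)
        lamv = tabulate (λ i → K (toℕ i))
        at-lam : ∀ {x} → x ℕ.≤ r → at [] lamv x ≡ K x
        at-lam le = at-tabulate [] K (ℕ.s≤s le)
        strips : ∀ x → 1 ℕ.≤ x → x ℕ.≤ r → HorizontalStrip (at [] (musOf K) (x ℕ.∸ 1)) (at [] (musOf K) x)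
        strips (suc y) _ le = subst₂ HorizontalStrip (sym (at-musOf K (ℕP.<⇒≤ le))) (sym (at-musOf K le)) (horizontal y le)
        strongs : ∀ x → 1 ℕ.≤ x → x ℕ.≤ r → HorizontalStrongStrip n ((n ℕ.∸ 1) ℕ.∸ at 0 α (x ℕ.∸ 1)) (at [] lamv (x ℕ.∸ 1)) (at [] lamv x)
        strongs (suc y) _ le = subst₂ (HorizontalStrongStrip n _) (sym (at-lam (ℕP.<⇒≤ le))) (sym (at-lam le)) (strip f y le)
        shapes : ∀ x → 1 ℕ.≤ x → x ℕ.≤ r → at [] (musOf K) x ≡ muShape n (musOf K) x (at [] lamv (r ℕ.∸ x))
        shapes (suc y) _ le = trans (at-musOf K le) (sym (trans (cong (muShape n (musOf K) (suc y)) (at-lam (ℕP.m∸n≤m r (suc y))))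
          (muShape-shape (musOf K) K y (λ t lt → trans (cong (λ l → row l (suc t)) (at-musOf K (ℕP.≤-trans lt (ℕP.≤-trans (ℕP.n≤1+n y) le)))) (row-shape K t)))))

      isAF : ∀ {vs} → (∀ x → x ℕ.< r → at idW vs x ≡ eval (as x)) → IsAffineFactorization w α vs
      isAF {vs} h = (λ x lt → subst (λ v → CycDec v × Len v (at 0 α x)) (sym (h x lt)) (cycDec x lt))
        , wv , (λ x lt → trans (cong eval (at-w lt)) (sym (h x lt)))
        , trans (cong eval (concat-reverse wv)) (trans (run⇒eval {tot (at [] wv) r} {a₀} (λ z → trans (tot-run r (λ x lt z → cong (λ a → run a z) (at-w lt)) z)
            (word-unique {tot as r} {a₀} {lam} (subst (WordAct n (tot as r) []) (ends f) (Acted.act (total f))) (subst (WordAct n a₀ []) (sym lam≡) (Acted.act A₀)) z))) eval≡)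
        where
        wv : Vec (Word n) r
        wv = tabulate (λ i → as (toℕ i))
        at-w : ∀ {x} → x ℕ.< r → at [] wv x ≡ as x
        at-w = at-tabulate [] as
        cycDec : ∀ x → x ℕ.< r → CycDec (eval (as x)) × Len (eval (as x)) (at 0 α x)
        cycDec x lt = (as x , refl , red , CD⇒unique (as x) (cyc f x lt) , CD⇒ordered (as x) (cyc f x lt))
            , subst (Len (eval (as x))) (len f x lt) ((as x , refl , refl) , red)
          where
          red : Reduced (as x)
          red = acted-Reduced (core-at f x (ℕP.<⇒≤ lt)) (step f x lt)

    toAF : Vec Partition (suc r) → Vec (Window n) r
    toAF mus = windows (lams mus)

    toABC : Vec (Window n) r → Vec Partition (suc r)
    toABC vs = musOf (cores vs)

    toAF-correct : ∀ {mus} → IsABC n lam α mus → IsAffineFactorization w α (toAF mus)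
    toAF-correct abc = let (as , e) = encode-ABC abc in isAF (Encodes.fact e) (windows-eval (Encodes.fact e) (encodes-lams e))

    toABC-correct : ∀ {vs} → IsAffineFactorization w α vs → IsABC n lam α (toABC vs)
    toABC-correct {vs} af = let (as , f , h) = encode-AF af in
      subst (IsABC n lam α) (sym (musOf-cong (cores-L {as} {vs} f h))) (isABC f)

    toABC-toAF : ∀ {mus} → IsABC n lam α mus → toABC (toAF mus) ≡ mus
    toABC-toAF {mus} abc = let (as , e) = encode-ABC abc ; f = Encodes.fact e in
      vec-ext [] (toABC (toAF mus)) mus (λ x lt → trans (at-musOf (cores (toAF mus)) (ℕ.s≤s⁻¹ lt))
        (trans (shape-cong (cores-L {as} {toAF mus} f (λ x lt → sym (windows-eval f (encodes-lams e) x lt))) x (ℕ.s≤s⁻¹ lt)) (sym (Encodes.shapes e x (ℕ.s≤s⁻¹ lt)))))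

    toAF-toABC : ∀ {vs} → IsAffineFactorization w α vs → toAF (toABC vs) ≡ vs
    toAF-toABC {vs} af = let (as , f , h) = encode-AF af in
      vec-ext idW (toAF (toABC vs)) vs (λ x lt → trans (windows-eval f (lams-cores f h) x lt) (h x lt))
      where
      lams-cores : ∀ {as} (f : Factorization as) → (∀ x → x ℕ.< r → eval (as x) ≡ at idW vs x) → ∀ x → x ℕ.≤ r → lams (toABC vs) x ≡ L as x
      lams-cores {as} f h x le = trans (cong (drop (r ℕ.∸ x)) (at-musOf (cores vs) (ℕP.m∸n≤m r x)))
        (trans (drop-shape-lam (cores vs) (r ℕ.∸ x)) (trans (cong (cores vs) (ℕP.m∸[m∸n]≡n le)) (cores-L {as} {vs} f h x le)))

    bijection : ABC n lam α ↔ AffineFactorizations w α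
    bijection = mk↔ₛ′ (λ { (mus , [ p ]) → toAF mus , [ toAF-correct p ] }) (λ { (vs , [ p ]) → toABC vs , [ toABC-correct p ] })
      -- The round-trip equations depend on the irrelevant `p`; decidability of equality makes them
      -- relevant again.
      (λ { (vs , [ p ]) → Σ≡ (recompute (VP.≡-dec (VP.≡-dec ℤP._≟_) _ _) (toAF-toABC p)) })
      (λ { (mus , [ p ]) → Σ≡ (recompute (VP.≡-dec (LP.≡-dec ℕP._≟_) _ _) (toABC-toAF p)) })
      where
      Σ≡ : ∀ {A : Set} {B : A → Set} {x y : A} {p : Irrelevant (B x)} {q : Irrelevant (B y)} → x ≡ y → (x , p) ≡ (y , q)
      Σ≡ refl = refl

mainTheorem9 : (n : ℕ) → {{_ : ℕ.NonZero n}} → 2 ℕ.≤ n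
    → (lam : Partition) → IsCore n lam
    → (w : Window n) → AffGrass w → Frak n w lam
    → (d : ℕ) → Len w d
    → (r : ℕ) → 1 ℕ.≤ r → (α : Vec ℕ r) → VA.All (λ a → a ℕ.< n) α → V.sum α ≡ d
    → ABC n lam α ↔ AffineFactorizations w α
mainTheorem9 n 2≤n lam _ w _ (a , eval≡ , reduced , act) d ((b , length≡ , eval-b≡) , minimal) r _ α α<n sum≡ =
  Bijection.bijection α (parts≤ α α<n) lam w a (proj₂ acted) (proj₁ acted) eval≡ (trans sum≡ d≡)
  where
  open Cores n 2≤n
  acted = wordAct⇒acted a core-[] act
  -- The length of w and the reduced word that creates the core come with separate minimality
  -- statements, which are compared here.
  d≡ : d ≡ length a
  d≡ = ℕP.≤-antisym (minimal a eval≡) (ℕP.≤-trans (reduced b (trans eval-b≡ (sym eval≡))) (ℕP.≤-reflexive length≡))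
  parts≤ : ∀ {r} (α : Vec ℕ r) → VA.All (λ a → a ℕ.< n) α → ∀ x → x ℕ.< r → at 0 α x ℕ.≤ n ℕ.∸ 1
  parts≤ (k ∷ _) (k<n VA.∷ _) zero _ = ℕP.≤-pred (ℕP.≤-trans k<n (ℕP.≤-reflexive (sym (ℕP.suc-pred n))))
  parts≤ (_ ∷ α) (_ VA.∷ α<n) (suc x) (ℕ.s≤s lt) = parts≤ α α<n x lt
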